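{- Let $q\le5$ be a prime power. Every maximum scattered $\mathbb F_q$-linear set in $\mathrm{PG}(1,q^5)$ is either of pseudoregulus type or of LP type.
   Context: An $\mathbb F_q$-linear set of rank 5 in $\mathrm{PG}(1,q^5)$ is $L_U=\{\langle v\rangle_{\mathbb F_{q^5}}:v\in U\setminus\{0\}\}$ for a 5-dimensional $\mathbb F_q$-subspace $U\subseteq\mathbb F_{q^5}^2$; it is maximum scattered if it has $(q^5-1)/(q-1)$ points (rank 5 being the maximum possible for scattered linear sets in $\mathrm{PG}(1,q^5)$). It is of pseudoregulus type if it is $\mathrm{P\Gamma L}(2,q^5)$-equivalent to $\{\langle(x,x^{q^s})\rangle_{\mathbb F_{q^5}}:x\in\mathbb F_{q^5}^*\}$ with $\gcd(s,5)=1$, and of LP type if equivalent to $\{\langle(x,x^{q^s}+\delta x^{q^{5-s}})\rangle_{\mathbb F_{q^5}}:x\in\mathbb F_{q^5}^*\}$ with $\gcd(s,5)=1$, $\mathrm N_{q^5/q}(\delta)\notin\{0,1\}$, where $\mathrm N_{q^5/q}(x)=x^{1+q+q^2+q^3+q^4}$. -}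

module Defs where

open import Data.Nat as ℕ using (ℕ; zero; suc)
open import Data.Nat.Primality using (Prime)
open import Data.Nat.GCD using (gcd)
open import Data.Fin using (Fin) renaming (zero to fzero; suc to fsuc)
open import Data.Product using (Σ; ∃; ∃-syntax; Σ-syntax; _×_; _,_)
open import Data.List using (List; length; _∷_; [])
open import Data.List.Relation.Unary.All using (All)
open import Data.List.Relation.Unary.Any using (Any)
open import Data.List.Relation.Unary.AllPairs using (AllPairs)
open import Relation.Binary.PropositionalEquality using (_≡_; _≢_)
open import Relation.Nullary using (¬_)
open import Algebra.Structures using (IsCommutativeRing)
open import Function.Bundles using (_↔_)

record Field : Set₁ where
  infixl 6 _+_
  infixl 7 _*_
  field
    Carrier : Set
    _+_ _*_ : Carrier → Carrier → Carrier
    -_      : Carrier → Carrier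
    0# 1#   : Carrier
    isCommutativeRing : IsCommutativeRing _≡_ _+_ _*_ -_ 0# 1#
    0≢1     : 0# ≢ 1#
    inverse : ∀ x → x ≢ 0# → ∃[ y ] (x * y ≡ 1#)

HasCard : Field → ℕ → Set
HasCard F n = Fin n ↔ Field.Carrier F

IsPrimePower : ℕ → Set
IsPrimePower q = ∃[ p ] ∃[ k ] (Prime p × q ≡ p ℕ.^ suc k)

module _ (F : Field) where
  open Field F

  _^ᶠ_ : Carrier → ℕ → Carrier
  x ^ᶠ zero  = 1#
  x ^ᶠ suc n = x * (x ^ᶠ n)

  V : Set
  V = Carrier × Carrier

  0V : V
  0V = (0# , 0#)

  _⊕_ : V → V → V
  (a , b) ⊕ (c , d) = (a + c , b + d)

  _·_ : Carrier → V → V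
  λ₀ · (a , b) = (λ₀ * a , λ₀ * b)

  sumV : (n : ℕ) → (Fin n → V) → V
  sumV zero    f = 0V
  sumV (suc n) f = f fzero ⊕ sumV n (λ i → f (fsuc i))

  InFq : ℕ → Carrier → Set
  InFq q c = c ^ᶠ q ≡ c

  InSpan : ℕ → (Fin 5 → V) → V → Set
  InSpan q u v = Σ[ c ∈ (Fin 5 → Carrier) ] ((∀ i → InFq q (c i)) × v ≡ sumV 5 (λ i → c i · u i))

  LinIndep : ℕ → (Fin 5 → V) → Set
  LinIndep q u = ∀ (c : Fin 5 → Carrier) → (∀ i → InFq q (c i)) →
                 sumV 5 (λ i → c i · u i) ≡ 0V → ∀ i → c i ≡ 0#

  -- A set of points of PG(1,F) is represented by the predicate
  -- "w is a nonzero vector spanning a point of the set".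
  PointSet : Set₁
  PointSet = V → Set

  Proportional : V → V → Set
  Proportional w v = ∃[ λ₀ ] (λ₀ ≢ 0# × w ≡ λ₀ · v)

  LinSet : ℕ → (Fin 5 → V) → PointSet
  LinSet q u w = w ≢ 0V × ∃[ v ] (InSpan q u v × v ≢ 0V × Proportional w v)

  NumPoints : PointSet → ℕ → Set
  NumPoints S N = Σ[ xs ∈ List V ] (All S xs
                         × AllPairs (λ w v → ¬ Proportional w v) xs
                         × (∀ w → S w → Any (Proportional w) xs)
                         × length xs ≡ N)

  -- Maximum scattered: (q^5 - 1)/(q - 1) = 1 + q + q² + q³ + q⁴ points
  MaxScattered : ℕ → (Fin 5 → V) → Set
  MaxScattered q u = NumPoints (LinSet q u)
                       (1 ℕ.+ q ℕ.+ q ℕ.^ 2 ℕ.+ q ℕ.^ 3 ℕ.+ q ℕ.^ 4)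

  IsAutomorphism : (Carrier → Carrier) → Set
  IsAutomorphism σ = (∀ x y → σ (x + y) ≡ σ x + σ y)
                   × (∀ x y → σ (x * y) ≡ σ x * σ y)
                   × σ 1# ≡ 1#
                   × Σ[ τ ∈ (Carrier → Carrier) ] ((∀ x → τ (σ x) ≡ x) × (∀ x → σ (τ x) ≡ x))

  record ΓL2 : Set where
    field
      a b c d : Carrier
      σ       : Carrier → Carrier
      det≢0   : a * d + - (b * c) ≢ 0#
      σ-aut   : IsAutomorphism σ

  applyΓL : ΓL2 → V → V
  applyΓL g (x , y) = (a * σ x + b * σ y , c * σ x + d * σ y)
    where open ΓL2 g

  PΓLEquivalent : PointSet → PointSet → Set
  PΓLEquivalent S T = ∃[ g ] (∀ w → (S w → T (applyΓL g w)) × (T (applyΓL g w) → S w))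

  GraphSet : (Carrier → Carrier) → PointSet
  GraphSet f w = w ≢ 0V × ∃[ x ] (x ≢ 0# × Proportional w (x , f x))

  Norm : ℕ → Carrier → Carrier
  Norm q x = x ^ᶠ (1 ℕ.+ q ℕ.+ q ℕ.^ 2 ℕ.+ q ℕ.^ 3 ℕ.+ q ℕ.^ 4)

  PseudoregulusType : ℕ → PointSet → Set
  PseudoregulusType q S =
    ∃[ s ] (s ℕ.< 5 × gcd s 5 ≡ 1 × PΓLEquivalent S (GraphSet (λ x → x ^ᶠ (q ℕ.^ s))))

  LPType : ℕ → PointSet → Set
  LPType q S =
    ∃[ s ] ∃[ δ ] (s ℕ.< 5 × gcd s 5 ≡ 1 × Norm q δ ≢ 0# × Norm q δ ≢ 1#
      × PΓLEquivalent S (GraphSet (λ x → x ^ᶠ (q ℕ.^ s) + δ * x ^ᶠ (q ℕ.^ (5 ℕ.∸ s)))))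

{-# OPTIONS --safe #-}
module Submission where

-- Write q for the order of the ground field and T x = x^q. A basis u of U and a nonzero A ∈ F⁵ with
-- Σ Aᵢ T²uᵢ = Σ Aᵢ T³uᵢ = 0 (four linear equations) give the map x ↦ Σ Tr(Aᵢ x) uᵢ into U, both of whose
-- coordinates are combinations of x, Tx and T⁴x only. If this map is injective, then GL(2, F) brings U to
-- {(x, sTx + rT⁴x)}, which is of pseudoregulus or LP type, or to {(T⁴x - cx, Tx - ax)} with c ∈ Fq. If it
-- is not, then U becomes {(x, Tx + e Tr x)} or {(z, Tz + te) : Tr z = 0, t ∈ Fq}. Apart from explicit
-- exceptional values of c, a and e, which again give pseudoregulus or LP type (with s = 2), these subspaces
-- contain two proportional vectors that are not Fq-proportional. For q ≤ 5 such a pair is found by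
-- computation for all the q⁶ + 2q⁵ parameters, in the model F = Fq[θ] with θ a root of a quintic.

open import Defs
open import Algebra.Bundles using (CommutativeRing; RawRing)
import Algebra.Properties.CommutativeMonoid.Sum as MonoidSum
import Algebra.Properties.Ring as RingProperties
import Algebra.Properties.Semiring.Mult.TCOptimised as Mult
import Algebra.Properties.Semiring.Sum as SemiringSum
import Algebra.Solver.Ring as RingSolver
open import Algebra.Solver.Ring.AlmostCommutativeRing using (fromCommutativeRing; _-Raw-AlmostCommutative⟶_)
open import Algebra.Structures using (IsCommutativeRing)
import Data.Bool
open import Data.Bool using (Bool; true; false; _∧_; _∨_; if_then_else_)
open import Data.Empty using (⊥; ⊥-elim)
open import Data.Fin as Fin using (Fin; zero; suc; punchOut; punchIn; funToFin; finToFun; remQuot; combine)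
open import Data.Fin.Patterns using (0F; 1F; 2F; 3F)
open import Data.Fin.Permutation using (Permutation; permutation; _⟨$⟩ʳ_)
import Data.Fin.Properties as Finₚ
open import Data.List as List using (List; []; _∷_; _++_; length; map; concatMap; foldr)
open import Data.List.Membership.Propositional using (_∈_)
open import Data.List.Membership.Propositional.Properties using (∈-lookup; ∈-upTo⁺)
open import Data.List.Relation.Unary.All as All using (All; []; _∷_)
open import Data.List.Relation.Unary.AllPairs using (AllPairs; []; _∷_)
open import Data.List.Relation.Unary.Any as Any using (here; there)
open import Data.List.Relation.Unary.Any.Properties using (lookup-index)
open import Data.Maybe using (Maybe; just; nothing)
open import Data.Nat as ℕ using (ℕ; zero; suc; _≡ᵇ_; _%_; s≤s; z≤n)
import Data.Nat.DivMod as DivMod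
open import Data.Nat.Induction using (<-wellFounded)
open import Data.Nat.Primality using (¬prime[0]; ¬prime[1])
import Data.Nat.Properties as ℕₚ
open import Data.Product using (∃; ∃-syntax; _×_; _,_; proj₁; proj₂)
open import Data.Product.Properties using (≡-dec)
import Data.Sum
open import Data.Sum using (_⊎_; inj₁; inj₂; map₂)
open import Data.Unit using (tt)
open import Data.Vec using (Vec; []; _∷_)
open import Function.Bundles using (_↔_; Inverse)
open import Induction.WellFounded using (Acc; acc)
open import Level using (0ℓ)
open import Relation.Binary.PropositionalEquality using (_≡_; _≢_; refl; sym; trans; cong; cong₂; subst; module ≡-Reasoning)
open import Relation.Nullary using (¬_; Dec; yes; no)
open import Relation.Nullary.Decidable using (¬?; _×-dec_; _→-dec_; toWitness)
open import Relation.Unary using (Decidable)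

-- Ring identities in a field

-- A direct search over {(x, f x)} would face four free coefficients, about q²⁰ maps f. The vector A
-- cuts this down: in Σ Tr(Aᵢx) uᵢ the coefficient of Tʲx is Σ Tʲ(Aᵢ) uᵢ, which for j = 2 and j = 3
-- is a conjugate of Σ Aᵢ T³uᵢ and Σ Aᵢ T²uᵢ; five unknowns can always meet the four equations that
-- make these vanish. Of the six coefficients left, row operations normalise four, and a
-- substitution x ↦ kx moves c into Fq by Hilbert 90. The price of prescribing A is a possible
-- kernel. A kernel vector can be moved to 1, and then T⁴x - cx and Tx - ax both vanish at 1: this
-- is why a hyperplane of the graph of T appears, and one further vector determines U. F is an
-- arbitrary field with q⁵ elements, so the computation has to be transported: X^(q⁵) ≡ X modulo the
-- quintic forces a root θ in F, and inequalities are certified by explicit inverses, which make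
-- sense before distinct tuples are known to represent distinct elements.

module FieldKit (F : Field) where
  open Field F public
  open IsCommutativeRing isCommutativeRing public
    using (+-assoc; +-comm; +-identityˡ; +-identityʳ; -‿inverseʳ; *-assoc; *-comm; *-identityˡ; *-identityʳ; distribˡ; distribʳ; zeroˡ; zeroʳ)

  commutativeRing : CommutativeRing 0ℓ 0ℓ
  commutativeRing = record { isCommutativeRing = isCommutativeRing }

  open CommutativeRing commutativeRing public using (semiring; ring; +-commutativeMonoid; *-commutativeMonoid)
  open RingProperties ring public using (-‿distribˡ-*; -‿distribʳ-*; -0#≈0#; -‿involutive; -‿+-comm)
  open Mult semiring public using (×-homo-+; ×1-homo-*) renaming (_×_ to _×ᶠ_)

  -- Differences of naturals as coefficients: unlike coefficients in F itself,
  -- they make the cancellation x - x = 0 visible to the ring normaliser.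
  private
    reduce : ℕ → ℕ → ℕ × ℕ
    reduce a b = (a ℕ.∸ b , b ℕ.∸ a)

    coefficients : RawRing 0ℓ 0ℓ
    coefficients = record
      { Carrier = ℕ × ℕ
      ; _≈_ = _≡_
      ; _+_ = λ (a , b) (c , d) → reduce (a ℕ.+ c) (b ℕ.+ d)
      ; _*_ = λ (a , b) (c , d) → reduce (a ℕ.* c ℕ.+ b ℕ.* d) (a ℕ.* d ℕ.+ b ℕ.* c)
      ; -_ = λ (a , b) → (b , a)
      ; 0# = (0 , 0)
      ; 1# = (1 , 0)
      }

    ⟦_⟧ : ℕ × ℕ → Carrier
    ⟦ a , zero ⟧ = a ×ᶠ 1#
    ⟦ a , suc b ⟧ = a ×ᶠ 1# + - (suc b ×ᶠ 1#)

    ⟦⟧-difference : ∀ a b → ⟦ a , b ⟧ ≡ a ×ᶠ 1# + - (b ×ᶠ 1#)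
    ⟦⟧-difference a zero = sym (trans (cong (a ×ᶠ 1# +_) -0#≈0#) (+-identityʳ _))
    ⟦⟧-difference a (suc b) = refl

    open ≡-Reasoning

    +-interchange : ∀ a b c d → (a + b) + (c + d) ≡ (a + c) + (b + d)
    +-interchange a b c d = begin
      (a + b) + (c + d) ≡⟨ +-assoc a b (c + d) ⟩
      a + (b + (c + d)) ≡⟨ cong (a +_) (trans (sym (+-assoc b c d)) (trans (cong (_+ d) (+-comm b c)) (+-assoc c b d))) ⟩
      a + (c + (b + d)) ≡⟨ sym (+-assoc a c (b + d)) ⟩
      (a + c) + (b + d) ∎

    sum-zero⇒equal : ∀ x y z → y + z ≡ 0# → x ≡ x + y + z
    sum-zero⇒equal x y z e = sym (trans (+-assoc x y z) (trans (cong (x +_) e) (+-identityʳ x)))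

    coefficient-equal : ∀ a b c d → a ℕ.+ d ≡ c ℕ.+ b → ⟦ a , b ⟧ ≡ ⟦ c , d ⟧
    coefficient-equal a b c d e = begin
      ⟦ a , b ⟧ ≡⟨ ⟦⟧-difference a b ⟩
      a′ + - b′ ≡⟨ cong (_+ - b′) (trans (sum-zero⇒equal a′ d′ (- d′) (-‿inverseʳ d′)) (cong (_+ - d′) e′)) ⟩
      (c′ + b′ + - d′) + - b′ ≡⟨ trans (+-assoc _ _ _) (trans (+-interchange c′ b′ (- d′) (- b′)) refl) ⟩
      (c′ + - d′) + (b′ + - b′) ≡⟨ trans (cong ((c′ + - d′) +_) (-‿inverseʳ b′)) (+-identityʳ _) ⟩
      c′ + - d′ ≡⟨ sym (⟦⟧-difference c d) ⟩
      ⟦ c , d ⟧ ∎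
      where
        a′ = a ×ᶠ 1#
        b′ = b ×ᶠ 1#
        c′ = c ×ᶠ 1#
        d′ = d ×ᶠ 1#
        e′ : a′ + d′ ≡ c′ + b′
        e′ = trans (sym (×-homo-+ 1# a d)) (trans (cong (_×ᶠ 1#) e) (×-homo-+ 1# c b))

    ⟦reduce⟧ : ∀ a b → ⟦ reduce a b ⟧ ≡ ⟦ a , b ⟧
    ⟦reduce⟧ a b = coefficient-equal (a ℕ.∸ b) (b ℕ.∸ a) a b (balance a b)
      where
        balance : ∀ a b → a ℕ.∸ b ℕ.+ b ≡ a ℕ.+ (b ℕ.∸ a)
        balance zero zero = refl
        balance zero (suc b) = refl
        balance (suc a) zero = refl
        balance (suc a) (suc b) = trans (ℕₚ.+-suc (a ℕ.∸ b) b) (cong suc (balance a b))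

    +-homo : ∀ x y → ⟦ RawRing._+_ coefficients x y ⟧ ≡ ⟦ x ⟧ + ⟦ y ⟧
    +-homo (a , b) (c , d) = begin
      ⟦ reduce (a ℕ.+ c) (b ℕ.+ d) ⟧ ≡⟨ trans (⟦reduce⟧ (a ℕ.+ c) (b ℕ.+ d)) (⟦⟧-difference (a ℕ.+ c) (b ℕ.+ d)) ⟩
      (a ℕ.+ c) ×ᶠ 1# + - ((b ℕ.+ d) ×ᶠ 1#)
        ≡⟨ cong₂ (λ x y → x + - y) (×-homo-+ 1# a c) (×-homo-+ 1# b d) ⟩
      (a ×ᶠ 1# + c ×ᶠ 1#) + - (b ×ᶠ 1# + d ×ᶠ 1#) ≡⟨ cong ((a ×ᶠ 1# + c ×ᶠ 1#) +_) (sym (-‿+-comm _ _)) ⟩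
      (a ×ᶠ 1# + c ×ᶠ 1#) + (- (b ×ᶠ 1#) + - (d ×ᶠ 1#)) ≡⟨ +-interchange _ _ _ _ ⟩
      (a ×ᶠ 1# + - (b ×ᶠ 1#)) + (c ×ᶠ 1# + - (d ×ᶠ 1#)) ≡⟨ sym (cong₂ _+_ (⟦⟧-difference a b) (⟦⟧-difference c d)) ⟩
      ⟦ a , b ⟧ + ⟦ c , d ⟧ ∎

    ×-homo-sum-of-products : ∀ a b c d →
      (a ℕ.* c ℕ.+ b ℕ.* d) ×ᶠ 1# ≡ (a ×ᶠ 1#) * (c ×ᶠ 1#) + (b ×ᶠ 1#) * (d ×ᶠ 1#)
    ×-homo-sum-of-products a b c d = trans (×-homo-+ 1# (a ℕ.* c) (b ℕ.* d)) (cong₂ _+_ (×1-homo-* a c) (×1-homo-* b d))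

    product-of-differences : ∀ a b c d → (a + - b) * (c + - d) ≡ (a * c + b * d) + - (a * d + b * c)
    product-of-differences a b c d = begin
      (a + - b) * (c + - d) ≡⟨ distribʳ (c + - d) a (- b) ⟩
      a * (c + - d) + (- b) * (c + - d) ≡⟨ cong₂ _+_ (distribˡ a c (- d)) (distribˡ (- b) c (- d)) ⟩
      (a * c + a * - d) + ((- b) * c + (- b) * - d)
        ≡⟨ cong₂ (λ x y → (a * c + x) + y) (sym (-‿distribʳ-* a d))
             (cong₂ _+_ (sym (-‿distribˡ-* b c))
               (trans (sym (-‿distribˡ-* b (- d))) (trans (cong -_ (sym (-‿distribʳ-* b d))) (-‿involutive _)))) ⟩
      (a * c + - (a * d)) + (- (b * c) + b * d) ≡⟨ cong ((a * c + - (a * d)) +_) (+-comm _ _) ⟩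
      (a * c + - (a * d)) + (b * d + - (b * c)) ≡⟨ +-interchange _ _ _ _ ⟩
      (a * c + b * d) + (- (a * d) + - (b * c)) ≡⟨ cong ((a * c + b * d) +_) (-‿+-comm _ _) ⟩
      (a * c + b * d) + - (a * d + b * c) ∎

    *-homo : ∀ x y → ⟦ RawRing._*_ coefficients x y ⟧ ≡ ⟦ x ⟧ * ⟦ y ⟧
    *-homo (a , b) (c , d) = begin
      ⟦ reduce (a ℕ.* c ℕ.+ b ℕ.* d) (a ℕ.* d ℕ.+ b ℕ.* c) ⟧
        ≡⟨ trans (⟦reduce⟧ (a ℕ.* c ℕ.+ b ℕ.* d) _) (⟦⟧-difference (a ℕ.* c ℕ.+ b ℕ.* d) (a ℕ.* d ℕ.+ b ℕ.* c)) ⟩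
      (a ℕ.* c ℕ.+ b ℕ.* d) ×ᶠ 1# + - ((a ℕ.* d ℕ.+ b ℕ.* c) ×ᶠ 1#)
        ≡⟨ cong₂ (λ x y → x + - y) (×-homo-sum-of-products a b c d) (×-homo-sum-of-products a b d c) ⟩
      ((a ×ᶠ 1#) * (c ×ᶠ 1#) + (b ×ᶠ 1#) * (d ×ᶠ 1#)) + - ((a ×ᶠ 1#) * (d ×ᶠ 1#) + (b ×ᶠ 1#) * (c ×ᶠ 1#))
        ≡⟨ sym (product-of-differences _ _ _ _) ⟩
      (a ×ᶠ 1# + - (b ×ᶠ 1#)) * (c ×ᶠ 1# + - (d ×ᶠ 1#)) ≡⟨ sym (cong₂ _*_ (⟦⟧-difference a b) (⟦⟧-difference c d)) ⟩
      ⟦ a , b ⟧ * ⟦ c , d ⟧ ∎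

    -homo : ∀ x → ⟦ RawRing.-_ coefficients x ⟧ ≡ - ⟦ x ⟧
    -homo (a , b) = begin
      ⟦ b , a ⟧ ≡⟨ ⟦⟧-difference b a ⟩
      b ×ᶠ 1# + - (a ×ᶠ 1#) ≡⟨ +-comm _ _ ⟩
      - (a ×ᶠ 1#) + b ×ᶠ 1# ≡⟨ cong (- (a ×ᶠ 1#) +_) (sym (-‿involutive _)) ⟩
      - (a ×ᶠ 1#) + - - (b ×ᶠ 1#) ≡⟨ -‿+-comm _ _ ⟩
      - (a ×ᶠ 1# + - (b ×ᶠ 1#)) ≡⟨ cong -_ (sym (⟦⟧-difference a b)) ⟩
      - ⟦ a , b ⟧ ∎

    morphism : coefficients -Raw-AlmostCommutative⟶ fromCommutativeRing commutativeRing
    morphism = record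
      { ⟦_⟧ = ⟦_⟧
      ; +-homo = +-homo
      ; *-homo = *-homo
      ; -‿homo = -homo
      ; 0-homo = refl
      ; 1-homo = refl
      }

    _coefficient≟_ : ∀ x y → Maybe (⟦ x ⟧ ≡ ⟦ y ⟧)
    (a , b) coefficient≟ (c , d) with a ℕ.+ d ℕₚ.≟ c ℕ.+ b
    ... | yes e = just (coefficient-equal a b c d e)
    ... | no _ = nothing

  open RingSolver coefficients (fromCommutativeRing commutativeRing) morphism _coefficient≟_ public
    using (solve; con; _:+_; _:*_; _:-_; :-_; _:=_; Polynomial)

  :0 :1 : ∀ {n} → Polynomial n
  :0 = con (0 , 0)
  :1 = con (1 , 0)

  infixl 6 _-_
  _-_ : Carrier → Carrier → Carrier
  x - y = x + - y

  difference-zero : ∀ {x y} → x ≡ y → x - y ≡ 0#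
  difference-zero {x} refl = -‿inverseʳ x

  zero-difference : ∀ {x y} → x - y ≡ 0# → x ≡ y
  zero-difference {x} {y} e = begin
    x             ≡⟨ solve 2 (λ x y → x := (x :- y) :+ y) refl x y ⟩
    (x - y) + y   ≡⟨ cong (_+ y) e ⟩
    0# + y        ≡⟨ +-identityˡ y ⟩
    y             ∎
    where open ≡-Reasoning

  -- Linear combinations of hypotheses: the remaining identity is one for the ring normaliser.
  linear₁ : ∀ {x y l r} → l ≡ r → ∀ k → x - y ≡ k * (l - r) → x ≡ y
  linear₁ h k e = zero-difference (trans e (trans (cong (k *_) (difference-zero h)) (zeroʳ k)))

  linear₂ : ∀ {x y l r l′ r′} → l ≡ r → ∀ k → l′ ≡ r′ → ∀ k′ →
            x - y ≡ k * (l - r) + k′ * (l′ - r′) → x ≡ y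
  linear₂ h k h′ k′ e = zero-difference (trans e
    (trans (cong₂ (λ s t → k * s + k′ * t) (difference-zero h) (difference-zero h′))
           (trans (cong₂ _+_ (zeroʳ k) (zeroʳ k′)) (+-identityˡ 0#))))

  no-zero-divisors : ∀ {x y} → x ≢ 0# → x * y ≡ 0# → y ≡ 0#
  no-zero-divisors {x} {y} x≢0 xy≡0 with inverse x x≢0
  ... | x⁻¹ , xx⁻¹≡1 = linear₂ xy≡0 x⁻¹ xx⁻¹≡1 (- y)
        (solve 3 (λ x y i → y :- :0 := i :* (x :* y :- :0) :+ (:- y) :* (x :* i :- :1)) refl x y x⁻¹)

  product-nonzero : ∀ {x y} → x ≢ 0# → y ≢ 0# → x * y ≢ 0#
  product-nonzero x≢0 y≢0 xy≡0 = y≢0 (no-zero-divisors x≢0 xy≡0)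

  cancelˡ : ∀ {k x y} → k ≢ 0# → k * x ≡ k * y → x ≡ y
  cancelˡ {k} {x} {y} k≢0 e = zero-difference (no-zero-divisors k≢0
    (linear₁ e 1# (solve 3 (λ k x y → k :* (x :- y) :- :0 := :1 :* (k :* x :- k :* y)) refl k x y)))

  factor-nonzeroʳ : ∀ {x y z} → x * y ≡ z → z ≢ 0# → y ≢ 0#
  factor-nonzeroʳ {x} e z≢0 refl = z≢0 (trans (sym e) (zeroʳ x))

  factor-nonzeroˡ : ∀ {x y z} → x * y ≡ z → z ≢ 0# → x ≢ 0#
  factor-nonzeroˡ {x} {y} e z≢0 refl = z≢0 (trans (sym e) (zeroˡ y))

  1≢0 : 1# ≢ 0#
  1≢0 e = 0≢1 (sym e)

  negation-nonzero : ∀ {x} → x ≢ 0# → - x ≢ 0#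
  negation-nonzero {x} x≢0 e = x≢0 (trans (sym (-‿involutive x)) (trans (cong -_ e) -0#≈0#))

-- Counting in finite sets and finite fields

module _ {n : ℕ} where
  injective⇒surjective : (f : Fin n → Fin n) → (∀ {i j} → f i ≡ f j → i ≡ j) → ∀ j → ∃[ i ] f i ≡ j
  injective⇒surjective f f-injective j with Finₚ.any? (λ i → f i Finₚ.≟ j)
  ... | yes found = found
  ... | no missed = ⊥-elim (omits n f f-injective j λ i e → missed (i , e))
    where
      omits : ∀ n (f : Fin n → Fin n) → (∀ {i j} → f i ≡ f j → i ≡ j) → ∀ j → (∀ i → f i ≢ j) → ⊥
      omits (suc m) f f-injective j fi≢j = ℕₚ.1+n≰n (Finₚ.injective⇒≤
        {f = λ i → punchOut (λ e → fi≢j i (sym e))}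
        (λ {i} {k} e → f-injective (Finₚ.punchOut-injective (λ e → fi≢j i (sym e)) (λ e → fi≢j k (sym e)) e)))

  non-injective⇒non-surjective : (f : Fin n → Fin n) → ∀ {i j} → i ≢ j → f i ≡ f j → ∃[ k ] (∀ i → f i ≢ k)
  non-injective⇒non-surjective f {i} {j} i≢j fi≡fj
    with Finₚ.any? (λ k → ¬? (Finₚ.any? (λ i → f i Finₚ.≟ k)))
  ... | yes (k , unhit) = k , λ i e → unhit (i , e)
  -- If every `k` were hit, a section of `f` would be injective, hence surjective, and so a
  -- two-sided inverse of `f`.
  ... | no all-hit = ⊥-elim (i≢j (trans (sym (section-of i)) (trans (cong section fi≡fj) (section-of j))))
    where
      hit : ∀ k → ∃[ i ] f i ≡ k
      hit k with Finₚ.any? (λ i → f i Finₚ.≟ k)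
      ... | yes h = h
      ... | no unhit = ⊥-elim (all-hit (k , unhit))
      section : Fin n → Fin n
      section k = proj₁ (hit k)
      section-injective : ∀ {k l} → section k ≡ section l → k ≡ l
      section-injective {k} {l} e = trans (sym (proj₂ (hit k))) (trans (cong f e) (proj₂ (hit l)))
      section-of : ∀ i → section (f i) ≡ i
      section-of i with injective⇒surjective section section-injective i
      ... | k , refl = cong section (proj₂ (hit k))

module FiniteKit (F : Field) (n : ℕ) (finite : Fin n ↔ Field.Carrier F) where
  open FieldKit F

  element : Fin n → Carrier
  element = Inverse.to finite

  index : Carrier → Fin n
  index = Inverse.from finite

  element-index : ∀ x → element (index x) ≡ x
  element-index x = Inverse.inverseˡ finite refl

  index-element : ∀ i → index (element i) ≡ i
  index-element i = Inverse.inverseʳ finite refl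

  index-injective : ∀ {x y} → index x ≡ index y → x ≡ y
  index-injective {x} {y} e = trans (sym (element-index x)) (trans (cong element e) (element-index y))

  infix 4 _≟_
  _≟_ : (x y : Carrier) → Dec (x ≡ y)
  x ≟ y with index x Finₚ.≟ index y
  ... | yes e = yes (index-injective e)
  ... | no ne = no (λ e → ne (cong index e))

  search : {P : Carrier → Set} → Decidable P → Dec (∃ P)
  search {P} P? with Finₚ.any? (λ i → P? (element i))
  ... | yes (i , p) = yes (element i , p)
  ... | no none = no λ (x , p) → none (index x , subst P (sym (element-index x)) p)

  endo-injective⇒surjective : (f : Carrier → Carrier) → (∀ {x y} → f x ≡ f y → x ≡ y) → ∀ y → ∃[ x ] f x ≡ y
  endo-injective⇒surjective f f-injective y
    with injective⇒surjective (λ i → index (f (element i)))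
           (λ {i} {j} e → trans (sym (index-element i))
             (trans (cong index (f-injective (index-injective e))) (index-element j))) (index y)
  ... | i , e = element i , index-injective e

-- The Frobenius map and the trace

-- `T` is kept abstract, as an endomorphism with fifth power 1. That it is the q-th power enters
-- only through the field `T-power` of `Digits` and `Realisation`.
record Frobenius (F : Field) (n : ℕ) : Set where
  open FieldKit F
  field
    finite : Fin n ↔ Carrier
    T : Carrier → Carrier
    T-+ : ∀ x y → T (x + y) ≡ T x + T y
    T-* : ∀ x y → T (x * y) ≡ T x * T y
    T⁵-identity : ∀ x → T (T (T (T (T x)))) ≡ x

  open FiniteKit F n finite public

  T² T³ T⁴ Tr N : Carrier → Carrier
  T² x = T (T x)
  T³ x = T (T² x)
  T⁴ x = T (T³ x)
  Tr x = x + (T x + (T² x + (T³ x + T⁴ x)))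
  N x = x * (T x * (T² x * (T³ x * T⁴ x)))

  Fixed : Carrier → Set
  Fixed c = T c ≡ c

  T-1 : T 1# ≡ 1#
  T-1 = begin
    T 1#              ≡⟨ sym (*-identityʳ _) ⟩
    T 1# * 1#         ≡⟨ cong (T 1# *_) (sym (T⁵-identity 1#)) ⟩
    T 1# * T (T⁴ 1#)  ≡⟨ sym (T-* 1# (T⁴ 1#)) ⟩
    T (1# * T⁴ 1#)    ≡⟨ cong T (*-identityˡ _) ⟩
    T (T⁴ 1#)         ≡⟨ T⁵-identity 1# ⟩
    1#                ∎
    where open ≡-Reasoning

  T-0 : T 0# ≡ 0#
  T-0 = linear₁ (trans (sym (T-+ 0# 0#)) (cong T (+-identityˡ 0#))) 1#
    (solve 1 (λ t → t :- :0 := :1 :* ((t :+ t) :- t)) refl (T 0#))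

  T-neg : ∀ x → T (- x) ≡ - T x
  T-neg x = linear₁ (trans (sym (T-+ x (- x))) (trans (cong T (-‿inverseʳ x)) T-0)) 1#
    (solve 2 (λ t s → s :- (:- t) := :1 :* ((t :+ s) :- :0)) refl (T x) (T (- x)))

  T-injective : ∀ {x y} → T x ≡ T y → x ≡ y
  T-injective {x} {y} e = trans (sym (T⁵-identity x)) (trans (cong T⁴ e) (T⁵-identity y))

  T-nonzero : ∀ {x} → x ≢ 0# → T x ≢ 0#
  T-nonzero x≢0 e = x≢0 (T-injective (trans e (sym T-0)))

  T²-+ : ∀ x y → T² (x + y) ≡ T² x + T² y
  T²-+ x y = trans (cong T (T-+ x y)) (T-+ _ _)
  T³-+ : ∀ x y → T³ (x + y) ≡ T³ x + T³ y
  T³-+ x y = trans (cong T (T²-+ x y)) (T-+ _ _)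
  T⁴-+ : ∀ x y → T⁴ (x + y) ≡ T⁴ x + T⁴ y
  T⁴-+ x y = trans (cong T (T³-+ x y)) (T-+ _ _)
  T²-* : ∀ x y → T² (x * y) ≡ T² x * T² y
  T²-* x y = trans (cong T (T-* x y)) (T-* _ _)
  T³-* : ∀ x y → T³ (x * y) ≡ T³ x * T³ y
  T³-* x y = trans (cong T (T²-* x y)) (T-* _ _)
  T⁴-* : ∀ x y → T⁴ (x * y) ≡ T⁴ x * T⁴ y
  T⁴-* x y = trans (cong T (T³-* x y)) (T-* _ _)

  Fixed-T⁴ : ∀ {c} → Fixed c → T⁴ c ≡ c
  Fixed-T⁴ {c} e = trans (cong T³ e) (trans (cong T² e) (trans (cong T e) e))

  Fixed-+ : ∀ {c d} → Fixed c → Fixed d → Fixed (c + d)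
  Fixed-+ {c} {d} e f = trans (T-+ c d) (cong₂ _+_ e f)
  Fixed-* : ∀ {c d} → Fixed c → Fixed d → Fixed (c * d)
  Fixed-* {c} {d} e f = trans (T-* c d) (cong₂ _*_ e f)
  Fixed-neg : ∀ {c} → Fixed c → Fixed (- c)
  Fixed-neg {c} e = trans (T-neg c) (cong -_ e)
  Fixed-inverse : ∀ {c d} → c ≢ 0# → Fixed c → c * d ≡ 1# → Fixed d
  Fixed-inverse {c} {d} c≢0 e cd≡1 = cancelˡ c≢0 (begin
    c * T d    ≡⟨ cong (_* T d) (sym e) ⟩
    T c * T d  ≡⟨ sym (T-* c d) ⟩
    T (c * d)  ≡⟨ cong T cd≡1 ⟩
    T 1#       ≡⟨ T-1 ⟩
    1#         ≡⟨ sym cd≡1 ⟩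
    c * d      ∎)
    where open ≡-Reasoning

  Tr-cong₅ : ∀ {a b c d e a′ b′ c′ d′ e′ : Carrier} → a ≡ a′ → b ≡ b′ → c ≡ c′ → d ≡ d′ → e ≡ e′ →
    a + (b + (c + (d + e))) ≡ a′ + (b′ + (c′ + (d′ + e′)))
  Tr-cong₅ refl refl refl refl refl = refl

  Tr-+ : ∀ x y → Tr (x + y) ≡ Tr x + Tr y
  Tr-+ x y = trans (Tr-cong₅ refl (T-+ x y) (T²-+ x y) (T³-+ x y) (T⁴-+ x y))
    (solve 10 (λ a b c d e a′ b′ c′ d′ e′ →
        (a :+ a′) :+ ((b :+ b′) :+ ((c :+ c′) :+ ((d :+ d′) :+ (e :+ e′))))
        := (a :+ (b :+ (c :+ (d :+ e)))) :+ (a′ :+ (b′ :+ (c′ :+ (d′ :+ e′))))) refl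
      x (T x) (T² x) (T³ x) (T⁴ x) y (T y) (T² y) (T³ y) (T⁴ y))

  Tr-scale : ∀ {c} → Fixed c → ∀ x → Tr (c * x) ≡ c * Tr x
  Tr-scale {c} c-fixed x = trans
    (Tr-cong₅ refl (trans (T-* c x) (cong (_* T x) c-fixed))
      (trans (T²-* c x) (cong (_* T² x) c₂)) (trans (T³-* c x) (cong (_* T³ x) c₃))
      (trans (T⁴-* c x) (cong (_* T⁴ x) (Fixed-T⁴ c-fixed))))
    (solve 6 (λ k a b c d e → k :* a :+ (k :* b :+ (k :* c :+ (k :* d :+ k :* e)))
        := k :* (a :+ (b :+ (c :+ (d :+ e))))) refl c x (T x) (T² x) (T³ x) (T⁴ x))
    where
      c₂ : T² c ≡ c
      c₂ = trans (cong T c-fixed) c-fixed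
      c₃ : T³ c ≡ c
      c₃ = trans (cong T c₂) c-fixed

  Tr-fixed : ∀ x → Fixed (Tr x)
  Tr-fixed x = begin
    T (Tr x) ≡⟨ trans (T-+ _ _) (cong (T x +_) (trans (T-+ _ _) (cong (T² x +_) (trans (T-+ _ _) (cong (T³ x +_) (T-+ _ _)))))) ⟩
    T x + (T² x + (T³ x + (T⁴ x + T (T⁴ x)))) ≡⟨ Tr-cong₅ refl refl refl refl (T⁵-identity x) ⟩
    T x + (T² x + (T³ x + (T⁴ x + x)))
      ≡⟨ solve 5 (λ a b c d e → b :+ (c :+ (d :+ (e :+ a))) := a :+ (b :+ (c :+ (d :+ e)))) refl x (T x) (T² x) (T³ x) (T⁴ x) ⟩
    Tr x ∎
    where open ≡-Reasoning

  Tr-T : ∀ x → Tr (T x) ≡ Tr x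
  Tr-T x = trans
    (sym (trans (T-+ _ _) (cong (T x +_) (trans (T-+ _ _) (cong (T² x +_) (trans (T-+ _ _) (cong (T³ x +_) (T-+ _ _))))))))
    (Tr-fixed x)

  T²-Tr : ∀ x → T² (Tr x) ≡ Tr x
  T²-Tr x = trans (cong T (Tr-fixed x)) (Tr-fixed x)

  Tr-0 : Tr 0# ≡ 0#
  Tr-0 = trans (Tr-cong₅ refl T-0 t₂ t₃ (trans (cong T t₃) T-0))
    (solve 0 (:0 :+ (:0 :+ (:0 :+ (:0 :+ :0))) := :0) refl)
    where
      t₂ : T² 0# ≡ 0#
      t₂ = trans (cong T T-0) T-0
      t₃ : T³ 0# ≡ 0#
      t₃ = trans (cong T t₂) T-0

  Tr-neg : ∀ x → Tr (- x) ≡ - Tr x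
  Tr-neg x = linear₁ (trans (sym (Tr-+ x (- x))) (trans (cong Tr (-‿inverseʳ x)) Tr-0)) 1#
    (solve 2 (λ t s → s :- (:- t) := :1 :* ((t :+ s) :- :0)) refl (Tr x) (Tr (- x)))

  Tr-difference-T⁴ : ∀ x → Tr (x - T⁴ x) ≡ 0#
  Tr-difference-T⁴ x = begin
    Tr (x - T⁴ x)         ≡⟨ trans (Tr-+ x (- T⁴ x)) (cong (Tr x +_) (Tr-neg (T⁴ x))) ⟩
    Tr x - Tr (T⁴ x)      ≡⟨ cong (λ s → Tr x - s) (trans (Tr-T _) (trans (Tr-T _) (trans (Tr-T _) (Tr-T x)))) ⟩
    Tr x - Tr x           ≡⟨ -‿inverseʳ _ ⟩
    0#                    ∎
    where open ≡-Reasoning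

  -- Additive Hilbert 90 for the generator T⁴ of the Galois group.
  trace-zero⇒difference : ∃[ τ ] Tr τ ≡ 1# → ∀ z → Tr z ≡ 0# → ∃[ y ] y - T⁴ y ≡ z
  trace-zero⇒difference (τ , Trτ≡1) z Trz≡0 = y , (begin
    y - T⁴ y ≡⟨ cong (λ s → y - s) T⁴y ⟩
    y - (z₄ * τ₃ + ((z₄ + z₃) * τ₂ + ((z₄ + z₃ + z₂) * τ₁ + (z₄ + z₃ + z₂ + z₁) * τ)))
      ≡⟨ linear₂ Trτ≡1 z Trz≡0 (- τ)
           (solve 10 (λ z z₁ z₂ z₃ z₄ t t₁ t₂ t₃ t₄ →
             (z :* t₄ :+ ((z :+ z₄) :* t₃ :+ ((z :+ z₄ :+ z₃) :* t₂ :+ (z :+ z₄ :+ z₃ :+ z₂) :* t₁))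
               :- (z₄ :* t₃ :+ ((z₄ :+ z₃) :* t₂ :+ ((z₄ :+ z₃ :+ z₂) :* t₁ :+ (z₄ :+ z₃ :+ z₂ :+ z₁) :* t)))) :- z
             := z :* ((t :+ (t₁ :+ (t₂ :+ (t₃ :+ t₄)))) :- :1) :+ (:- t) :* ((z :+ (z₁ :+ (z₂ :+ (z₃ :+ z₄)))) :- :0))
             refl z z₁ z₂ z₃ z₄ τ τ₁ τ₂ τ₃ τ₄) ⟩
    z ∎)
    where
      open ≡-Reasoning
      z₁ = T z
      z₂ = T² z
      z₃ = T³ z
      z₄ = T⁴ z
      τ₁ = T τ
      τ₂ = T² τ
      τ₃ = T³ τ
      τ₄ = T⁴ τ
      -- With σ = T⁴ this is Σ (z + σz + ... + σⁱ⁻¹z) σⁱτ over i = 1, ..., 4. In y - σy everything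
      -- cancels except z Tr τ - τ Tr z.
      y = z * τ₄ + ((z + z₄) * τ₃ + ((z + z₄ + z₃) * τ₂ + (z + z₄ + z₃ + z₂) * τ₁))
      T⁸ : ∀ x → T⁴ (T⁴ x) ≡ T³ x
      T⁸ x = T⁵-identity (T³ x)
      T⁷ : ∀ x → T⁴ (T³ x) ≡ T² x
      T⁷ x = T⁵-identity (T² x)
      T⁶ : ∀ x → T⁴ (T² x) ≡ T x
      T⁶ x = T⁵-identity (T x)
      T⁴y : T⁴ y ≡ z₄ * τ₃ + ((z₄ + z₃) * τ₂ + ((z₄ + z₃ + z₂) * τ₁ + (z₄ + z₃ + z₂ + z₁) * τ))
      T⁴y = trans (T⁴-+ _ _) (cong₂ _+_ (trans (T⁴-* z τ₄) (cong (z₄ *_) (T⁸ τ)))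
        (trans (T⁴-+ _ _) (cong₂ _+_ (trans (T⁴-* _ τ₃) (cong₂ _*_ p₂ (T⁷ τ)))
          (trans (T⁴-+ _ _) (cong₂ _+_ (trans (T⁴-* _ τ₂) (cong₂ _*_ p₃ (T⁶ τ)))
            (trans (T⁴-* _ τ₁) (cong₂ _*_ p₄ (T⁵-identity τ))))))))
        where
          p₂ : T⁴ (z + z₄) ≡ z₄ + z₃
          p₂ = trans (T⁴-+ _ _) (cong (z₄ +_) (T⁸ z))
          p₃ : T⁴ (z + z₄ + z₃) ≡ z₄ + z₃ + z₂
          p₃ = trans (T⁴-+ _ _) (cong₂ _+_ p₂ (T⁷ z))
          p₄ : T⁴ (z + z₄ + z₃ + z₂) ≡ z₄ + z₃ + z₂ + z₁
          p₄ = trans (T⁴-+ _ _) (cong₂ _+_ p₃ (T⁶ z))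

-- Scattered subspaces up to GL(2, F)

module Conditions {F : Field} {n : ℕ} (frobenius : Frobenius F n) where
  open FieldKit F
  open Frobenius frobenius

  -- {(x, Tx + e Tr x)} for t = 1, and {(z, Tz + s e) : Tr z = 0, s ∈ Fq} for t = 0, are not scattered.
  TraceCollision : Carrier → Carrier → Set
  TraceCollision t e = ∃[ y ] ∃[ z ] (z ≢ 0# × Tr z ≡ 0# × Tr y ≡ t × e * z ≡ y * T z - z * T y)

  -- {(T⁴y - cy, Ty - ay)} is not scattered: z stands for t - T⁴t, where y and ty give the same point.
  BinomialCollision : Carrier → Carrier → Set
  BinomialCollision c a = ∃[ y ] ∃[ z ] (y ≢ 0# × z ≢ 0# × Tr z ≡ 0#
    × a * (y * (T⁴ y * z)) + c * (y * (T y * T z)) ≡ T y * (T⁴ y * (z + T z)))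

  -- For such δ the map P = δy + Ty + e Tr y satisfies T²P + δT³P = -δ(y + Ty + e Tr y), so that row
  -- operations give the LP form with s = 2. The polynomial X² - X + 1 has roots in Fq only for q =
  -- 3 and q = 4.
  TraceException : Carrier → Carrier → Set
  TraceException e δ = Fixed δ × N δ ≢ 1# × δ * δ + 1# ≡ δ × e * (1# + (δ + δ)) + δ ≡ 0#

  -- With P = T⁴ + δ²T - δ the sum T²P + δT³P telescopes to T + δ³T⁴. The two equations say that the
  -- rows (1, δ²) and (δ³, 1) turn T⁴ - c and T - a into these two maps; the determinant of the rows
  -- is 1 - δ⁵ = 1 - N δ.
  BinomialException : Carrier → Carrier → Carrier → Set
  BinomialException c a δ = Fixed δ × δ ≢ 0# × N δ ≢ 1# × c + δ * δ * a ≡ δ × a + δ * δ * δ * c ≡ 0#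

  -- Collects what the computation supplies for q ≤ 5; the classification derived from it is uniform
  -- in q.
  record Arithmetic : Set where
    field
      moved : ∃[ θ ] T θ ≢ θ
      trace-one : ∃[ τ ] Tr τ ≡ 1#
      -- For q ≤ 5 the order q - 1 of Fq* is prime to 5, so N κ = c⁵ = N c for some c in Fq. If κ ≠
      -- 0, then κ/c has norm 1 and is of the form l / Tl.
      hilbert90 : ∀ κ → ∃[ l ] ∃[ c ] (l ≢ 0# × Fixed c × κ * T l ≡ c * l)
      norm-one : ∀ δ → N δ ≡ 1# → ∃[ l ] (l ≢ 0# × δ * T⁴ l ≡ T l)
      -- The subspace {(x, Tx + T⁴x)}, which would be the LP form with δ = 1, is not scattered.
      T+T⁴-collision : ∃[ y ] ∃[ t ] (y ≢ 0# × T t ≢ t × t * (T y + T⁴ y) ≡ T (t * y) + T⁴ (t * y))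
      trace-zero-collision : ∀ e → e ≡ 0# ⊎ TraceCollision 0# e
      trace-one-collision : ∀ e → TraceCollision 1# e ⊎ e ≡ 0# ⊎ ∃ (TraceException e)
      binomial-collision : ∀ c a → Fixed c →
        BinomialCollision c a ⊎ (c ≡ 0# × a ≡ 0#) ⊎ a * c ≡ 1# ⊎ ∃ (BinomialException c a)

module Classification {F : Field} {n : ℕ} (frobenius : Frobenius F n) (arithmetic : Conditions.Arithmetic frobenius) where
  open FieldKit F
  open Frobenius frobenius
  open Conditions frobenius
  open Arithmetic arithmetic
  open ≡-Reasoning

  Vec² : Set
  Vec² = V F

  infixr 7 _·ᵛ_
  infixl 6 _+ᵛ_
  _+ᵛ_ : Vec² → Vec² → Vec²
  _+ᵛ_ = _⊕_ F
  _·ᵛ_ : Carrier → Vec² → Vec²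
  _·ᵛ_ = _·_ F

  record Matrix : Set where
    constructor matrix
    field
      a b c d : Carrier
      det≢0 : a * d - b * c ≢ 0#

  act : Matrix → Vec² → Vec²
  act M (x , y) = (a * x + b * y , c * x + d * y)
    where open Matrix M

  act-injective : ∀ M {v w} → act M v ≡ act M w → v ≡ w
  act-injective (matrix a b c d det≢0) {x , y} {x′ , y′} e = cong₂ _,_
    (cancelˡ det≢0 (linear₂ e₁ d e₂ (- b)
      (solve 8 (λ a b c d x y x′ y′ → (a :* d :- b :* c) :* x :- (a :* d :- b :* c) :* x′
        := d :* ((a :* x :+ b :* y) :- (a :* x′ :+ b :* y′)) :+ (:- b) :* ((c :* x :+ d :* y) :- (c :* x′ :+ d :* y′)))
        refl a b c d x y x′ y′)))
    (cancelˡ det≢0 (linear₂ e₁ (- c) e₂ a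
      (solve 8 (λ a b c d x y x′ y′ → (a :* d :- b :* c) :* y :- (a :* d :- b :* c) :* y′
        := (:- c) :* ((a :* x :+ b :* y) :- (a :* x′ :+ b :* y′)) :+ a :* ((c :* x :+ d :* y) :- (c :* x′ :+ d :* y′)))
        refl a b c d x y x′ y′)))
    where
      e₁ = cong proj₁ e
      e₂ = cong proj₂ e

  act-+ : ∀ M v w → act M (v +ᵛ w) ≡ act M v +ᵛ act M w
  act-+ (matrix a b c d _) (x , y) (x′ , y′) = cong₂ _,_ (row a b) (row c d)
    where
      row : ∀ a b → a * (x + x′) + b * (y + y′) ≡ (a * x + b * y) + (a * x′ + b * y′)
      row a b = solve 6 (λ a b x y x′ y′ → a :* (x :+ x′) :+ b :* (y :+ y′) := (a :* x :+ b :* y) :+ (a :* x′ :+ b :* y′)) refl a b x y x′ y′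

  act-· : ∀ M l v → act M (l ·ᵛ v) ≡ l ·ᵛ act M v
  act-· (matrix a b c d _) l (x , y) = cong₂ _,_ (row a b) (row c d)
    where
      row : ∀ a b → a * (l * x) + b * (l * y) ≡ l * (a * x + b * y)
      row a b = solve 5 (λ a b l x y → a :* (l :* x) :+ b :* (l :* y) := l :* (a :* x :+ b :* y)) refl a b l x y

  act-0 : ∀ M → act M (0# , 0#) ≡ (0# , 0#)
  act-0 (matrix a b c d _) = cong₂ _,_ (row a b) (row c d)
    where
      row : ∀ a b → a * 0# + b * 0# ≡ 0#
      row a b = solve 2 (λ a b → a :* :0 :+ b :* :0 := :0) refl a b

  diagonal : ∀ {k l} → k ≢ 0# → l ≢ 0# → Matrix
  diagonal {k} {l} k≢0 l≢0 = matrix k 0# 0# l λ e → product-nonzero k≢0 l≢0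
    (trans (solve 2 (λ k l → k :* l := k :* l :- :0 :* :0) refl k l) e)

  act-diagonal : ∀ {k l} (k≢0 : k ≢ 0#) (l≢0 : l ≢ 0#) x y → act (diagonal k≢0 l≢0) (x , y) ≡ (k * x , l * y)
  act-diagonal {k} {l} _ _ x y = cong₂ _,_
    (solve 3 (λ k x y → k :* x :+ :0 :* y := k :* x) refl k x y)
    (solve 3 (λ l x y → :0 :* x :+ l :* y := l :* y) refl l x y)

  -- The dimension 5 over Fq is encoded as a bijection of U with the index set of F: an injective
  -- map from F to U is then onto by counting, and a non-injective one misses a vector. The field
  -- `scattered` says that every point has weight at most one.
  record Scattered (U : Vec² → Set) : Set where
    field
      +-closed : ∀ {v w} → U v → U w → U (v +ᵛ w)
      ·-closed : ∀ {c v} → Fixed c → U v → U (c ·ᵛ v)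
      scattered : ∀ {l v} → U v → v ≢ (0# , 0#) → U (l ·ᵛ v) → Fixed l
      enum : Fin n → Vec²
      enum∈ : ∀ i → U (enum i)
      enum-injective : ∀ {i j} → enum i ≡ enum j → i ≡ j
      enum-surjective : ∀ {v} → U v → ∃[ i ] enum i ≡ v

    position : (Ψ : Carrier → Vec²) → (∀ x → U (Ψ x)) → Fin n → Fin n
    position Ψ Ψ∈U i = proj₁ (enum-surjective (Ψ∈U (element i)))

    enum-position : ∀ Ψ Ψ∈U i → enum (position Ψ Ψ∈U i) ≡ Ψ (element i)
    enum-position Ψ Ψ∈U i = proj₂ (enum-surjective (Ψ∈U (element i)))

    parametrised : (Ψ : Carrier → Vec²) → (∀ x → U (Ψ x)) → (∀ {x y} → Ψ x ≡ Ψ y → x ≡ y) →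
                   ∀ {v} → U v → ∃[ x ] Ψ x ≡ v
    parametrised Ψ Ψ∈U Ψ-injective {v} v∈U with enum-surjective v∈U
    ... | j , refl with injective⇒surjective (position Ψ Ψ∈U)
                          (λ {i} {k} e → trans (sym (index-element i)) (trans (cong index (Ψ-injective
                            (trans (sym (enum-position Ψ Ψ∈U i)) (trans (cong enum e) (enum-position Ψ Ψ∈U k))))) (index-element k))) j
    ...   | i , refl = element i , sym (enum-position Ψ Ψ∈U i)

    not-parametrised : (Ψ : Carrier → Vec²) → (∀ x → U (Ψ x)) → ∀ {x y} → x ≢ y → Ψ x ≡ Ψ y →
                       ∃[ v ] (U v × (∀ x → Ψ x ≢ v))
    not-parametrised Ψ Ψ∈U {x} {y} x≢y Ψx≡Ψy
      with non-injective⇒non-surjective (position Ψ Ψ∈U) {index x} {index y} (λ e → x≢y (index-injective e))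
             (enum-injective (begin
               enum (position Ψ Ψ∈U (index x)) ≡⟨ enum-position Ψ Ψ∈U (index x) ⟩
               Ψ (element (index x)) ≡⟨ cong Ψ (element-index x) ⟩
               Ψ x ≡⟨ Ψx≡Ψy ⟩
               Ψ y ≡⟨ cong Ψ (sym (element-index y)) ⟩
               Ψ (element (index y)) ≡⟨ sym (enum-position Ψ Ψ∈U (index y)) ⟩
               enum (position Ψ Ψ∈U (index y)) ∎))
    ... | k , unhit = enum k , enum∈ k , λ x e → unhit (index x) (enum-injective
            (trans (enum-position Ψ Ψ∈U (index x)) (trans (cong Ψ (element-index x)) e)))

    -- A vanishing determinant makes w an F-multiple of v, and scatteredness puts the scalar into
    -- Fq.
    dependent : ∀ {v w} → U v → v ≢ (0# , 0#) → U w → proj₁ v * proj₂ w ≡ proj₂ v * proj₁ w →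
                ∃[ l ] (Fixed l × w ≡ l ·ᵛ v)
    dependent {v@(v₁ , v₂)} {w@(w₁ , w₂)} v∈U v≢0 w∈U e with v₁ ≟ 0#
    ... | no v₁≢0 with inverse v₁ v₁≢0
    ...   | i , v₁i≡1 = w₁ * i , scattered v∈U v≢0 (subst U w≡ w∈U) , w≡
      where
        w≡ : w ≡ (w₁ * i) ·ᵛ v
        w≡ = cong₂ _,_
          (linear₁ v₁i≡1 (- w₁) (solve 3 (λ v w i → w :- (w :* i) :* v := (:- w) :* (v :* i :- :1)) refl v₁ w₁ i))
          (linear₂ v₁i≡1 (- w₂) e i (solve 5 (λ v w v′ w′ i → w′ :- (w :* i) :* v′
            := (:- w′) :* (v :* i :- :1) :+ i :* (v :* w′ :- v′ :* w)) refl v₁ w₁ v₂ w₂ i))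
    dependent {v@(v₁ , v₂)} {w@(w₁ , w₂)} v∈U v≢0 w∈U e | yes refl with v₂ ≟ 0#
    ... | yes refl = ⊥-elim (v≢0 refl)
    ... | no v₂≢0 with inverse v₂ v₂≢0
    ...   | i , v₂i≡1 = w₂ * i , scattered v∈U v≢0 (subst U w≡ w∈U) , w≡
      where
        w₁≡0 : w₁ ≡ 0#
        w₁≡0 = no-zero-divisors v₂≢0 (trans (sym e) (zeroˡ w₂))
        w≡ : w ≡ (w₂ * i) ·ᵛ v
        w≡ = cong₂ _,_ (trans w₁≡0 (sym (zeroʳ _)))
          (linear₁ v₂i≡1 (- w₂) (solve 3 (λ v w i → w :- (w :* i) :* v := (:- w) :* (v :* i :- :1)) refl v₂ w₂ i))

  image : Matrix → (Vec² → Set) → Vec² → Set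
  image M U w = ∃[ v ] (U v × act M v ≡ w)

  image-scattered : ∀ M {U} → Scattered U → Scattered (image M U)
  image-scattered M {U} S = record
    { +-closed = λ { (v , v∈U , refl) (w , w∈U , refl) → v +ᵛ w , +-closed v∈U w∈U , act-+ M v w }
    ; ·-closed = λ { {c} c-fixed (v , v∈U , refl) → c ·ᵛ v , ·-closed c-fixed v∈U , act-· M c v }
    ; scattered = λ { {l} (v , v∈U , refl) Mv≢0 (w , w∈U , Mw≡) →
        scattered v∈U (λ { refl → Mv≢0 (act-0 M) })
          (subst U (act-injective M (trans Mw≡ (sym (act-· M l v)))) w∈U) }
    ; enum = λ i → act M (enum i)
    ; enum∈ = λ i → enum i , enum∈ i , refl
    ; enum-injective = λ e → enum-injective (act-injective M e)
    ; enum-surjective = λ { (v , v∈U , refl) → let (i , e) = enum-surjective v∈U in i , cong (act M) e }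
    }
    where open Scattered S

  record GraphOf (f : Carrier → Carrier) (U : Vec² → Set) : Set where
    field
      M : Matrix
      into : ∀ {v} → U v → ∃[ x ] act M v ≡ (x , f x)
      onto : ∀ x → ∃[ v ] (U v × act M v ≡ (x , f x))

  product : Matrix → Matrix → Matrix
  product (matrix a b c d det≢0) (matrix a′ b′ c′ d′ det′≢0) =
    matrix (a * a′ + b * c′) (a * b′ + b * d′) (c * a′ + d * c′) (c * b′ + d * d′)
      λ e → product-nonzero det≢0 det′≢0 (trans
        (solve 8 (λ a b c d a′ b′ c′ d′ → (a :* d :- b :* c) :* (a′ :* d′ :- b′ :* c′)
          := (a :* a′ :+ b :* c′) :* (c :* b′ :+ d :* d′) :- (a :* b′ :+ b :* d′) :* (c :* a′ :+ d :* c′))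
          refl a b c d a′ b′ c′ d′) e)

  act-product : ∀ M M′ v → act (product M M′) v ≡ act M (act M′ v)
  act-product (matrix a b c d _) (matrix a′ b′ c′ d′ _) (x , y) = cong₂ _,_ (row a b) (row c d)
    where
      row : ∀ a b → (a * a′ + b * c′) * x + (a * b′ + b * d′) * y ≡ a * (a′ * x + b′ * y) + b * (c′ * x + d′ * y)
      row a b = solve 8 (λ a b a′ b′ c′ d′ x y → (a :* a′ :+ b :* c′) :* x :+ (a :* b′ :+ b :* d′) :* y
        := a :* (a′ :* x :+ b′ :* y) :+ b :* (c′ :* x :+ d′ :* y)) refl a b a′ b′ c′ d′ x y

  GraphOf-image : ∀ M {U f} → GraphOf f (image M U) → GraphOf f U
  GraphOf-image M {U} {f} g = record
    { M = product G.M M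
    ; into = λ {v} v∈U → let (x , e) = G.into (v , v∈U , refl) in x , trans (act-product G.M M v) e
    ; onto = λ x → case-onto (G.onto x)
    }
    where
      module G = GraphOf g
      case-onto : ∀ {x} → ∃[ w ] (image M U w × act G.M w ≡ (x , f x)) → ∃[ v ] (U v × act (product G.M M) v ≡ (x , f x))
      case-onto (_ , (v , v∈U , refl) , e) = v , v∈U , trans (act-product G.M M v) e

  -- The first coordinate `P x` determines the second, so `P` inherits injectivity from `Ψ` and `M`;
  -- by finiteness it is onto, and every point of the graph is reached.
  graphOf : ∀ {U f} M → Scattered U → (Ψ : Carrier → Vec²) → (∀ x → U (Ψ x)) → (∀ {x y} → Ψ x ≡ Ψ y → x ≡ y) →
            (P : Carrier → Carrier) → (∀ x → act M (Ψ x) ≡ (P x , f (P x))) → GraphOf f U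
  graphOf {U} {f} M S Ψ Ψ∈U Ψ-injective P e = record
    { M = M
    ; into = λ v∈U → into (parametrised Ψ Ψ∈U Ψ-injective v∈U)
    ; onto = λ x → onto (endo-injective⇒surjective P P-injective x)
    }
    where
      open Scattered S
      P-injective : ∀ {x y} → P x ≡ P y → x ≡ y
      P-injective {x} {y} Px≡Py = Ψ-injective (act-injective M
        (trans (e x) (trans (cong (λ p → (p , f p)) Px≡Py) (sym (e y)))))
      into : ∀ {v} → ∃[ x ] Ψ x ≡ v → ∃[ x ] act M v ≡ (x , f x)
      into (x , refl) = P x , e x
      onto : ∀ {x} → ∃[ y ] P y ≡ x → ∃[ v ] (U v × act M v ≡ (x , f x))
      onto (y , refl) = Ψ y , Ψ∈U y , e y

  -- The other exponents reduce to these: exchanging the coordinates turns T³ into T², and division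
  -- by δ turns the LP forms with s = 3, 4 into those with s = 2, 1.
  data Form : (Carrier → Carrier) → Set where
    pseudoregulus₁ : Form T
    pseudoregulus₂ : Form T²
    pseudoregulus₄ : Form T⁴
    LP₁ : ∀ δ → δ ≢ 0# → N δ ≢ 1# → Form (λ x → T x + δ * T⁴ x)
    LP₂ : ∀ δ → δ ≢ 0# → N δ ≢ 1# → Form (λ x → T² x + δ * T³ x)

  Classified : (Vec² → Set) → Set
  Classified U = ∃[ f ] (Form f × GraphOf f U)

  Classified-image : ∀ M {U} → Classified (image M U) → Classified U
  Classified-image M (f , form , g) = f , form , GraphOf-image M g

  identity : Matrix
  identity = diagonal 1≢0 1≢0

  act-identity : ∀ v → act identity v ≡ v
  act-identity (x , y) = trans (act-diagonal 1≢0 1≢0 x y) (cong₂ _,_ (*-identityˡ x) (*-identityˡ y))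

  L : Carrier → Carrier → Carrier → Carrier → Carrier
  L g₀ g₁ g₄ x = g₀ * x + (g₁ * T x + g₄ * T⁴ x)

  L-scale : ∀ g₀ g₁ g₄ {c} → Fixed c → ∀ x → L g₀ g₁ g₄ (c * x) ≡ c * L g₀ g₁ g₄ x
  L-scale g₀ g₁ g₄ {c} c-fixed x = begin
    g₀ * (c * x) + (g₁ * T (c * x) + g₄ * T⁴ (c * x))
      ≡⟨ cong₂ (λ s t → g₀ * (c * x) + (g₁ * s + g₄ * t))
           (trans (T-* c x) (cong (_* T x) c-fixed)) (trans (T⁴-* c x) (cong (_* T⁴ x) (Fixed-T⁴ c-fixed))) ⟩
    g₀ * (c * x) + (g₁ * (c * T x) + g₄ * (c * T⁴ x))
      ≡⟨ solve 7 (λ g₀ g₁ g₄ c x y z → g₀ :* (c :* x) :+ (g₁ :* (c :* y) :+ g₄ :* (c :* z))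
           := c :* (g₀ :* x :+ (g₁ :* y :+ g₄ :* z))) refl g₀ g₁ g₄ c x (T x) (T⁴ x) ⟩
    c * L g₀ g₁ g₄ x ∎

  L-combination : ∀ a b g₀ g₁ g₄ h₀ h₁ h₄ x →
    a * L g₀ g₁ g₄ x + b * L h₀ h₁ h₄ x ≡ L (a * g₀ + b * h₀) (a * g₁ + b * h₁) (a * g₄ + b * h₄) x
  L-combination a b g₀ g₁ g₄ h₀ h₁ h₄ x =
    solve 11 (λ a b g₀ g₁ g₄ h₀ h₁ h₄ x y z →
      a :* (g₀ :* x :+ (g₁ :* y :+ g₄ :* z)) :+ b :* (h₀ :* x :+ (h₁ :* y :+ h₄ :* z))
      := (a :* g₀ :+ b :* h₀) :* x :+ ((a :* g₁ :+ b :* h₁) :* y :+ (a :* g₄ :+ b :* h₄) :* z))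
      refl a b g₀ g₁ g₄ h₀ h₁ h₄ x (T x) (T⁴ x)

  L-cong : ∀ {g₀ g₁ g₄ h₀ h₁ h₄} → g₀ ≡ h₀ → g₁ ≡ h₁ → g₄ ≡ h₄ → ∀ x → L g₀ g₁ g₄ x ≡ L h₀ h₁ h₄ x
  L-cong refl refl refl x = refl

  Homogeneous : (Carrier → Vec²) → Set
  Homogeneous Ψ = ∀ {c} → Fixed c → ∀ x → Ψ (c * x) ≡ c ·ᵛ Ψ x

  -- By `dependent`, Ψ(ty) = l Ψ(y) = Ψ(ly) for some l in Fq, and injectivity gives t = l.
  collision : ∀ {U} → Scattered U → (Ψ : Carrier → Vec²) → (∀ x → U (Ψ x)) → (∀ {x y} → Ψ x ≡ Ψ y → x ≡ y) →
              Homogeneous Ψ → ∀ {y t} → y ≢ 0# →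
              proj₁ (Ψ y) * proj₂ (Ψ (t * y)) ≡ proj₂ (Ψ y) * proj₁ (Ψ (t * y)) → Fixed t
  collision S Ψ Ψ∈U Ψ-injective homogeneous {y} {t} y≢0 e = conclude (dependent (Ψ∈U y) Ψy≢0 (Ψ∈U (t * y)) e)
    where
      open Scattered S
      Ψy≢0 : Ψ y ≢ (0# , 0#)
      Ψy≢0 Ψy≡0 = y≢0 (trans (Ψ-injective (begin
        Ψ y ≡⟨ Ψy≡0 ⟩
        (0# , 0#) ≡⟨ sym (cong₂ _,_ (zeroˡ _) (zeroˡ _)) ⟩
        0# ·ᵛ Ψ y ≡⟨ sym (homogeneous T-0 y) ⟩
        Ψ (0# * y) ∎)) (zeroˡ y))
      conclude : ∃[ l ] (Fixed l × Ψ (t * y) ≡ l ·ᵛ Ψ y) → Fixed t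
      conclude (l , l-fixed , Ψty≡lΨy) = subst Fixed (cancelˡ y≢0 (trans (*-comm y l)
        (trans (Ψ-injective (trans (homogeneous l-fixed y) (sym Ψty≡lΨy))) (*-comm t y)))) l-fixed

  -- Norm 1 is excluded by twisting: if δT⁴l = Tl, then x ↦ lx turns Tx + δT⁴x into Tl (Tx + T⁴x),
  -- and the known collision for δ = 1 carries over.
  T+δT⁴-classified : ∀ {U} → Scattered U → ∀ δ → (∀ x → U (x , T x + δ * T⁴ x)) → Classified U
  T+δT⁴-classified {U} S δ Ψ∈U with δ ≟ 0# | N δ ≟ 1#
  ... | yes refl | _ = T , pseudoregulus₁ , graphOf identity S Ψ Ψ∈U (cong proj₁) (λ x → x)
        (λ x → trans (act-identity _) (cong (x ,_) (trans (cong (T x +_) (zeroˡ _)) (+-identityʳ _))))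
    where
      Ψ : Carrier → Vec²
      Ψ x = (x , T x + 0# * T⁴ x)
  ... | no δ≢0 | no Nδ≢1 = _ , LP₁ δ δ≢0 Nδ≢1 , graphOf identity S (λ x → (x , T x + δ * T⁴ x)) Ψ∈U (cong proj₁) (λ x → x) (λ x → act-identity _)
  ... | no δ≢0 | yes Nδ≡1 with norm-one δ Nδ≡1 | T+T⁴-collision
  ...   | l , l≢0 , δT⁴l≡Tl | y , t , y≢0 , t-moved , e = ⊥-elim (t-moved (collision S Ψ Ψ∈U (cong proj₁) homogeneous {l * y} {t} (product-nonzero l≢0 y≢0)
          (begin
            (l * y) * (T (t * (l * y)) + δ * T⁴ (t * (l * y)))
              ≡⟨ cong ((l * y) *_) (trans (cong (λ s → T s + δ * T⁴ s) (solve 3 (λ t l y → t :* (l :* y) := l :* (t :* y)) refl t l y)) (twist (t * y))) ⟩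
            (l * y) * (T l * (T (t * y) + T⁴ (t * y))) ≡⟨ cong (λ s → (l * y) * (T l * s)) (sym e) ⟩
            (l * y) * (T l * (t * (T y + T⁴ y)))
              ≡⟨ solve 5 (λ l y l′ t s → (l :* y) :* (l′ :* (t :* s)) := (l′ :* s) :* (t :* (l :* y))) refl l y (T l) t (T y + T⁴ y) ⟩
            (T l * (T y + T⁴ y)) * (t * (l * y)) ≡⟨ cong (_* (t * (l * y))) (sym (twist y)) ⟩
            (T (l * y) + δ * T⁴ (l * y)) * (t * (l * y)) ∎)))
    where
      Ψ : Carrier → Vec²
      Ψ x = (x , T x + δ * T⁴ x)
      twist : ∀ x → T (l * x) + δ * T⁴ (l * x) ≡ T l * (T x + T⁴ x)
      twist x = begin
        T (l * x) + δ * T⁴ (l * x) ≡⟨ cong₂ (λ s t → s + δ * t) (T-* l x) (T⁴-* l x) ⟩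
        T l * T x + δ * (T⁴ l * T⁴ x) ≡⟨ linear₁ δT⁴l≡Tl (T⁴ x)
          (solve 5 (λ l l₄ x x₄ d → (l :* x :+ d :* (l₄ :* x₄)) :- l :* (x :+ x₄) := x₄ :* (d :* l₄ :- l)) refl (T l) (T⁴ l) (T x) (T⁴ x) δ) ⟩
        T l * (T x + T⁴ x) ∎
      homogeneous : Homogeneous Ψ
      homogeneous {c} c-fixed x = cong (c * x ,_) (begin
        T (c * x) + δ * T⁴ (c * x) ≡⟨ cong₂ (λ s t → s + δ * t) (trans (T-* c x) (cong (_* T x) c-fixed)) (trans (T⁴-* c x) (cong (_* T⁴ x) (Fixed-T⁴ c-fixed))) ⟩
        c * T x + δ * (c * T⁴ x) ≡⟨ solve 4 (λ c x y d → c :* x :+ d :* (c :* y) := c :* (x :+ d :* y)) refl c (T x) (T⁴ x) δ ⟩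
        c * (T x + δ * T⁴ x) ∎)

  sT+rT⁴-classified : ∀ {U} → Scattered U → ∀ s r → (∀ x → U (x , s * T x + r * T⁴ x)) → Classified U
  sT+rT⁴-classified {U} S s r Ψ∈U with s ≟ 0# | r ≟ 0#
  -- Here U contains every (x, 0), so scatteredness would make each element of F fixed.
  ... | yes refl | yes refl = ⊥-elim (proj₂ moved (scattered (subst U (cong (1# ,_) null) (Ψ∈U 1#)) (λ e → 1≢0 (cong proj₁ e))
          (subst U (cong₂ _,_ (sym (*-identityʳ θ)) (trans null (sym (zeroʳ θ)))) (Ψ∈U θ))))
    where
      open Scattered S
      θ = proj₁ moved
      null : ∀ {x y} → 0# * x + 0# * y ≡ 0#
      null {x} {y} = solve 2 (λ x y → :0 :* x :+ :0 :* y := :0) refl x y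
  ... | yes refl | no r≢0 with inverse r r≢0
  ...   | i , ri≡1 = T⁴ , pseudoregulus₄ , graphOf (diagonal 1≢0 i≢0) S (λ x → (x , 0# * T x + r * T⁴ x)) Ψ∈U (cong proj₁) (λ x → x)
            (λ x → trans (act-diagonal 1≢0 i≢0 _ _) (cong₂ _,_ (*-identityˡ x)
              (linear₁ ri≡1 (T⁴ x) (solve 4 (λ r i x y → i :* (:0 :* x :+ r :* y) :- y := y :* (r :* i :- :1)) refl r i (T x) (T⁴ x)))))
    where
      i≢0 : i ≢ 0#
      i≢0 = factor-nonzeroʳ ri≡1 1≢0
  sT+rT⁴-classified {U} S s r Ψ∈U | no s≢0 | _ with inverse s s≢0
  ... | i , si≡1 = Classified-image M (T+δT⁴-classified (image-scattered M S) (i * r)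
          (λ x → _ , Ψ∈U x , trans (act-diagonal 1≢0 i≢0 _ _) (cong₂ _,_ (*-identityˡ x)
            (linear₁ si≡1 (T x) (solve 5 (λ s r i x y → i :* (s :* x :+ r :* y) :- (x :+ (i :* r) :* y) := x :* (s :* i :- :1)) refl s r i (T x) (T⁴ x))))))
    where
      i≢0 : i ≢ 0#
      i≢0 = factor-nonzeroʳ si≡1 1≢0
      M = diagonal 1≢0 i≢0

  N-fixed : ∀ {δ} → Fixed δ → N δ ≡ δ * (δ * (δ * (δ * δ)))
  N-fixed {δ} δ-fixed = product-cong δ-fixed δ₂ δ₃ (Fixed-T⁴ δ-fixed)
    where
      product-cong : ∀ {a b c d a′ b′ c′ d′} → a ≡ a′ → b ≡ b′ → c ≡ c′ → d ≡ d′ → δ * (a * (b * (c * d))) ≡ δ * (a′ * (b′ * (c′ * d′)))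
      product-cong refl refl refl refl = refl
      δ₂ : T² δ ≡ δ
      δ₂ = trans (cong T δ-fixed) δ-fixed
      δ₃ : T³ δ ≡ δ
      δ₃ = trans (cong T δ₂) δ-fixed

  T-difference : ∀ x c y → T (x - c * y) ≡ T x - T c * T y
  T-difference x c y = trans (T-+ x _) (cong (T x +_) (trans (T-neg _) (cong -_ (T-* c y))))

  fixed-binomial-classified : ∀ {U} → Scattered U → ∀ c a → Fixed c →
    (∀ x → U (T⁴ x - c * x , T x - a * x)) →
    (∀ {x y} → (T⁴ x - c * x , T x - a * x) ≡ (T⁴ y - c * y , T y - a * y) → x ≡ y) → Classified U
  fixed-binomial-classified {U} S c a c-fixed Ψ∈U Ψ-injective = cases (binomial-collision c a c-fixed)
    where
      Ψ : Carrier → Vec²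
      Ψ x = (T⁴ x - c * x , T x - a * x)

      homogeneous : Homogeneous Ψ
      homogeneous {k} k-fixed x = cong₂ _,_
        (trans (cong (_- c * (k * x)) (trans (T⁴-* k x) (cong (_* T⁴ x) (Fixed-T⁴ k-fixed)))) (factor c (T⁴ x)))
        (trans (cong (_- a * (k * x)) (trans (T-* k x) (cong (_* T x) k-fixed))) (factor a (T x)))
        where
          factor : ∀ c y → k * y - c * (k * x) ≡ k * (y - c * x)
          factor c y = solve 4 (λ k y c x → k :* y :- c :* (k :* x) := k :* (y :- c :* x)) refl k y c x

      -- With z = t - T⁴t one has both Tt = t + Tz and T⁴t = t - z. In the determinant of Ψ(y) and
      -- Ψ(ty) the terms with t cancel, and the condition left involves only y and z. Hence t would
      -- lie in Fq, that is z = 0.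
      collides : ∀ {y z t} → y ≢ 0# → z ≢ 0# → t - T⁴ t ≡ z →
        a * (y * (T⁴ y * z)) + c * (y * (T y * T z)) ≡ T y * (T⁴ y * (z + T z)) → ⊥
      collides {y} {z} {t} y≢0 z≢0 t-T⁴t≡z e = z≢0 (trans (sym t-T⁴t≡z) (difference-zero (sym (Fixed-T⁴ (collision S Ψ Ψ∈U Ψ-injective homogeneous y≢0 (begin
        (T⁴ y - c * y) * (T (t * y) - a * (t * y)) ≡⟨ cong (λ s → (T⁴ y - c * y) * (s - a * (t * y))) (T-* t y) ⟩
        (T⁴ y - c * y) * (T t * T y - a * (t * y)) ≡⟨ cong ((T⁴ y - c * y) *_) move₁ ⟩
        (T⁴ y - c * y) * (t * (T y - a * y) + T z * T y)
          ≡⟨ linear₁ cancels 1# (solve 5 (λ v w t p r → v :* (t :* w :+ p) :- w :* (t :* v :- r) := :1 :* ((v :* p :+ w :* r) :- :0))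
               refl (T⁴ y - c * y) (T y - a * y) t (T z * T y) (z * T⁴ y)) ⟩
        (T y - a * y) * (t * (T⁴ y - c * y) - z * T⁴ y) ≡⟨ cong ((T y - a * y) *_) (sym move₄) ⟩
        (T y - a * y) * (T⁴ t * T⁴ y - c * (t * y)) ≡⟨ cong (λ s → (T y - a * y) * (s - c * (t * y))) (sym (T⁴-* t y)) ⟩
        (T y - a * y) * (T⁴ (t * y) - c * (t * y)) ∎))))))
        where
          Tz : T z ≡ T t - t
          Tz = trans (cong T (sym t-T⁴t≡z)) (trans (T-+ t _) (cong (T t +_) (trans (T-neg _) (cong -_ (T⁵-identity t)))))
          move₁ : T t * T y - a * (t * y) ≡ t * (T y - a * y) + T z * T y
          move₁ = linear₁ Tz (- T y) (solve 6 (λ a y y₁ t t₁ z₁ → (t₁ :* y₁ :- a :* (t :* y)) :- (t :* (y₁ :- a :* y) :+ z₁ :* y₁)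
            := (:- y₁) :* (z₁ :- (t₁ :- t))) refl a y (T y) t (T t) (T z))
          move₄ : T⁴ t * T⁴ y - c * (t * y) ≡ t * (T⁴ y - c * y) - z * T⁴ y
          move₄ = linear₁ t-T⁴t≡z (- T⁴ y) (solve 6 (λ c y y₄ t t₄ z → (t₄ :* y₄ :- c :* (t :* y)) :- (t :* (y₄ :- c :* y) :- z :* y₄)
            := (:- y₄) :* ((t :- t₄) :- z)) refl c y (T⁴ y) t (T⁴ t) z)
          cancels : (T⁴ y - c * y) * (T z * T y) + (T y - a * y) * (z * T⁴ y) ≡ 0#
          cancels = linear₁ e (- 1#) (solve 7 (λ a c y y₁ y₄ z z₁ → ((y₄ :- c :* y) :* (z₁ :* y₁) :+ (y₁ :- a :* y) :* (z :* y₄)) :- :0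
            := (:- :1) :* ((a :* (y :* (y₄ :* z)) :+ c :* (y :* (y₁ :* z₁))) :- y₁ :* (y₄ :* (z :+ z₁)))) refl a c y (T y) (T⁴ y) z (T z))

      cases : BinomialCollision c a ⊎ (c ≡ 0# × a ≡ 0#) ⊎ a * c ≡ 1# ⊎ ∃ (BinomialException c a) → Classified U
      cases (inj₁ (y , z , y≢0 , z≢0 , Trz≡0 , e)) =
        let (t , t-T⁴t≡z) = trace-zero⇒difference trace-one z Trz≡0 in ⊥-elim (collides y≢0 z≢0 t-T⁴t≡z e)
      -- The vectors are (T⁴x, Tx) = (y, T²y) with y = T⁴x.
      cases (inj₂ (inj₁ (c≡0 , a≡0))) = T² , pseudoregulus₂ , graphOf identity S Ψ Ψ∈U Ψ-injective T⁴
        (λ x → trans (act-identity _) (cong₂ _,_ (drop c≡0) (trans (drop a≡0) (sym (cong T (T⁵-identity x))))))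
        where
          drop : ∀ {c x y} → c ≡ 0# → y - c * x ≡ y
          drop {c} {x} {y} refl = solve 2 (λ x y → y :- :0 :* x := y) refl x y
      -- Since c lies in Fq and ac = 1, -c(Tx - ax) = x - cTx is the image under T of T⁴x - cx.
      cases (inj₂ (inj₂ (inj₁ ac≡1))) = T , pseudoregulus₁ , graphOf (diagonal 1≢0 -c≢0) S Ψ Ψ∈U Ψ-injective (λ x → T⁴ x - c * x)
        (λ x → trans (act-diagonal 1≢0 -c≢0 _ _) (cong₂ _,_ (*-identityˡ _) (begin
          - c * (T x - a * x) ≡⟨ linear₁ ac≡1 x (solve 4 (λ a c x y → (:- c) :* (y :- a :* x) :- (x :- c :* y) := x :* (a :* c :- :1)) refl a c x (T x)) ⟩
          x - c * T x ≡⟨ sym (cong₂ (λ s k → s - k * T x) (T⁵-identity x) c-fixed) ⟩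
          T (T⁴ x) - T c * T x ≡⟨ sym (T-difference (T⁴ x) c x) ⟩
          T (T⁴ x - c * x) ∎)))
        where
          -c≢0 : - c ≢ 0#
          -c≢0 = negation-nonzero (factor-nonzeroʳ ac≡1 1≢0)
      cases (inj₂ (inj₂ (inj₂ (δ , δ-fixed , δ≢0 , Nδ≢1 , e₁ , e₂)))) =
        _ , LP₂ δ δ≢0 Nδ≢1 , graphOf M S Ψ Ψ∈U Ψ-injective P (λ x → cong₂ _,_ (first x) (second x))
        where
          M = matrix 1# (δ * δ) (δ * δ * δ) 1# λ e → Nδ≢1 (trans (N-fixed δ-fixed)
            (linear₁ e (- 1#) (solve 1 (λ d → d :* (d :* (d :* (d :* d))) :- :1 := (:- :1) :* ((:1 :* :1 :- (d :* d) :* (d :* d :* d)) :- :0)) refl δ)))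
          P : Carrier → Carrier
          P x = T⁴ x + δ * (δ * T x - x)
          TP : ∀ s t r → T (s + δ * (δ * t - r)) ≡ T s + δ * (δ * T t - T r)
          TP s t r = trans (T-+ s _) (cong (T s +_) (trans (T-* δ _) (cong₂ _*_ δ-fixed
            (trans (T-+ _ _) (cong₂ _+_ (trans (T-* δ t) (cong (_* T t) δ-fixed)) (T-neg r))))))
          first : ∀ x → 1# * (T⁴ x - c * x) + (δ * δ) * (T x - a * x) ≡ P x
          first x = linear₁ e₁ (- x) (solve 6 (λ d c a x x₁ x₄ →
            (:1 :* (x₄ :- c :* x) :+ (d :* d) :* (x₁ :- a :* x)) :- (x₄ :+ d :* (d :* x₁ :- x)) := (:- x) :* ((c :+ d :* d :* a) :- d))
            refl δ c a x (T x) (T⁴ x))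
          T²P : ∀ x → T² (P x) ≡ T x + δ * (δ * T³ x - T² x)
          T²P x = begin
            T² (P x) ≡⟨ cong T (TP (T⁴ x) (T x) x) ⟩
            T (T (T⁴ x) + δ * (δ * T² x - T x)) ≡⟨ TP (T (T⁴ x)) (T² x) (T x) ⟩
            T (T (T⁴ x)) + δ * (δ * T³ x - T² x) ≡⟨ cong (λ s → T s + δ * (δ * T³ x - T² x)) (T⁵-identity x) ⟩
            T x + δ * (δ * T³ x - T² x) ∎
          second : ∀ x → (δ * δ * δ) * (T⁴ x - c * x) + 1# * (T x - a * x) ≡ T² (P x) + δ * T³ (P x)
          second x = begin
            (δ * δ * δ) * (T⁴ x - c * x) + 1# * (T x - a * x)
              ≡⟨ linear₁ e₂ (- x) (solve 6 (λ d c a x x₁ x₄ →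
                   ((d :* d :* d) :* (x₄ :- c :* x) :+ :1 :* (x₁ :- a :* x)) :- (x₁ :+ d :* d :* d :* x₄)
                   := (:- x) :* ((a :+ d :* d :* d :* c) :- :0)) refl δ c a x (T x) (T⁴ x)) ⟩
            T x + δ * δ * δ * T⁴ x
              ≡⟨ solve 5 (λ d x₁ x₂ x₃ x₄ → x₁ :+ d :* d :* d :* x₄
                   := (x₁ :+ d :* (d :* x₃ :- x₂)) :+ d :* (x₂ :+ d :* (d :* x₄ :- x₃))) refl δ (T x) (T² x) (T³ x) (T⁴ x) ⟩
            (T x + δ * (δ * T³ x - T² x)) + δ * (T² x + δ * (δ * T⁴ x - T³ x))
              ≡⟨ sym (cong₂ (λ s t → s + δ * t) (T²P x) (trans (cong T (T²P x)) (TP (T x) (T³ x) (T² x)))) ⟩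
            T² (P x) + δ * T³ (P x) ∎

  -- Replacing x by (Tl)x multiplies T⁴x by l and Tx by T²l. After division by these factors c has
  -- become c Tl / l, which `hilbert90` places in Fq for a suitable l.
  binomial-classified : ∀ {U} → Scattered U → ∀ c a →
    (∀ x → U (T⁴ x - c * x , T x - a * x)) →
    (∀ {x y} → (T⁴ x - c * x , T x - a * x) ≡ (T⁴ y - c * y , T y - a * y) → x ≡ y) → Classified U
  binomial-classified {U} S c a Ψ∈U Ψ-injective with hilbert90 c
  ... | l , c′ , l≢0 , c′-fixed , cTl≡c′l with inverse l l≢0 | inverse (T² l) (T-nonzero (T-nonzero l≢0))
  ... | i , li≡1 | j , T²lj≡1 = Classified-image M (fixed-binomial-classified (image-scattered M S) c′ a′ c′-fixed
          (λ x → _ , Ψ∈U (T l * x) , rescaled x)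
          (λ {x} {y} e → cancelˡ (T-nonzero l≢0) (Ψ-injective (act-injective M (trans (rescaled x) (trans e (sym (rescaled y))))))))
    where
      a′ = j * (a * T l)
      i≢0 : i ≢ 0#
      i≢0 = factor-nonzeroʳ li≡1 1≢0
      j≢0 : j ≢ 0#
      j≢0 = factor-nonzeroʳ T²lj≡1 1≢0
      M = diagonal i≢0 j≢0
      rescaled : ∀ x → act M (T⁴ (T l * x) - c * (T l * x) , T (T l * x) - a * (T l * x)) ≡ (T⁴ x - c′ * x , T x - a′ * x)
      rescaled x = trans (act-diagonal i≢0 j≢0 _ _) (cong₂ _,_
        (begin
          i * (T⁴ (T l * x) - c * (T l * x)) ≡⟨ cong (λ s → i * (s - c * (T l * x))) (trans (T⁴-* (T l) x) (cong (_* T⁴ x) (T⁵-identity l))) ⟩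
          i * (l * T⁴ x - c * (T l * x))
            ≡⟨ linear₂ li≡1 (T⁴ x - c′ * x) cTl≡c′l (- (i * x)) (solve 7 (λ i l l₁ c c′ x x₄ →
                 i :* (l :* x₄ :- c :* (l₁ :* x)) :- (x₄ :- c′ :* x)
                 := (x₄ :- c′ :* x) :* (l :* i :- :1) :+ (:- (i :* x)) :* (c :* l₁ :- c′ :* l)) refl i l (T l) c c′ x (T⁴ x)) ⟩
          T⁴ x - c′ * x ∎)
        (begin
          j * (T (T l * x) - a * (T l * x)) ≡⟨ cong (λ s → j * (s - a * (T l * x))) (T-* (T l) x) ⟩
          j * (T² l * T x - a * (T l * x))
            ≡⟨ linear₁ T²lj≡1 (T x) (solve 6 (λ j l₁ l₂ a x x₁ →
                 j :* (l₂ :* x₁ :- a :* (l₁ :* x)) :- (x₁ :- (j :* (a :* l₁)) :* x) := x₁ :* (l₂ :* j :- :1)) refl j (T l) (T² l) a x (T x)) ⟩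
          T x - a′ * x ∎))

  module _ (g₀ g₁ g₄ h₀ h₁ h₄ : Carrier) where

    Trinomials : Carrier → Vec²
    Trinomials x = (L g₀ g₁ g₄ x , L h₀ h₁ h₄ x)

    Trinomials-homogeneous : Homogeneous Trinomials
    Trinomials-homogeneous c-fixed x = cong₂ _,_ (L-scale g₀ g₁ g₄ c-fixed x) (L-scale h₀ h₁ h₄ c-fixed x)

    record Binomials : Set where
      field
        M : Matrix
        c a : Carrier
        reduced : ∀ x → act M (Trinomials x) ≡ (T⁴ x - c * x , T x - a * x)

    binomials : g₁ * h₄ - g₄ * h₁ ≢ 0# → Binomials
    binomials Δ≢0 with inverse (g₁ * h₄ - g₄ * h₁) Δ≢0
    ... | i , Δi≡1 = record
      { M = matrix (- (h₁ * i)) (g₁ * i) (h₄ * i) (- (g₄ * i)) det≢0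
      ; c = - (- (h₁ * i) * g₀ + g₁ * i * h₀)
      ; a = - (h₄ * i * g₀ + - (g₄ * i) * h₀)
      ; reduced = λ x → cong₂ _,_
          (trans (L-combination (- (h₁ * i)) (g₁ * i) g₀ g₁ g₄ h₀ h₁ h₄ x)
            (trans (L-cong refl coefficient₁ coefficient₂ x)
              (solve 4 (λ p x₀ x₁ x₄ → p :* x₀ :+ (:0 :* x₁ :+ :1 :* x₄) := x₄ :- (:- p) :* x₀) refl (- (h₁ * i) * g₀ + g₁ * i * h₀) x (T x) (T⁴ x))))
          (trans (L-combination (h₄ * i) (- (g₄ * i)) g₀ g₁ g₄ h₀ h₁ h₄ x)
            (trans (L-cong refl coefficient₃ coefficient₄ x)
              (solve 4 (λ p x₀ x₁ x₄ → p :* x₀ :+ (:1 :* x₁ :+ :0 :* x₄) := x₁ :- (:- p) :* x₀) refl (h₄ * i * g₀ + - (g₄ * i) * h₀) x (T x) (T⁴ x))))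
      }
      where
        i≢0 : i ≢ 0#
        i≢0 = factor-nonzeroʳ Δi≡1 1≢0
        det≢0 : - (h₁ * i) * - (g₄ * i) - g₁ * i * (h₄ * i) ≢ 0#
        det≢0 e = negation-nonzero i≢0 (trans (linear₁ Δi≡1 i
          (solve 5 (λ g₁ g₄ h₁ h₄ i → (:- i) :- ((:- (h₁ :* i)) :* (:- (g₄ :* i)) :- g₁ :* i :* (h₄ :* i))
            := i :* ((g₁ :* h₄ :- g₄ :* h₁) :* i :- :1)) refl g₁ g₄ h₁ h₄ i)) e)
        coefficient₁ : - (h₁ * i) * g₁ + g₁ * i * h₁ ≡ 0#
        coefficient₁ = solve 3 (λ h g i → (:- (h :* i)) :* g :+ g :* i :* h := :0) refl h₁ g₁ i
        coefficient₂ : - (h₁ * i) * g₄ + g₁ * i * h₄ ≡ 1#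
        coefficient₂ = trans (solve 5 (λ g₁ g₄ h₁ h₄ i → (:- (h₁ :* i)) :* g₄ :+ g₁ :* i :* h₄ := (g₁ :* h₄ :- g₄ :* h₁) :* i) refl g₁ g₄ h₁ h₄ i) Δi≡1
        coefficient₃ : h₄ * i * g₁ + - (g₄ * i) * h₁ ≡ 1#
        coefficient₃ = trans (solve 5 (λ g₁ g₄ h₁ h₄ i → h₄ :* i :* g₁ :+ (:- (g₄ :* i)) :* h₁ := (g₁ :* h₄ :- g₄ :* h₁) :* i) refl g₁ g₄ h₁ h₄ i) Δi≡1
        coefficient₄ : h₄ * i * g₄ + - (g₄ * i) * h₄ ≡ 0#
        coefficient₄ = solve 3 (λ h g i → h :* i :* g :+ (:- (g :* i)) :* h := :0) refl h₄ g₄ i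

    record Dependence : Set where
      field
        M : Matrix
        relation₁ : Matrix.a M * g₁ + Matrix.b M * h₁ ≡ 0#
        relation₄ : Matrix.a M * g₄ + Matrix.b M * h₄ ≡ 0#

    -- The columns (g₁, h₁) and (g₄, h₄) are dependent. The first row of `M` is chosen orthogonal to
    -- a nonzero one among them, or is arbitrary if both vanish; the case distinction finds a
    -- nonzero entry.
    dependence : g₁ * h₄ - g₄ * h₁ ≡ 0# → Dependence
    dependence Δ≡0 with h₁ ≟ 0# | g₁ ≟ 0#
    ... | no h₁≢0 | _ = record
      { M = matrix h₁ (- g₁) 0# 1# λ e → h₁≢0 (trans (solve 2 (λ h g → h := h :* :1 :- (:- g) :* :0) refl h₁ g₁) e)
      ; relation₁ = solve 2 (λ h g → h :* g :+ (:- g) :* h := :0) refl h₁ g₁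
      ; relation₄ = linear₁ Δ≡0 (- 1#) (solve 4 (λ g₁ g₄ h₁ h₄ → (h₁ :* g₄ :+ (:- g₁) :* h₄) :- :0 := (:- :1) :* ((g₁ :* h₄ :- g₄ :* h₁) :- :0)) refl g₁ g₄ h₁ h₄)
      }
    ... | yes refl | no g₁≢0 = record
      { M = matrix 0# g₁ 1# 0# λ e → g₁≢0 (linear₁ e (- 1#) (solve 1 (λ g → g :- :0 := (:- :1) :* ((:0 :* :0 :- g :* :1) :- :0)) refl g₁))
      ; relation₁ = solve 1 (λ g → :0 :* g :+ g :* :0 := :0) refl g₁
      ; relation₄ = linear₁ Δ≡0 1# (solve 3 (λ g₁ g₄ h₄ → (:0 :* g₄ :+ g₁ :* h₄) :- :0 := :1 :* ((g₁ :* h₄ :- g₄ :* :0) :- :0)) refl g₁ g₄ h₄)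
      }
    ... | yes refl | yes refl with h₄ ≟ 0#
    ...   | no h₄≢0 = record
      { M = matrix h₄ (- g₄) 0# 1# λ e → h₄≢0 (trans (solve 2 (λ h g → h := h :* :1 :- (:- g) :* :0) refl h₄ g₄) e)
      ; relation₁ = solve 2 (λ h g → h :* :0 :+ (:- g) :* :0 := :0) refl h₄ g₄
      ; relation₄ = solve 2 (λ h g → h :* g :+ (:- g) :* h := :0) refl h₄ g₄
      }
    ...   | yes refl = record
      { M = matrix 0# 1# 1# 0# λ e → 1≢0 (linear₁ e (- 1#) (solve 0 (:1 :- :0 := (:- :1) :* ((:0 :* :0 :- :1 :* :1) :- :0)) refl))
      ; relation₁ = solve 0 (:0 :* :0 :+ :1 :* :0 := :0) refl
      ; relation₄ = solve 1 (λ g → :0 :* g :+ :1 :* :0 := :0) refl g₄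
      }

  line-classified : ∀ {U} → Scattered U → ∀ e b₀ b₁ b₄ → (∀ x → U (L e 0# 0# x , L b₀ b₁ b₄ x)) →
    (∀ {x y} → (L e 0# 0# x , L b₀ b₁ b₄ x) ≡ (L e 0# 0# y , L b₀ b₁ b₄ y) → x ≡ y) → Classified U
  line-classified {U} S e b₀ b₁ b₄ Ψ∈U Ψ-injective with e ≟ 0#
  -- For e = 0 all of U lies in a single point of the projective line, so `collision` applies to 1
  -- and every t, in particular to a moved one.
  ... | yes refl = ⊥-elim (proj₂ moved (collision S (Trinomials 0# 0# 0# b₀ b₁ b₄) Ψ∈U Ψ-injective
          (Trinomials-homogeneous 0# 0# 0# b₀ b₁ b₄) 1≢0
          (trans (trans (cong (_* L b₀ b₁ b₄ (proj₁ moved * 1#)) (null 1#)) (zeroˡ _))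
                 (sym (trans (cong (L b₀ b₁ b₄ 1# *_) (null (proj₁ moved * 1#))) (zeroʳ _))))))
    where
      null : ∀ x → L 0# 0# 0# x ≡ 0#
      null x = solve 3 (λ x y z → :0 :* x :+ (:0 :* y :+ :0 :* z) := :0) refl x (T x) (T⁴ x)
  ... | no e≢0 with inverse e e≢0
  ...   | i , ei≡1 = Classified-image M (sT+rT⁴-classified (image-scattered M S) b₁ b₄ (λ x → _ , Ψ∈U x , cong₂ _,_
            (linear₁ ei≡1 x (solve 6 (λ e i x y z s → i :* (e :* x :+ (:0 :* y :+ :0 :* z)) :+ :0 :* s :- x := x :* (e :* i :- :1)) refl e i x (T x) (T⁴ x) (L b₀ b₁ b₄ x)))
            (linear₁ ei≡1 (- (b₀ * x)) (solve 8 (λ e i b₀ b₁ b₄ x y z →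
               (:- (b₀ :* i)) :* (e :* x :+ (:0 :* y :+ :0 :* z)) :+ :1 :* (b₀ :* x :+ (b₁ :* y :+ b₄ :* z)) :- (b₁ :* y :+ b₄ :* z)
               := (:- (b₀ :* x)) :* (e :* i :- :1)) refl e i b₀ b₁ b₄ x (T x) (T⁴ x)))))
    where
      M = matrix i 0# (- (b₀ * i)) 1# λ d → factor-nonzeroʳ ei≡1 1≢0
        (trans (solve 2 (λ i b → i := i :* :1 :- :0 :* (:- (b :* i))) refl i b₀) d)

  -- If the coefficients of Tx and T⁴x have nonzero determinant, row operations isolate T⁴x and Tx;
  -- otherwise one row operation removes both from the first coordinate.
  trinomials-classified : ∀ {U} → Scattered U → ∀ g₀ g₁ g₄ h₀ h₁ h₄ →
    (∀ x → U (Trinomials g₀ g₁ g₄ h₀ h₁ h₄ x)) →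
    (∀ {x y} → Trinomials g₀ g₁ g₄ h₀ h₁ h₄ x ≡ Trinomials g₀ g₁ g₄ h₀ h₁ h₄ y → x ≡ y) → Classified U
  trinomials-classified {U} S g₀ g₁ g₄ h₀ h₁ h₄ Ψ∈U Ψ-injective with g₁ * h₄ - g₄ * h₁ ≟ 0#
  ... | no Δ≢0 = Classified-image M (binomial-classified (image-scattered M S) c a
          (λ x → _ , Ψ∈U x , reduced x)
          (λ {x} {y} e → Ψ-injective (act-injective M (trans (reduced x) (trans e (sym (reduced y)))))))
    where open Binomials (binomials g₀ g₁ g₄ h₀ h₁ h₄ Δ≢0)
  ... | yes Δ≡0 = Classified-image M (line-classified (image-scattered M S) _ _ _ _
          (λ x → _ , Ψ∈U x , reduced x)
          (λ {x} {y} e → Ψ-injective (act-injective M (trans (reduced x) (trans e (sym (reduced y)))))))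
    where
      open Dependence (dependence g₀ g₁ g₄ h₀ h₁ h₄ Δ≡0)
      open Matrix M
      reduced : ∀ x → act M (Trinomials g₀ g₁ g₄ h₀ h₁ h₄ x)
        ≡ (L (a * g₀ + b * h₀) 0# 0# x , L (c * g₀ + d * h₀) (c * g₁ + d * h₁) (c * g₄ + d * h₄) x)
      reduced x = cong₂ _,_
        (trans (L-combination a b g₀ g₁ g₄ h₀ h₁ h₄ x) (L-cong refl relation₁ relation₄ x))
        (L-combination c d g₀ g₁ g₄ h₀ h₁ h₄ x)

  -- Subspaces containing a hyperplane of the graph of T

  module _ {U : Vec² → Set} (S : Scattered U) (hyperplane : ∀ {z} → Tr z ≡ 0# → U (z , T z)) where
    open Scattered S

    -- The vector (y, Ty + e) lies in U, as it differs from (β, γ) by (y - β, T(y - β)) in the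
    -- hyperplane. Being proportional to (z, Tz), it is an Fq-multiple of it, hence has trace zero
    -- and lies on the graph of T. The conclusion is not absurd in itself: `TraceCollision 0# 0#`
    -- holds with y = 0.
    trace-collision : ∀ {β γ e} → U (β , γ) → γ ≡ T β + e → TraceCollision (Tr β) e → Tr β ≡ 0# × e ≡ 0#
    trace-collision {β} {γ} {e} βγ∈U refl (y , z , z≢0 , Trz≡0 , Try≡Trβ , ez≡) =
      conclude (dependent (hyperplane Trz≡0) (λ null → z≢0 (cong proj₁ null)) y∈U
        (linear₁ ez≡ 1# (solve 5 (λ z z₁ y y₁ e → z :* (y₁ :+ e) :- z₁ :* y := :1 :* (e :* z :- (y :* z₁ :- z :* y₁))) refl z (T z) y (T y) e)))
      where
        Tr-difference : Tr (y - β) ≡ 0#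
        Tr-difference = trans (Tr-+ y (- β)) (trans (cong (Tr y +_) (Tr-neg β)) (difference-zero Try≡Trβ))
        y∈U : U (y , T y + e)
        y∈U = subst U (cong₂ _,_
            (solve 2 (λ y b → (y :- b) :+ b := y) refl y β)
            (trans (cong (_+ (T β + e)) (trans (T-+ y (- β)) (cong (T y +_) (T-neg β))))
              (solve 3 (λ y b e → (y :- b) :+ (b :+ e) := y :+ e) refl (T y) (T β) e)))
          (+-closed (hyperplane Tr-difference) βγ∈U)
        conclude : ∃[ l ] (Fixed l × (y , T y + e) ≡ l ·ᵛ (z , T z)) → Tr β ≡ 0# × e ≡ 0#
        conclude (l , l-fixed , y≡) =
          trans (sym Try≡Trβ) (trans (cong Tr (cong proj₁ y≡)) (trans (Tr-scale l-fixed z) (trans (cong (l *_) Trz≡0) (zeroʳ l)))) ,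
          linear₁ (begin
            T y + e ≡⟨ cong proj₂ y≡ ⟩
            l * T z ≡⟨ cong (_* T z) (sym l-fixed) ⟩
            T l * T z ≡⟨ sym (T-* l z) ⟩
            T (l * z) ≡⟨ cong T (sym (cong proj₁ y≡)) ⟩
            T y ∎) 1# (solve 2 (λ t e → e :- :0 := :1 :* ((t :+ e) :- t)) refl (T y) e)

    trace-one-classified : ∀ {β γ e} → U (β , γ) → Tr β ≡ 1# → γ ≡ T β + e → Classified U
    trace-one-classified {β} {γ} {e} βγ∈U Trβ≡1 γ≡ = cases (trace-one-collision e)
      where
        Ψ : Carrier → Vec²
        Ψ y = (y , T y + e * Tr y)
        Ψ∈U : ∀ y → U (Ψ y)
        -- Subtracting Tr(y) β from y leaves an element of trace zero, whose vector lies in the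
        -- hyperplane; adding Tr(y) (β, γ) gives Ψ y.
        Ψ∈U y = subst U (cong₂ _,_
            (solve 2 (λ y p → (y :- p) :+ p := y) refl y (Tr y * β))
            (begin
              T (y - Tr y * β) + Tr y * γ ≡⟨ cong₂ _+_ (trans (T-difference y (Tr y) β) (cong (λ s → T y - s * T β) (Tr-fixed y))) (cong (Tr y *_) γ≡) ⟩
              (T y - Tr y * T β) + Tr y * (T β + e) ≡⟨ solve 4 (λ y t b e → (y :- t :* b) :+ t :* (b :+ e) := y :+ e :* t) refl (T y) (Tr y) (T β) e ⟩
              T y + e * Tr y ∎))
          (+-closed (hyperplane trace) (·-closed (Tr-fixed y) βγ∈U))
          where
            trace : Tr (y - Tr y * β) ≡ 0#
            trace = trans (Tr-+ y _) (trans (cong (Tr y +_) (trans (Tr-neg _) (cong -_ (Tr-scale (Tr-fixed y) β))))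
              (linear₁ Trβ≡1 (- Tr y) (solve 2 (λ t b → (t :- t :* b) :- :0 := (:- t) :* (b :- :1)) refl (Tr y) (Tr β))))

        cases : TraceCollision 1# e ⊎ e ≡ 0# ⊎ ∃ (TraceException e) → Classified U
        cases (inj₁ collides) = ⊥-elim (1≢0 (trans (sym Trβ≡1) (proj₁ (trace-collision βγ∈U γ≡ (subst (λ t → TraceCollision t e) (sym Trβ≡1) collides)))))
        cases (inj₂ (inj₁ e≡0)) = T , pseudoregulus₁ , graphOf identity S Ψ Ψ∈U (cong proj₁) (λ y → y)
          (λ y → trans (act-identity _) (cong (y ,_) (trans (cong (λ s → T y + s * Tr y) e≡0) (trans (cong (T y +_) (zeroˡ _)) (+-identityʳ _)))))
        cases (inj₂ (inj₂ (δ , δ-fixed , Nδ≢1 , δ²+1≡δ , e₂))) =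
          _ , LP₂ δ δ≢0 Nδ≢1 , graphOf M S Ψ Ψ∈U (cong proj₁) P (λ y → cong₂ _,_ (first y) (second y))
          where
            δ≢0 : δ ≢ 0#
            δ≢0 refl = 1≢0 (trans (sym (trans (cong (_+ 1#) (zeroˡ 0#)) (+-identityˡ 1#))) δ²+1≡δ)
            M = matrix δ 1# (- δ) (- δ) λ d → 1≢0 (linear₂ d 1# δ²+1≡δ 1#
              (solve 1 (λ d → :1 :- :0 := :1 :* ((d :* (:- d) :- :1 :* (:- d)) :- :0) :+ :1 :* ((d :* d :+ :1) :- d)) refl δ))
            P : Carrier → Carrier
            P y = δ * y + (T y + e * Tr y)
            first : ∀ y → δ * y + 1# * (T y + e * Tr y) ≡ P y
            first y = cong (δ * y +_) (*-identityˡ _)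
            1+2δ≢0 : 1# + (δ + δ) ≢ 0#
            1+2δ≢0 null = δ≢0 (trans (sym (trans (cong (λ s → e * s + δ) null) (trans (cong (_+ δ) (zeroʳ e)) (+-identityˡ δ)))) e₂)
            -- e = -δ / (1 + 2δ) is a quotient of elements of Fq; therefore T passes through e Tr y
            -- in the computation of T²P and T³P.
            e-fixed : Fixed e
            e-fixed = cancelˡ 1+2δ≢0 (linear₂ Te₂ 1# e₂ (- 1#)
              (solve 3 (λ e t d → (:1 :+ (d :+ d)) :* t :- (:1 :+ (d :+ d)) :* e
                := :1 :* ((t :* (:1 :+ (d :+ d)) :+ d) :- :0) :+ (:- :1) :* ((e :* (:1 :+ (d :+ d)) :+ d) :- :0)) refl e (T e) δ))
              where
                Te₂ : T e * (1# + (δ + δ)) + δ ≡ 0#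
                Te₂ = begin
                  T e * (1# + (δ + δ)) + δ ≡⟨ sym (cong₂ (λ s d → T e * s + d) (Fixed-+ T-1 (Fixed-+ δ-fixed δ-fixed)) δ-fixed) ⟩
                  T e * T (1# + (δ + δ)) + T δ ≡⟨ sym (trans (T-+ _ _) (cong (_+ T δ) (T-* _ _))) ⟩
                  T (e * (1# + (δ + δ)) + δ) ≡⟨ trans (cong T e₂) T-0 ⟩
                  0# ∎
            TP : ∀ y z w → Fixed w → T (δ * y + (z + e * w)) ≡ δ * T y + (T z + e * w)
            TP y z w w-fixed = trans (T-+ _ _) (cong₂ _+_ (trans (T-* δ y) (cong (_* T y) δ-fixed))
              (trans (T-+ z _) (cong (T z +_) (Fixed-* e-fixed w-fixed))))
            T²P : ∀ y → T² (P y) ≡ δ * T² y + (T³ y + e * Tr y)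
            T²P y = trans (cong T (TP y (T y) (Tr y) (Tr-fixed y))) (TP (T y) (T² y) (Tr y) (Tr-fixed y))
            T³P : ∀ y → T³ (P y) ≡ δ * T³ y + (T⁴ y + e * Tr y)
            T³P y = trans (cong T (T²P y)) (TP (T² y) (T³ y) (Tr y) (Tr-fixed y))
            second : ∀ y → - δ * y + - δ * (T y + e * Tr y) ≡ T² (P y) + δ * T³ (P y)
            second y = trans (identity₅ y (T y) (T² y) (T³ y) (T⁴ y) (Tr y) refl) (sym (cong₂ (λ s t → s + δ * t) (T²P y) (T³P y)))
              where
                identity₅ : ∀ y y₁ y₂ y₃ y₄ t → t ≡ y + (y₁ + (y₂ + (y₃ + y₄))) →
                  - δ * y + - δ * (y₁ + e * t) ≡ (δ * y₂ + (y₃ + e * t)) + δ * (δ * y₃ + (y₄ + e * t))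
                identity₅ y y₁ y₂ y₃ y₄ t t≡ = trans
                  (linear₂ e₂ (- t) t≡ δ (solve 8 (λ d e y y₁ y₂ y₃ y₄ t →
                    ((:- d) :* y :+ (:- d) :* (y₁ :+ e :* t)) :- (d :* y₂ :+ d :* y₃ :+ d :* y₄ :+ (e :* t :+ d :* (e :* t)))
                    := (:- t) :* ((e :* (:1 :+ (d :+ d)) :+ d) :- :0) :+ d :* (t :- (y :+ (y₁ :+ (y₂ :+ (y₃ :+ y₄))))))
                    refl δ e y y₁ y₂ y₃ y₄ t))
                  (linear₁ δ²+1≡δ (- y₃) (solve 5 (λ d y₂ y₃ y₄ s →
                    (d :* y₂ :+ d :* y₃ :+ d :* y₄ :+ (s :+ d :* s)) :- ((d :* y₂ :+ (y₃ :+ s)) :+ d :* (d :* y₃ :+ (y₄ :+ s)))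
                    := (:- y₃) :* ((d :* d :+ :1) :- d)) refl δ y₂ y₃ y₄ (e * t)))

    trace-zero⇒on-graph : ∀ {β γ} → U (β , γ) → Tr β ≡ 0# → γ ≡ T β
    trace-zero⇒on-graph {β} {γ} βγ∈U Trβ≡0 = linear₁ (e≡0 (trace-zero-collision (γ - T β))) 1#
      (solve 2 (λ g b → g :- b := :1 :* ((g :- b) :- :0)) refl γ (T β))
      where
        e≡0 : γ - T β ≡ 0# ⊎ TraceCollision 0# (γ - T β) → γ - T β ≡ 0#
        e≡0 (inj₁ null) = null
        e≡0 (inj₂ collides) = proj₂ (trace-collision βγ∈U (solve 2 (λ g b → g := b :+ (g :- b)) refl γ (T β))
          (subst (λ t → TraceCollision t (γ - T β)) (sym Trβ≡0) collides))

    -- The map x ↦ x - T⁴x kills 1 and has the trace-zero elements as its image, so some (β, γ) in U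
    -- is not a value of `Ψ`. If Tr β = 0, it would lie on the graph of T and be such a value. So Tr
    -- β ≠ 0, and scaling by an element of Fq makes it 1.
    hyperplane-classified : Classified U
    hyperplane-classified = extend (not-parametrised Ψ (λ x → hyperplane (Tr-difference-T⁴ x)) 1≢0 Ψ1≡Ψ0)
      where
        Ψ : Carrier → Vec²
        Ψ x = (x - T⁴ x , T (x - T⁴ x))
        vanish : ∀ {x} → T⁴ x ≡ x → x - T⁴ x ≡ 0#
        vanish e = difference-zero (sym e)
        Ψ1≡Ψ0 : Ψ 1# ≡ Ψ 0#
        Ψ1≡Ψ0 = cong (λ z → (z , T z)) (trans (vanish (Fixed-T⁴ T-1)) (sym (vanish (Fixed-T⁴ T-0))))
        extend : ∃[ v ] (U v × (∀ x → Ψ x ≢ v)) → Classified U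
        extend ((β , γ) , βγ∈U , unhit) with Tr β ≟ 0#
        ... | yes Trβ≡0 = ⊥-elim (let (y , e) = trace-zero⇒difference trace-one β Trβ≡0 in
                unhit y (cong₂ _,_ e (trans (cong T e) (sym (trace-zero⇒on-graph βγ∈U Trβ≡0)))))
        ... | no Trβ≢0 with inverse (Tr β) Trβ≢0
        ...   | i , Trβi≡1 = trace-one-classified {i * β} {i * γ} {i * γ - T (i * β)}
                  (·-closed i-fixed βγ∈U) (trans (Tr-scale i-fixed β) (trans (*-comm i _) Trβi≡1))
                  (solve 2 (λ g b → g := b :+ (g :- b)) refl (i * γ) (T (i * β)))
          where
            i-fixed : Fixed i
            i-fixed = Fixed-inverse Trβ≢0 (Tr-fixed β) Trβi≡1

  -- The binomials vanish at 1 together with `Ψ`, which forces c = a = 1. For z = y - T⁴y one has Tz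
  -- = Ty - y, so a change of sign yields the vectors (z, Tz), and by Hilbert 90 all those with Tr z
  -- = 0.
  kernel-trinomials-classified : ∀ {U} → Scattered U → ∀ g₀ g₁ g₄ h₀ h₁ h₄ →
    (∀ x → U (Trinomials g₀ g₁ g₄ h₀ h₁ h₄ x)) → Trinomials g₀ g₁ g₄ h₀ h₁ h₄ 1# ≡ (0# , 0#) →
    g₁ * h₄ - g₄ * h₁ ≢ 0# → Classified U
  kernel-trinomials-classified {U} S g₀ g₁ g₄ h₀ h₁ h₄ Ψ∈U Ψ1≡0 Δ≢0 =
    Classified-image M (Classified-image M′ (hyperplane-classified (image-scattered M′ (image-scattered M S)) hyperplane))
    where
      open Binomials (binomials g₀ g₁ g₄ h₀ h₁ h₄ Δ≢0)
      M′ = diagonal (negation-nonzero 1≢0) 1≢0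
      at-1 : (T⁴ 1# - c * 1# , T 1# - a * 1#) ≡ (0# , 0#)
      at-1 = trans (sym (reduced 1#)) (trans (cong (act M) Ψ1≡0) (act-0 M))
      unit : ∀ {k t} → t ≡ 1# → t - k * 1# ≡ 0# → k ≡ 1#
      unit {k} {t} t≡1 e = linear₂ t≡1 1# e (- 1#)
        (solve 2 (λ k t → k :- :1 := :1 :* (t :- :1) :+ (:- :1) :* ((t :- k :* :1) :- :0)) refl k t)
      c≡1 : c ≡ 1#
      c≡1 = unit (Fixed-T⁴ T-1) (cong proj₁ at-1)
      a≡1 : a ≡ 1#
      a≡1 = unit T-1 (cong proj₂ at-1)
      difference : ∀ y → image M′ (image M U) (y - T⁴ y , T (y - T⁴ y))
      difference y = _ , (_ , Ψ∈U y , reduced y) , trans (act-diagonal (negation-nonzero 1≢0) 1≢0 _ _) (cong₂ _,_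
        (trans (cong (λ k → - 1# * (T⁴ y - k * y)) c≡1) (solve 2 (λ y z → (:- :1) :* (z :- :1 :* y) := y :- z) refl y (T⁴ y)))
        (begin
          1# * (T y - a * y) ≡⟨ cong (λ k → 1# * (T y - k * y)) a≡1 ⟩
          1# * (T y - 1# * y) ≡⟨ solve 2 (λ y z → :1 :* (z :- :1 :* y) := z :- y) refl y (T y) ⟩
          T y - y ≡⟨ cong (λ s → T y - s) (sym (T⁵-identity y)) ⟩
          T y - T (T⁴ y) ≡⟨ sym (trans (T-+ y _) (cong (T y +_) (T-neg _))) ⟩
          T (y - T⁴ y) ∎))
      hyperplane : ∀ {z} → Tr z ≡ 0# → image M′ (image M U) (z , T z)
      hyperplane {z} Trz≡0 = let (y , e) = trace-zero⇒difference trace-one z Trz≡0 in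
        subst (λ z → image M′ (image M U) (z , T z)) e (difference y)

  -- In the degenerate case all the values of Ψ lie on one line through the origin.
  kernel-trinomials-degenerate : ∀ {U} → Scattered U → ∀ g₀ g₁ g₄ h₀ h₁ h₄ →
    let Ψ = Trinomials g₀ g₁ g₄ h₀ h₁ h₄ in
    (∀ x → U (Ψ x)) → Ψ 1# ≡ (0# , 0#) → g₁ * h₄ - g₄ * h₁ ≡ 0# →
    ∀ {x} → Ψ x ≢ (0# , 0#) → ∀ y → ∃[ l ] (Fixed l × Ψ y ≡ l ·ᵛ Ψ x)
  kernel-trinomials-degenerate {U} S g₀ g₁ g₄ h₀ h₁ h₄ Ψ∈U Ψ1≡0 Δ≡0 {x} Ψx≢0 y =
    let (l , l-fixed , e) = dependent (_ , Ψ∈U x , refl) (λ null → Ψx≢0 (act-injective M (trans null (sym (act-0 M))))) (_ , Ψ∈U y , refl) collinear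
    in l , l-fixed , act-injective M (trans e (sym (act-· M l _)))
    where
      open Dependence (dependence g₀ g₁ g₄ h₀ h₁ h₄ Δ≡0)
      open Matrix M
      open Scattered (image-scattered M S)
      Ψ : Carrier → Vec²
      Ψ = Trinomials g₀ g₁ g₄ h₀ h₁ h₄
      first : ∀ x → proj₁ (act M (Ψ x)) ≡ (a * g₀ + b * h₀) * x
      first x = trans (L-combination a b g₀ g₁ g₄ h₀ h₁ h₄ x) (trans (L-cong refl relation₁ relation₄ x)
        (solve 4 (λ e x y z → e :* x :+ (:0 :* y :+ :0 :* z) := e :* x) refl (a * g₀ + b * h₀) x (T x) (T⁴ x)))
      leading : a * g₀ + b * h₀ ≡ 0#
      leading = trans (sym (*-identityʳ _)) (trans (sym (first 1#)) (cong proj₁ (trans (cong (act M) Ψ1≡0) (act-0 M))))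
      first≡0 : ∀ x → proj₁ (act M (Ψ x)) ≡ 0#
      first≡0 x = trans (first x) (trans (cong (_* x) leading) (zeroˡ x))
      collinear : proj₁ (act M (Ψ x)) * proj₂ (act M (Ψ y)) ≡ proj₂ (act M (Ψ x)) * proj₁ (act M (Ψ y))
      collinear = trans (trans (cong (_* proj₂ (act M (Ψ y))) (first≡0 x)) (zeroˡ _))
        (sym (trans (cong (proj₂ (act M (Ψ x)) *_) (first≡0 y)) (zeroʳ _)))

-- Spans and linear sets

finToFun-injective : ∀ {k l} {i j : Fin (k ℕ.^ l)} → (∀ x → finToFun {k} {l} i x ≡ finToFun j x) → i ≡ j
finToFun-injective {k} {l} {i} {j} e = trans (sym (Finₚ.funToFin-finToFin {l} {k} i)) (trans (funToFin-cong l e) (Finₚ.funToFin-finToFin {l} {k} j))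
  where
    funToFin-cong : ∀ l {f g : Fin l → Fin k} → (∀ x → f x ≡ g x) → funToFin f ≡ funToFin g
    funToFin-cong zero e = refl
    funToFin-cong (suc l) e = cong₂ combine (e zero) (funToFin-cong l (λ x → e (suc x)))

remQuot-injective : ∀ {k l} (i j : Fin (k ℕ.* l)) → remQuot {k} l i ≡ remQuot l j → i ≡ j
remQuot-injective {k} {l} i j e = trans (sym (Finₚ.combine-remQuot {k} l i)) (trans (cong (λ (x , y) → combine x y) e) (Finₚ.combine-remQuot {k} l j))

All-lookup : ∀ {A : Set} {P : A → Set} {xs : List A} → All P xs → ∀ i → P (List.lookup xs i)
All-lookup (p ∷ _) zero = p
All-lookup (_ ∷ ps) (suc i) = All-lookup ps i

AllPairs-lookup : ∀ {A : Set} {R : A → A → Set} {xs : List A} → AllPairs R xs → ∀ i j → i ≢ j →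
  R (List.lookup xs i) (List.lookup xs j) ⊎ R (List.lookup xs j) (List.lookup xs i)
AllPairs-lookup (_ ∷ _) zero zero i≢j = ⊥-elim (i≢j refl)
AllPairs-lookup (rs ∷ _) zero (suc j) i≢j = inj₁ (All-lookup rs j)
AllPairs-lookup (rs ∷ _) (suc i) zero i≢j = inj₂ (All-lookup rs i)
AllPairs-lookup (_ ∷ rss) (suc i) (suc j) i≢j = AllPairs-lookup rss i j (λ e → i≢j (cong suc e))

module LinearCombinations (F : Field) where
  open FieldKit F
  open SemiringSum semiring public using (sum; *-distribˡ-sum; *-distribʳ-sum)
  open MonoidSum +-commutativeMonoid public using (∑-distrib-+; sum-cong-≗)
  open ≡-Reasoning

  combination : ∀ {k} → (Fin k → Carrier) → (Fin k → V F) → V F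
  combination {k} c u = sumV F k (λ i → _·_ F (c i) (u i))

  combination-coordinates : ∀ {k} (c : Fin k → Carrier) u →
    combination c u ≡ (sum (λ i → c i * proj₁ (u i)) , sum (λ i → c i * proj₂ (u i)))
  combination-coordinates {zero} c u = refl
  combination-coordinates {suc k} c u = cong (_⊕_ F (_·_ F (c zero) (u zero))) (combination-coordinates (λ i → c (suc i)) (λ i → u (suc i)))

  combination-cong : ∀ {k} {c d : Fin k → Carrier} u → (∀ i → c i ≡ d i) → combination c u ≡ combination d u
  combination-cong {zero} u e = refl
  combination-cong {suc k} u e = cong₂ (_⊕_ F) (cong (λ s → _·_ F s (u zero)) (e zero)) (combination-cong (λ i → u (suc i)) (λ i → e (suc i)))

  sum-combination : ∀ {k} (c d u : Fin k → Carrier) → sum (λ i → (c i + d i) * u i) ≡ sum (λ i → c i * u i) + sum (λ i → d i * u i)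
  sum-combination c d u = trans (sum-cong-≗ (λ i → distribʳ (u i) (c i) (d i))) (∑-distrib-+ (λ i → c i * u i) (λ i → d i * u i))

  sum-scale : ∀ {k} l (c u : Fin k → Carrier) → sum (λ i → (l * c i) * u i) ≡ l * sum (λ i → c i * u i)
  sum-scale l c u = trans (sum-cong-≗ (λ i → *-assoc l (c i) (u i))) (sym (*-distribˡ-sum l (λ i → c i * u i)))

  combination-+ : ∀ {k} (c d : Fin k → Carrier) u → combination (λ i → c i + d i) u ≡ _⊕_ F (combination c u) (combination d u)
  combination-+ c d u = begin
    combination (λ i → c i + d i) u ≡⟨ combination-coordinates _ u ⟩
    _ ≡⟨ cong₂ _,_ (sum-combination c d (λ i → proj₁ (u i))) (sum-combination c d (λ i → proj₂ (u i))) ⟩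
    _ ≡⟨ sym (cong₂ (_⊕_ F) (combination-coordinates c u) (combination-coordinates d u)) ⟩
    _⊕_ F (combination c u) (combination d u) ∎

  combination-· : ∀ {k} l (c : Fin k → Carrier) u → combination (λ i → l * c i) u ≡ _·_ F l (combination c u)
  combination-· l c u = begin
    combination (λ i → l * c i) u ≡⟨ combination-coordinates _ u ⟩
    _ ≡⟨ cong₂ _,_ (sum-scale l c (λ i → proj₁ (u i))) (sum-scale l c (λ i → proj₂ (u i))) ⟩
    _ ≡⟨ sym (cong (_·_ F l) (combination-coordinates c u)) ⟩
    _·_ F l (combination c u) ∎

  sum-difference : ∀ {k} (c d u : Fin k → Carrier) → sum (λ i → (c i - d i) * u i) ≡ sum (λ i → c i * u i) - sum (λ i → d i * u i)
  sum-difference c d u = begin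
    sum (λ i → (c i - d i) * u i) ≡⟨ sum-combination c (λ i → - d i) u ⟩
    sum (λ i → c i * u i) + sum (λ i → - d i * u i)
      ≡⟨ cong (sum (λ i → c i * u i) +_) (trans (sum-cong-≗ (λ i → solve 2 (λ d u → (:- d) :* u := ((:- :1) :* d) :* u) refl (d i) (u i))) (sum-scale (- 1#) d u)) ⟩
    sum (λ i → c i * u i) + - 1# * sum (λ i → d i * u i)
      ≡⟨ solve 2 (λ s t → s :+ (:- :1) :* t := s :- t) refl (sum (λ i → c i * u i)) (sum (λ i → d i * u i)) ⟩
    sum (λ i → c i * u i) - sum (λ i → d i * u i) ∎

  module _ {n : ℕ} (finite : Fin n ↔ Carrier) where
    open FiniteKit F n finite

    1<n : 1 ℕ.< n
    1<n = Finₚ.injective⇒≤ {f = f} f-injective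
      where
        f : Fin 2 → Fin n
        f zero = index 0#
        f (suc zero) = index 1#
        f-injective : ∀ {i j} → f i ≡ f j → i ≡ j
        f-injective {zero} {zero} e = refl
        f-injective {zero} {suc zero} e = ⊥-elim (0≢1 (index-injective e))
        f-injective {suc zero} {zero} e = ⊥-elim (0≢1 (sym (index-injective e)))
        f-injective {suc zero} {suc zero} e = refl

    -- There are more vectors of unknowns than vectors of values.
    nontrivial-solution : ∀ {k l} → k ℕ.< l → (w : Fin k → Fin l → Carrier) →
      ∃[ A ] (∃[ j ] A j ≢ 0#) × (∀ r → sum (λ i → A i * w r i) ≡ 0#)
    nontrivial-solution {k} {l} k<l w =
      let (x , y , x<y , e) = Finₚ.pigeonhole (ℕₚ.^-monoʳ-< n 1<n k<l) values in
      A x y , nonzero x y x<y , λ r → trans (sum-difference (vector x) (vector y) (w r)) (difference-zero (index-injective (begin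
        index (sum (λ i → vector x i * w r i)) ≡⟨ sym (Finₚ.finToFun-funToFin (value x) r) ⟩
        finToFun (values x) r ≡⟨ cong (λ v → finToFun v r) e ⟩
        finToFun (values y) r ≡⟨ Finₚ.finToFun-funToFin (value y) r ⟩
        index (sum (λ i → vector y i * w r i)) ∎)))
      where
        vector : Fin (n ℕ.^ l) → Fin l → Carrier
        vector x i = element (finToFun {n} {l} x i)
        value : Fin (n ℕ.^ l) → Fin k → Fin n
        value x r = index (sum (λ i → vector x i * w r i))
        values : Fin (n ℕ.^ l) → Fin (n ℕ.^ k)
        values x = funToFin (value x)
        A : Fin (n ℕ.^ l) → Fin (n ℕ.^ l) → Fin l → Carrier
        A x y i = vector x i - vector y i
        nonzero : ∀ x y → x Fin.< y → ∃[ j ] A x y j ≢ 0#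
        nonzero x y x<y = Finₚ.¬∀⟶∃¬ l (λ i → A x y i ≡ 0#) (λ i → A x y i ≟ 0#)
          (λ all-zero → Finₚ.<⇒≢ x<y (finToFun-injective {n} {l} (λ i →
            trans (sym (index-element _)) (trans (cong index (zero-difference (all-zero i))) (index-element _)))))

cast-injective : ∀ {k l} (e : k ≡ l) {i j : Fin k} → Fin.cast e i ≡ Fin.cast e j → i ≡ j
cast-injective e {i} {j} p = Finₚ.toℕ-injective (trans (sym (Finₚ.toℕ-cast e i)) (trans (cong Fin.toℕ p) (Finₚ.toℕ-cast e j)))

record Digits {F : Field} {n : ℕ} (frobenius : Frobenius F n) (q m : ℕ) : Set where
  open FieldKit F
  open Frobenius frobenius
  field
    T-power : ∀ x → T x ≡ _^ᶠ_ F x q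
    digit : Fin q → Carrier
    digit-fixed : ∀ i → Fixed (digit i)
    digit-injective : ∀ {i j} → digit i ≡ digit j → i ≡ j
    digit-surjective : ∀ {c} → Fixed c → ∃[ i ] digit i ≡ c
    unit : Fin m → Carrier
    unit-fixed : ∀ i → Fixed (unit i)
    unit-injective : ∀ {i j} → unit i ≡ unit j → i ≡ j
    unit≢0 : ∀ i → unit i ≢ 0#

module LinearSet {F : Field} (q m : ℕ) (frobenius : Frobenius F (q ℕ.^ 5)) (digits : Digits frobenius q m)
  (u : Fin 5 → V F) (independent : LinIndep F q u) where
  open FieldKit F
  open Frobenius frobenius
  open Digits digits
  open LinearCombinations F
  open ≡-Reasoning

  U : V F → Set
  U = InSpan F q u

  to-fixed : ∀ {c} → InFq F q c → Fixed c
  to-fixed {c} e = trans (T-power c) e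

  from-fixed : ∀ {c} → Fixed c → InFq F q c
  from-fixed {c} e = trans (sym (T-power c)) e

  combination-injective : ∀ {c d : Fin 5 → Carrier} → (∀ i → Fixed (c i)) → (∀ i → Fixed (d i)) →
    combination c u ≡ combination d u → ∀ i → c i ≡ d i
  combination-injective {c} {d} c-fixed d-fixed e i = zero-difference (independent (λ i → c i - d i)
    (λ i → from-fixed (Fixed-+ (c-fixed i) (Fixed-neg (d-fixed i))))
    (trans (combination-coordinates (λ i → c i - d i) u) (cong₂ _,_
      (trans (sum-difference c d (λ i → proj₁ (u i))) (difference-zero (cong proj₁ coordinates)))
      (trans (sum-difference c d (λ i → proj₂ (u i))) (difference-zero (cong proj₂ coordinates))))) i)
    where
      coordinates = trans (sym (combination-coordinates c u)) (trans e (combination-coordinates d u))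

  enum : Fin (q ℕ.^ 5) → V F
  enum k = combination (λ i → digit (finToFun {q} {5} k i)) u

  enum∈ : ∀ k → U (enum k)
  enum∈ k = (λ i → digit (finToFun {q} {5} k i)) , (λ i → from-fixed (digit-fixed (finToFun {q} {5} k i))) , refl

  enum-injective : ∀ {k l} → enum k ≡ enum l → k ≡ l
  enum-injective {k} {l} e = finToFun-injective {q} {5} (λ i → digit-injective (combination-injective
    (λ i → digit-fixed (finToFun {q} {5} k i)) (λ i → digit-fixed (finToFun {q} {5} l i)) e i))

  enum-surjective : ∀ {v} → U v → ∃[ k ] enum k ≡ v
  enum-surjective (c , c∈Fq , refl) = funToFin d , combination-cong u (λ i →
      trans (cong digit (Finₚ.finToFun-funToFin d i)) (proj₂ (digit-surjective (to-fixed (c∈Fq i)))))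
    where
      d : Fin 5 → Fin q
      d i = proj₁ (digit-surjective (to-fixed (c∈Fq i)))

  +-closed : ∀ {v w} → U v → U w → U (_⊕_ F v w)
  +-closed (c , c∈Fq , refl) (d , d∈Fq , refl) =
    (λ i → c i + d i) , (λ i → from-fixed (Fixed-+ (to-fixed (c∈Fq i)) (to-fixed (d∈Fq i)))) , sym (combination-+ c d u)

  ·-closed : ∀ {l v} → Fixed l → U v → U (_·_ F l v)
  ·-closed {l} l-fixed (c , c∈Fq , refl) =
    (λ i → l * c i) , (λ i → from-fixed (Fixed-* l-fixed (to-fixed (c∈Fq i)))) , sym (combination-· l c u)

  0∈U : U (0# , 0#)
  0∈U = subst U (cong₂ _,_ (zeroˡ _) (zeroˡ _)) (·-closed T-0 (enum∈ (funToFin {5} {q} (λ _ → proj₁ (digit-surjective T-0)))))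

  ·-assoc : ∀ k l v → _·_ F k (_·_ F l v) ≡ _·_ F (k * l) v
  ·-assoc k l (x , y) = cong₂ _,_ (sym (*-assoc k l x)) (sym (*-assoc k l y))

  ·-cancel : ∀ {k l v} → v ≢ (0# , 0#) → _·_ F k v ≡ _·_ F l v → k ≡ l
  ·-cancel {k} {l} {x , y} v≢0 e with x ≟ 0#
  ... | no x≢0 = cancelˡ x≢0 (trans (*-comm x k) (trans (cong proj₁ e) (*-comm l x)))
  ... | yes refl with y ≟ 0#
  ...   | no y≢0 = cancelˡ y≢0 (trans (*-comm y k) (trans (cong proj₂ e) (*-comm l y)))
  ...   | yes refl = ⊥-elim (v≢0 refl)

  ·-nonzero : ∀ {l v} → l ≢ 0# → v ≢ (0# , 0#) → _·_ F l v ≢ (0# , 0#)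
  ·-nonzero {l} {x , y} l≢0 v≢0 e = v≢0 (cong₂ _,_ (no-zero-divisors l≢0 (cong proj₁ e)) (no-zero-divisors l≢0 (cong proj₂ e)))

  Proportional-sym : ∀ {v w} → Proportional F v w → Proportional F w v
  Proportional-sym {_} {w} (l , l≢0 , refl) with inverse l l≢0
  ... | i , li≡1 = i , factor-nonzeroʳ li≡1 1≢0 , sym (trans (·-assoc i l w)
        (trans (cong (λ s → _·_ F s w) (trans (*-comm i l) li≡1)) (cong₂ _,_ (*-identityˡ _) (*-identityˡ _))))

  Proportional-trans : ∀ {v w x} → Proportional F v w → Proportional F w x → Proportional F v x
  Proportional-trans {x = x} (k , k≢0 , refl) (l , l≢0 , refl) = k * l , product-nonzero k≢0 l≢0 , ·-assoc k l x

  Proportional-·ˡ : ∀ {k l v w} → k ≢ 0# → l ≢ 0# → _·_ F k v ≡ _·_ F l w → Proportional F v w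
  Proportional-·ˡ {k} {l} {v} {w} k≢0 l≢0 e = Proportional-trans (Proportional-sym (k , k≢0 , refl)) (l , l≢0 , e)

  pointCount : ℕ
  pointCount = 1 ℕ.+ q ℕ.+ q ℕ.^ 2 ℕ.+ q ℕ.^ 3 ℕ.+ q ℕ.^ 4

  -- The multiples of representatives of the points by nonzero scalars of Fq, together with 0,
  -- are q⁵ distinct vectors of U, hence all of U.
  module Counting (count : suc (pointCount ℕ.* m) ≡ q ℕ.^ 5) (maximum : MaxScattered F q u) where

    points : List (V F)
    points = proj₁ maximum

    point : Fin pointCount → V F
    point i = List.lookup points (Fin.cast (sym (proj₂ (proj₂ (proj₂ (proj₂ maximum))))) i)

    point∈ : ∀ i → LinSet F q u (point i)
    point∈ i = All-lookup (proj₁ (proj₂ maximum)) _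

    points-apart : ∀ {i j} → Proportional F (point i) (point j) → i ≡ j
    points-apart {i} {j} p with i Finₚ.≟ j
    ... | yes e = e
    ... | no i≢j with AllPairs-lookup (proj₁ (proj₂ (proj₂ maximum))) (Fin.cast _ i) (Fin.cast _ j)
                        (λ e → i≢j (cast-injective (sym (proj₂ (proj₂ (proj₂ (proj₂ maximum))))) e))
    ...   | inj₁ apart = ⊥-elim (apart p)
    ...   | inj₂ apart = ⊥-elim (apart (Proportional-sym p))

    representative : Fin pointCount → V F
    representative i = proj₁ (proj₂ (point∈ i))

    representative∈ : ∀ i → U (representative i)
    representative∈ i = proj₁ (proj₂ (proj₂ (point∈ i)))

    representative≢0 : ∀ i → representative i ≢ (0# , 0#)
    representative≢0 i = proj₁ (proj₂ (proj₂ (proj₂ (point∈ i))))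

    representatives-apart : ∀ {i j} → Proportional F (representative i) (representative j) → i ≡ j
    representatives-apart {i} {j} p = points-apart (Proportional-trans (proj₂ (proj₂ (proj₂ (proj₂ (point∈ i)))))
      (Proportional-trans p (Proportional-sym (proj₂ (proj₂ (proj₂ (proj₂ (point∈ j))))))))

    multiple : Fin pointCount × Fin m → V F
    multiple (i , c) = _·_ F (unit c) (representative i)

    multiple-injective : ∀ {x y} → multiple x ≡ multiple y → x ≡ y
    multiple-injective {i , c} {j , d} e with representatives-apart {i} {j} (Proportional-·ˡ (unit≢0 c) (unit≢0 d) e)
    ... | refl with unit-injective (·-cancel {unit c} {unit d} (representative≢0 i) e)
    ...   | refl = refl

    vector : Fin (suc (pointCount ℕ.* m)) → V F
    vector zero = (0# , 0#)
    vector (suc k) = multiple (remQuot m k)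

    vector∈ : ∀ k → U (vector k)
    vector∈ zero = 0∈U
    vector∈ (suc k) = ·-closed (unit-fixed _) (representative∈ _)

    vector-injective : ∀ {k l} → vector k ≡ vector l → k ≡ l
    vector-injective {zero} {zero} e = refl
    vector-injective {zero} {suc l} e = ⊥-elim (·-nonzero (unit≢0 _) (representative≢0 _) (sym e))
    vector-injective {suc k} {zero} e = ⊥-elim (·-nonzero (unit≢0 _) (representative≢0 _) e)
    vector-injective {suc k} {suc l} e = cong suc (remQuot-injective {pointCount} {m} k l (multiple-injective e))

    vector-surjective : ∀ {v} → U v → ∃[ k ] vector k ≡ v
    vector-surjective {v} v∈U =
      let (j , e) = enum-surjective v∈U
          (k , e′) = injective⇒surjective position position-injective j
      in Fin.cast (sym count) k , trans (sym (position-enum k)) (trans (cong enum e′) e)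
      where
        position : Fin (q ℕ.^ 5) → Fin (q ℕ.^ 5)
        position k = proj₁ (enum-surjective (vector∈ (Fin.cast (sym count) k)))
        position-enum : ∀ k → enum (position k) ≡ vector (Fin.cast (sym count) k)
        position-enum k = proj₂ (enum-surjective (vector∈ (Fin.cast (sym count) k)))
        position-injective : ∀ {k l} → position k ≡ position l → k ≡ l
        position-injective {k} {l} e = cast-injective (sym count) (vector-injective
          (trans (sym (position-enum k)) (trans (cong enum e) (position-enum l))))

    scattered : ∀ {l v} → U v → v ≢ (0# , 0#) → U (_·_ F l v) → Fixed l
    scattered {l} {v} v∈U v≢0 lv∈U with l ≟ 0#
    ... | yes refl = T-0
    ... | no l≢0 = compare (vector-surjective v∈U) (vector-surjective lv∈U)
      where
        compare : ∃[ j ] vector j ≡ v → ∃[ k ] vector k ≡ _·_ F l v → Fixed l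
        compare (zero , e) _ = ⊥-elim (v≢0 (sym e))
        compare (suc _ , _) (zero , e) = ⊥-elim (·-nonzero l≢0 v≢0 (sym e))
        compare (suc j , refl) (suc k , e) = same (remQuot {pointCount} m j) (remQuot {pointCount} m k) e
          where
            -- Both vectors are multiples by units of Fq of representatives of the same point, hence
            -- of the same representative, and l is a quotient of two units.
            same : ∀ x y → multiple y ≡ _·_ F l (multiple x) → Fixed l
            same (i , c) (i′ , c′) e with representatives-apart {i′} {i} (Proportional-·ˡ (unit≢0 c′) (product-nonzero l≢0 (unit≢0 c)) (trans e (·-assoc l _ _)))
            ... | refl = cancelˡ (unit≢0 c) (begin
              unit c * T l ≡⟨ cong (_* T l) (sym (unit-fixed c)) ⟩
              T (unit c) * T l ≡⟨ sym (T-* _ _) ⟩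
              T (unit c * l) ≡⟨ cong T (trans (*-comm _ l) (sym quotient)) ⟩
              T (unit c′) ≡⟨ unit-fixed c′ ⟩
              unit c′ ≡⟨ trans quotient (*-comm l _) ⟩
              unit c * l ∎)
              where
                quotient : unit c′ ≡ l * unit c
                quotient = ·-cancel (representative≢0 i) (trans e (·-assoc l _ _))

-- Roots of polynomials in finite fields

module FiniteField (F : Field) where
  open FieldKit F
  open ≡-Reasoning

  infixr 8 _^_
  _^_ : Carrier → ℕ → Carrier
  _^_ = _^ᶠ_ F

  ^-+ : ∀ x k l → x ^ (k ℕ.+ l) ≡ x ^ k * x ^ l
  ^-+ x zero l = sym (*-identityˡ _)
  ^-+ x (suc k) l = trans (cong (x *_) (^-+ x k l)) (sym (*-assoc x _ _))

  ^-* : ∀ x k l → x ^ (k ℕ.* l) ≡ (x ^ l) ^ k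
  ^-* x zero l = refl
  ^-* x (suc k) l = trans (^-+ x l (k ℕ.* l)) (cong (x ^ l *_) (^-* x k l))

  module Sum = MonoidSum +-commutativeMonoid
  module Prod = MonoidSum *-commutativeMonoid

  ι : ℕ → Carrier
  ι k = k ×ᶠ 1#

  ι-suc : ∀ k → ι (suc k) ≡ 1# + ι k
  ι-suc k = ×-homo-+ 1# 1 k

  ι-+ : ∀ k l → ι (k ℕ.+ l) ≡ ι k + ι l
  ι-+ = ×-homo-+ 1#

  ι-* : ∀ k l → ι (k ℕ.* l) ≡ ι k * ι l
  ι-* = ×1-homo-*

  sum-ones : ∀ k → Sum.sum {k} (λ _ → 1#) ≡ ι k
  sum-ones zero = refl
  sum-ones (suc k) = trans (cong (1# +_) (sum-ones k)) (sym (ι-suc k))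

  product-constant : ∀ k x → Prod.sum {k} (λ _ → x) ≡ x ^ k
  product-constant zero x = refl
  product-constant (suc k) x = cong (x *_) (product-constant k x)

  product-of-nonzero : ∀ {k} (f : Fin k → Carrier) → (∀ i → f i ≢ 0#) → Prod.sum f ≢ 0#
  product-of-nonzero {zero} f f≢0 = 1≢0
  product-of-nonzero {suc k} f f≢0 = product-nonzero (f≢0 zero) (product-of-nonzero (λ i → f (suc i)) (λ i → f≢0 (suc i)))

  -- Translation by 1 permutes F, so the sum s of all elements satisfies s = s + n · 1.
  cardinality-zero : ∀ {n} → (Fin n ↔ Carrier) → ι n ≡ 0#
  cardinality-zero {n} finite = linear₁ shifted-sum (- 1#)
    (solve 2 (λ s k → k :- :0 := (:- :1) :* (s :- (s :+ k))) refl (Sum.sum element) (ι n))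
    where
      open FiniteKit F n finite
      shift : Permutation n n
      shift = permutation (λ i → index (element i + 1#)) (λ i → index (element i - 1#))
        ((λ i → trans (cong (λ x → index (x + 1#)) (element-index _)) (trans (cong index (solve 1 (λ x → (x :- :1) :+ :1 := x) refl (element i))) (index-element i))))
        (λ i → trans (cong (λ x → index (x - 1#)) (element-index _)) (trans (cong index (solve 1 (λ x → (x :+ :1) :- :1 := x) refl (element i))) (index-element i)))
      shifted-sum : Sum.sum element ≡ Sum.sum element + ι n
      shifted-sum = begin
        Sum.sum element ≡⟨ Sum.sum-permute element shift ⟩
        Sum.sum (λ i → element (shift ⟨$⟩ʳ i)) ≡⟨ Sum.sum-cong-≗ (λ i → element-index (element i + 1#)) ⟩
        Sum.sum (λ i → element i + 1#) ≡⟨ Sum.∑-distrib-+ element (λ _ → 1#) ⟩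
        Sum.sum element + Sum.sum {n} (λ _ → 1#) ≡⟨ cong (Sum.sum element +_) (sum-ones n) ⟩
        Sum.sum element + ι n ∎

  prime-power-zero : ∀ p k → ι (p ℕ.^ k) ≡ 0# → ∀ {n} → (Fin n ↔ Carrier) → ι p ≡ 0#
  prime-power-zero p zero e finite = ⊥-elim (1≢0 e)
  prime-power-zero p (suc k) e {n} finite with FiniteKit._≟_ F n finite (ι p) 0#
  ... | yes ιp≡0 = ιp≡0
  ... | no ιp≢0 = prime-power-zero p k (no-zero-divisors ιp≢0 (trans (sym (ι-* p (p ℕ.^ k))) e)) finite

  -- Multiplication by x permutes F. To compare products over all of F, `patched` replaces 0 by 1;
  -- the other k = n - 1 elements contribute one factor x each.
  fermat : ∀ n → (Fin n ↔ Carrier) → ∀ x → x ^ n ≡ x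
  fermat zero finite x with FiniteKit.index F 0 finite x
  ... | ()
  fermat (suc k) finite x with FiniteKit._≟_ F (suc k) finite x 0#
  ... | yes refl = zeroˡ _
  ... | no x≢0 = trans (cong (x *_) x^k≡1) (*-identityʳ x)
    where
      open FiniteKit F (suc k) finite
      x⁻¹ = proj₁ (inverse x x≢0)
      xx⁻¹≡1 = proj₂ (inverse x x≢0)
      scaling : Permutation (suc k) (suc k)
      scaling = permutation (λ i → index (x * element i)) (λ i → index (x⁻¹ * element i))
        ((λ i → trans (cong (λ y → index (x * y)) (element-index _)) (trans (cong index
           (linear₁ xx⁻¹≡1 (element i) (solve 3 (λ x i y → x :* (i :* y) :- y := y :* (x :* i :- :1)) refl x x⁻¹ (element i)))) (index-element i))))
        (λ i → trans (cong (λ y → index (x⁻¹ * y)) (element-index _)) (trans (cong index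
           (linear₁ xx⁻¹≡1 (element i) (solve 3 (λ x i y → i :* (x :* y) :- y := y :* (x :* i :- :1)) refl x x⁻¹ (element i)))) (index-element i)))
      patched : Carrier → Carrier
      patched y with y ≟ 0#
      ... | yes _ = 1#
      ... | no _ = y
      factor : Carrier → Carrier
      factor y with y ≟ 0#
      ... | yes _ = 1#
      ... | no _ = x
      patched≢0 : ∀ y → patched y ≢ 0#
      patched≢0 y with y ≟ 0#
      ... | yes _ = 1≢0
      ... | no y≢0 = y≢0
      patched-scaled : ∀ y → patched (x * y) ≡ factor y * patched y
      patched-scaled y with y ≟ 0# | x * y ≟ 0#
      ... | yes _ | yes _ = sym (*-identityˡ 1#)
      ... | yes refl | no xy≢0 = ⊥-elim (xy≢0 (zeroʳ x))
      ... | no y≢0 | yes xy≡0 = ⊥-elim (product-nonzero x≢0 y≢0 xy≡0)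
      ... | no _ | no _ = refl
      factor-0 : ∀ {y} → y ≡ 0# → factor y ≡ 1#
      factor-0 {y} y≡0 with y ≟ 0#
      ... | yes _ = refl
      ... | no y≢0 = ⊥-elim (y≢0 y≡0)
      factor-nonzero : ∀ {y} → y ≢ 0# → factor y ≡ x
      factor-nonzero {y} y≢0 with y ≟ 0#
      ... | yes y≡0 = ⊥-elim (y≢0 y≡0)
      ... | no _ = refl
      i₀ = index 0#
      p : Fin (suc k) → Carrier
      p i = patched (element i)
      f : Fin (suc k) → Carrier
      f i = factor (element i)
      others-nonzero : ∀ j → element (punchIn i₀ j) ≢ 0#
      others-nonzero j e = Finₚ.punchInᵢ≢i i₀ j (trans (sym (index-element _)) (cong index e))
      factors : Prod.sum f ≡ x ^ k
      factors = begin
        Prod.sum f ≡⟨ Prod.sum-remove {i = i₀} f ⟩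
        f i₀ * Prod.sum (λ j → f (punchIn i₀ j)) ≡⟨ cong₂ _*_ (factor-0 (element-index 0#)) (Prod.sum-cong-≗ (λ j → factor-nonzero (others-nonzero j))) ⟩
        1# * Prod.sum {k} (λ _ → x) ≡⟨ trans (*-identityˡ _) (product-constant k x) ⟩
        x ^ k ∎
      x^k≡1 : x ^ k ≡ 1#
      x^k≡1 = cancelˡ (product-of-nonzero p (λ i → patched≢0 (element i))) (begin
        Prod.sum p * x ^ k ≡⟨ trans (*-comm _ _) (cong (_* Prod.sum p) (sym factors)) ⟩
        Prod.sum f * Prod.sum p ≡⟨ sym (Prod.∑-distrib-+ f p) ⟩
        Prod.sum (λ i → f i * p i) ≡⟨ sym (Prod.sum-cong-≗ (λ i → trans (cong patched (element-index (x * element i))) (patched-scaled (element i)))) ⟩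
        Prod.sum (λ i → p (scaling ⟨$⟩ʳ i)) ≡⟨ sym (Prod.sum-permute p scaling) ⟩
        Prod.sum p ≡⟨ sym (*-identityʳ _) ⟩
        Prod.sum p * 1# ∎)

  -- The leading coefficient 1 is left out; the constant term comes first.
  monic : ∀ {k} → Vec Carrier k → Carrier → Carrier
  monic [] x = 1#
  monic (c ∷ cs) x = c + x * monic cs x

  divide : ∀ {k} (cs : Vec Carrier (suc k)) a → ∃[ ds ] (∀ x → monic cs x ≡ (x - a) * monic {k} ds x + monic cs a)
  divide (c ∷ []) a = [] , λ x → solve 3 (λ c x a → c :+ x :* :1 := (x :- a) :* :1 :+ (c :+ a :* :1)) refl c x a
  divide (c ∷ cs@(_ ∷ _)) a with divide cs a
  ... | ds , e = monic cs a ∷ ds , λ x → linear₁ (e x) x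
        (solve 6 (λ c x a d r s → (c :+ x :* s) :- ((x :- a) :* (r :+ x :* d) :+ (c :+ a :* r)) := x :* (s :- ((x :- a) :* d :+ r)))
          refl c x a (monic ds x) (monic cs a) (monic cs x))

  too-many-roots : ∀ {k} (cs : Vec Carrier k) (x : Fin (suc k) → Carrier) → (∀ {i j} → x i ≡ x j → i ≡ j) →
                   (∀ i → monic cs (x i) ≡ 0#) → ⊥
  too-many-roots [] x x-injective root = 1≢0 (root zero)
  too-many-roots {suc k} cs x x-injective root = too-many-roots (proj₁ (divide cs (x zero))) (λ i → x (suc i))
    (λ e → Finₚ.suc-injective (x-injective e))
    (λ i → no-zero-divisors (λ e → Finₚ.0≢1+n (sym (x-injective (zero-difference e))))
      (linear₂ (trans (sym (proj₂ (divide cs (x zero)) (x (suc i)))) (root (suc i))) 1# (root zero) (- 1#)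
        (solve 2 (λ s r → s :- :0 := :1 :* ((s :+ r) :- :0) :+ (:- :1) :* (r :- :0)) refl
          ((x (suc i) - x zero) * monic (proj₁ (divide cs (x zero))) (x (suc i))) (monic cs (x zero)))))

  -- Coefficient lists start with the leading coefficient.
  value : List ℕ → Carrier → Carrier
  value [] x = 0#
  value (s ∷ ss) x = ι s * x ^ length ss + value ss x

module _ (p : ℕ) .{{_ : ℕ.NonZero p}} where

  reduceBy : ℕ → List ℕ → List ℕ → List ℕ
  reduceBy t (s ∷ ss) (r ∷ rs) = ((s ℕ.+ t ℕ.* r) ℕ.% p) ∷ reduceBy t ss rs
  reduceBy t [] (r ∷ []) = ((t ℕ.* r) ℕ.% p) ∷ []
  reduceBy _ _ _ = []

  -- Multiplication by X modulo X^d - rs.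
  times-X : List ℕ → List ℕ → List ℕ
  times-X rs [] = []
  times-X rs (t ∷ ss) = reduceBy t ss rs

  -- Started at `rs`, which is X^d reduced for d = `length rs`, k steps give X^(k + d) reduced.
  X-power : List ℕ → ℕ → List ℕ → List ℕ
  X-power rs zero s = s
  X-power rs (suc k) s = X-power rs k (times-X rs s)

  module Characteristic (F : Field) (char : FiniteField.ι F p ≡ Field.0# F) where
    open FieldKit F
    open FiniteField F
    open ≡-Reasoning

    ι-% : ∀ k → ι (k ℕ.% p) ≡ ι k
    ι-% k = sym (begin
      ι k ≡⟨ cong ι (DivMod.m≡m%n+[m/n]*n k p) ⟩
      ι (k ℕ.% p ℕ.+ (k ℕ./ p) ℕ.* p) ≡⟨ trans (ι-+ (k ℕ.% p) _) (cong (ι (k ℕ.% p) +_) (ι-* (k ℕ./ p) p)) ⟩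
      ι (k ℕ.% p) + ι (k ℕ./ p) * ι p ≡⟨ cong (λ z → ι (k ℕ.% p) + ι (k ℕ./ p) * z) char ⟩
      ι (k ℕ.% p) + ι (k ℕ./ p) * 0# ≡⟨ trans (cong (ι (k ℕ.% p) +_) (zeroʳ _)) (+-identityʳ _) ⟩
      ι (k ℕ.% p) ∎)

  module RootExistence (F : Field) (char : FiniteField.ι F p ≡ Field.0# F) (rs : List ℕ) where
    open FieldKit F
    open FiniteField F
    open Characteristic F char
    open ≡-Reasoning

    reduceBy-length : ∀ t ss rs → length rs ≡ suc (length ss) → length (reduceBy t ss rs) ≡ length rs
    reduceBy-length t [] (r ∷ []) e = refl
    reduceBy-length t (s ∷ ss) (r ∷ rs) e = cong suc (reduceBy-length t ss rs (ℕₚ.suc-injective e))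

    reduceBy-value : ∀ t ss rs → length rs ≡ suc (length ss) → ∀ x → value (reduceBy t ss rs) x ≡ x * value ss x + ι t * value rs x
    reduceBy-value t [] (r ∷ []) e x = begin
      ι ((t ℕ.* r) ℕ.% p) * 1# + 0# ≡⟨ cong (λ s → s * 1# + 0#) (trans (ι-% (t ℕ.* r)) (ι-* t r)) ⟩
      ι t * ι r * 1# + 0# ≡⟨ solve 3 (λ t r x → t :* r :* :1 :+ :0 := x :* :0 :+ t :* (r :* :1 :+ :0)) refl (ι t) (ι r) x ⟩
      x * 0# + ι t * (ι r * 1# + 0#) ∎
    reduceBy-value t (s ∷ ss) (r ∷ rs) e x = begin
      ι ((s ℕ.+ t ℕ.* r) ℕ.% p) * x ^ length (reduceBy t ss rs) + value (reduceBy t ss rs) x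
        ≡⟨ cong₂ _+_ (cong₂ (λ c k → c * x ^ k) (trans (ι-% (s ℕ.+ t ℕ.* r)) (trans (ι-+ s (t ℕ.* r)) (cong (ι s +_) (ι-* t r))))
             (trans (reduceBy-length t ss rs e′) e′)) (reduceBy-value t ss rs e′ x) ⟩
      (ι s + ι t * ι r) * (x * x ^ length ss) + (x * value ss x + ι t * value rs x)
        ≡⟨ solve 7 (λ s t r x y v w → (s :+ t :* r) :* (x :* y) :+ (x :* v :+ t :* w) := x :* (s :* y :+ v) :+ t :* (r :* (x :* y) :+ w))
             refl (ι s) (ι t) (ι r) x (x ^ length ss) (value ss x) (value rs x) ⟩
      x * (ι s * x ^ length ss + value ss x) + ι t * (ι r * (x * x ^ length ss) + value rs x)
        ≡⟨ cong (λ k → x * (ι s * x ^ length ss + value ss x) + ι t * (ι r * x ^ k + value rs x)) (sym e′) ⟩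
      x * value (s ∷ ss) x + ι t * value (r ∷ rs) x ∎
      where
        e′ : length rs ≡ suc (length ss)
        e′ = ℕₚ.suc-injective e

    modulus : Carrier → Carrier
    modulus x = x ^ length rs - value rs x

    -- Dividing X^(k + d) by the modulus: the quotient is monic of degree k.
    Division : ℕ → List ℕ → Set
    Division k s = length s ≡ length rs × ∃[ cs ] (∀ x → x ^ (k ℕ.+ length rs) ≡ monic {k} cs x * modulus x + value s x)

    divide-step : ∀ {k s} → 0 ℕ.< length rs → Division k s → Division (suc k) (times-X rs s)
    divide-step {k} {[]} 0<d (e , _) = ⊥-elim (ℕₚ.<⇒≢ 0<d e)
    divide-step {k} {t ∷ ss} 0<d (e , cs , division) = reduceBy-length t ss rs (sym e) , ι t ∷ cs , λ x → begin
      x * x ^ (k ℕ.+ length rs) ≡⟨ cong (x *_) (division x) ⟩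
      x * (monic cs x * modulus x + (ι t * x ^ length ss + value ss x))
        ≡⟨ linear₁ (cong (x ^_) e) (ι t) (solve 7 (λ x h X t y v w →
             x :* (h :* (X :- w) :+ (t :* y :+ v)) :- ((t :+ x :* h) :* (X :- w) :+ (x :* v :+ t :* w)) := t :* (x :* y :- X))
             refl x (monic cs x) (x ^ length rs) (ι t) (x ^ length ss) (value ss x) (value rs x)) ⟩
      (ι t + x * monic cs x) * modulus x + (x * value ss x + ι t * value rs x)
        ≡⟨ cong ((ι t + x * monic cs x) * modulus x +_) (sym (reduceBy-value t ss rs (sym e) x)) ⟩
      (ι t + x * monic cs x) * modulus x + value (reduceBy t ss rs) x ∎

    divide-steps : ∀ l {k s} → 0 ℕ.< length rs → Division k s → Division (l ℕ.+ k) (X-power rs l s)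
    divide-steps zero 0<d division = division
    divide-steps (suc l) {k} {s} 0<d division = subst (λ j → Division j (X-power rs (suc l) s)) (ℕₚ.+-suc l k)
      (divide-steps l 0<d (divide-step {k} {s} 0<d division))

    divide-start : Division 0 rs
    divide-start = refl , [] , λ x → solve 2 (λ X w → X := :1 :* (X :- w) :+ w) refl (x ^ length rs) (value rs x)

    -- If the modulus divides Xⁿ - X, where n is the order of the field, then it has a root: otherwise
    -- the quotient, of degree less than n, would vanish everywhere.
    root-exists : ∀ {k n} → (Fin n ↔ Carrier) → 0 ℕ.< length rs → n ≡ k ℕ.+ length rs →
      ∀ {s} → X-power rs k rs ≡ s → (∀ x → value s x ≡ x) → ∃[ θ ] θ ^ length rs ≡ value rs θ
    root-exists {k} {n} finite 0<d n≡k+d {s} X-power≡s value-s with search (λ x → x ^ length rs ≟ value rs x)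
      where open FiniteKit F n finite
    ... | yes found = found
    -- As k < n, there are k + 1 distinct elements at which the monic quotient of degree k would
    -- vanish.
    ... | no none = ⊥-elim (too-many-roots (proj₁ (proj₂ division)) (λ i → element (Fin.inject≤ i k<n))
            (λ {i} {j} e → Finₚ.inject≤-injective k<n k<n i j (trans (sym (index-element _)) (trans (cong index e) (index-element _))))
            (λ i → vanishes (element (Fin.inject≤ i k<n))))
      where
        open FiniteKit F n finite
        k<n : k ℕ.< n
        k<n = subst (k ℕ.<_) (sym n≡k+d) (ℕₚ.m<m+n k 0<d)
        division : Division k s
        division = subst (Division k) X-power≡s (subst (λ j → Division j (X-power rs k rs)) (ℕₚ.+-identityʳ k) (divide-steps k 0<d divide-start))
        quotient : Carrier → Carrier
        quotient = monic (proj₁ (proj₂ division))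
        vanishes : ∀ x → quotient x ≡ 0#
        vanishes x = no-zero-divisors {modulus x} (λ e → none (x , zero-difference e)) (linear₂
          (trans (sym (proj₂ (proj₂ division) x)) (trans (cong (x ^_) (sym n≡k+d)) (fermat n finite x))) 1#
          (value-s x) (- 1#)
          (solve 4 (λ m h v x → m :* h :- :0 := :1 :* ((h :* m :+ v) :- x) :+ (:- :1) :* (v :- x)) refl
            (modulus x) (quotient x) (value s x) x))

-- From the span of u to a normal form

module TraceSums {F : Field} {n : ℕ} (frobenius : Frobenius F n) where
  open FieldKit F
  open Frobenius frobenius
  open LinearCombinations F
  open ≡-Reasoning

  T-sum : ∀ {k} (f : Fin k → Carrier) → T (sum f) ≡ sum (λ i → T (f i))
  T-sum {zero} f = T-0
  T-sum {suc k} f = trans (T-+ _ _) (cong (T (f zero) +_) (T-sum (λ i → f (suc i))))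

  T-sum-* : ∀ {k} (f g : Fin k → Carrier) → T (sum (λ i → f i * g i)) ≡ sum (λ i → T (f i) * T (g i))
  T-sum-* f g = trans (T-sum (λ i → f i * g i)) (sum-cong-≗ (λ i → T-* (f i) (g i)))

  sum-trace : ∀ {k} (A g : Fin k → Carrier) x → sum (λ i → Tr (A i * x) * g i)
    ≡ sum (λ i → A i * g i) * x + (sum (λ i → T (A i) * g i) * T x + (sum (λ i → T² (A i) * g i) * T² x
      + (sum (λ i → T³ (A i) * g i) * T³ x + sum (λ i → T⁴ (A i) * g i) * T⁴ x)))
  sum-trace {k} A g x = begin
    sum (λ i → Tr (A i * x) * g i) ≡⟨ sum-cong-≗ (λ i → expand (A i) (g i)) ⟩
    sum (λ i → e₀ i + (e₁ i + (e₂ i + (e₃ i + e₄ i))))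
      ≡⟨ trans (∑-distrib-+ e₀ _) (cong (sum e₀ +_) (trans (∑-distrib-+ e₁ _) (cong (sum e₁ +_)
           (trans (∑-distrib-+ e₂ _) (cong (sum e₂ +_) (∑-distrib-+ e₃ e₄)))))) ⟩
    sum e₀ + (sum e₁ + (sum e₂ + (sum e₃ + sum e₄)))
      ≡⟨ Tr-cong₅ (sym (*-distribʳ-sum x (λ i → A i * g i))) (sym (*-distribʳ-sum (T x) (λ i → T (A i) * g i)))
           (sym (*-distribʳ-sum (T² x) (λ i → T² (A i) * g i))) (sym (*-distribʳ-sum (T³ x) (λ i → T³ (A i) * g i)))
           (sym (*-distribʳ-sum (T⁴ x) (λ i → T⁴ (A i) * g i))) ⟩
    _ ∎
    where
      e₀ e₁ e₂ e₃ e₄ : Fin k → Carrier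
      e₀ i = (A i * g i) * x
      e₁ i = (T (A i) * g i) * T x
      e₂ i = (T² (A i) * g i) * T² x
      e₃ i = (T³ (A i) * g i) * T³ x
      e₄ i = (T⁴ (A i) * g i) * T⁴ x
      expand : ∀ a g → Tr (a * x) * g ≡ (a * g) * x + ((T a * g) * T x + ((T² a * g) * T² x + ((T³ a * g) * T³ x + (T⁴ a * g) * T⁴ x)))
      expand a g = trans (cong (_* g) (Tr-cong₅ refl (T-* a x) (T²-* a x) (T³-* a x) (T⁴-* a x)))
        (trans (solve 6 (λ a b c d e g → (a :+ (b :+ (c :+ (d :+ e)))) :* g := a :* g :+ (b :* g :+ (c :* g :+ (d :* g :+ e :* g))))
            refl (a * x) (T a * T x) (T² a * T² x) (T³ a * T³ x) (T⁴ a * T⁴ x) g)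
          (Tr-cong₅ (swap a x) (swap (T a) (T x)) (swap (T² a) (T² x)) (swap (T³ a) (T³ x)) (swap (T⁴ a) (T⁴ x))))
        where
          swap : ∀ a x → (a * x) * g ≡ (a * g) * x
          swap a x = solve 3 (λ a x g → (a :* x) :* g := (a :* g) :* x) refl a x g

  trace-nondegenerate : ∃[ τ ] Tr τ ≡ 1# → ∀ {a} → a ≢ 0# → ∃[ x ] Tr (a * x) ≡ 1#
  trace-nondegenerate (τ , Trτ≡1) {a} a≢0 = let (i , ai≡1) = inverse a a≢0 in
    i * τ , trans (cong Tr (trans (sym (*-assoc a i τ)) (trans (cong (_* τ) ai≡1) (*-identityˡ τ)))) Trτ≡1

module MaximumScattered {F : Field} (q m : ℕ) (frobenius : Frobenius F (q ℕ.^ 5)) (digits : Digits frobenius q m)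
  (arithmetic : Conditions.Arithmetic frobenius)
  (count : suc ((1 ℕ.+ q ℕ.+ q ℕ.^ 2 ℕ.+ q ℕ.^ 3 ℕ.+ q ℕ.^ 4) ℕ.* m) ≡ q ℕ.^ 5)
  (u : Fin 5 → V F) (independent : LinIndep F q u) (maximum : MaxScattered F q u) where
  open FieldKit F
  open Frobenius frobenius
  open Conditions frobenius using (module Arithmetic)
  open Arithmetic arithmetic
  open Digits digits using (T-power)
  open LinearCombinations F
  open TraceSums frobenius
  open FiniteField F using (_^_; ^-+; ^-*)
  open Classification frobenius arithmetic
  open LinearSet q m frobenius digits u independent
  open Counting count maximum using (scattered)
  open ≡-Reasoning

  U-scattered : Scattered U
  U-scattered = record
    { +-closed = +-closed ; ·-closed = ·-closed ; scattered = scattered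
    ; enum = enum ; enum∈ = enum∈ ; enum-injective = enum-injective ; enum-surjective = enum-surjective }

  g h : Fin 5 → Carrier
  g i = proj₁ (u i)
  h i = proj₂ (u i)

  Annihilates : (Fin 5 → Carrier) → (Fin 5 → Carrier) → Set
  Annihilates A g = sum (λ i → A i * T² (g i)) ≡ 0# × sum (λ i → A i * T³ (g i)) ≡ 0#

  annihilator : ∃[ A ] ((∃[ j ] A j ≢ 0#) × Annihilates A g × Annihilates A h)
  annihilator =
    let (A , A≢0 , e) = nontrivial-solution finite {4} {5} (ℕₚ.n<1+n 4) w in
    A , A≢0 , (e zero , e (suc zero)) , (e (suc (suc zero)) , e (suc (suc (suc zero))))
    where
      w : Fin 4 → Fin 5 → Carrier
      w zero i = T² (g i)
      w (suc zero) i = T³ (g i)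
      w (suc (suc zero)) i = T² (h i)
      w (suc (suc (suc zero))) i = T³ (h i)

  coefficient₀ coefficient₁ coefficient₄ : (Fin 5 → Carrier) → (Fin 5 → Carrier) → Carrier
  coefficient₀ A g = sum (λ i → A i * g i)
  coefficient₁ A g = sum (λ i → T (A i) * g i)
  coefficient₄ A g = sum (λ i → T⁴ (A i) * g i)

  module _ (A : Fin 5 → Carrier) (A⊥g : Annihilates A g) (A⊥h : Annihilates A h) where

    Φ : Carrier → V F
    Φ x = combination (λ i → Tr (A i * x)) u

    Ψ : Carrier → V F
    Ψ = Trinomials (coefficient₀ A g) (coefficient₁ A g) (coefficient₄ A g) (coefficient₀ A h) (coefficient₁ A h) (coefficient₄ A h)

    -- Applying T³ and T² to the two annihilation conditions kills the terms in T²x and T³x.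
    sum-trace-trinomial : ∀ g → Annihilates A g → ∀ x →
      sum (λ i → Tr (A i * x) * g i) ≡ L (coefficient₀ A g) (coefficient₁ A g) (coefficient₄ A g) x
    sum-trace-trinomial g (e₂ , e₃) x = trans (sum-trace A g x) (trans
        (cong₂ (λ s t → coefficient₀ A g * x + (coefficient₁ A g * T x + (s * T² x + (t * T³ x + coefficient₄ A g * T⁴ x)))) vanish₂ vanish₃)
        (solve 8 (λ c₀ c₁ c₄ x x₁ x₂ x₃ x₄ → c₀ :* x :+ (c₁ :* x₁ :+ (:0 :* x₂ :+ (:0 :* x₃ :+ c₄ :* x₄)))
            := c₀ :* x :+ (c₁ :* x₁ :+ c₄ :* x₄)) refl (coefficient₀ A g) (coefficient₁ A g) (coefficient₄ A g) x (T x) (T² x) (T³ x) (T⁴ x)))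
      where
        vanish₂ : sum (λ i → T² (A i) * g i) ≡ 0#
        vanish₂ = begin
          sum (λ i → T² (A i) * g i) ≡⟨ sum-cong-≗ (λ i → cong (T² (A i) *_) (sym (T⁵-identity (g i)))) ⟩
          sum (λ i → T² (A i) * T² (T³ (g i))) ≡⟨ sym (trans (cong T (T-sum-* A (λ i → T³ (g i)))) (T-sum-* (λ i → T (A i)) (λ i → T⁴ (g i)))) ⟩
          T² (sum (λ i → A i * T³ (g i))) ≡⟨ trans (cong T² e₃) (trans (cong T T-0) T-0) ⟩
          0# ∎
        vanish₃ : sum (λ i → T³ (A i) * g i) ≡ 0#
        vanish₃ = begin
          sum (λ i → T³ (A i) * g i) ≡⟨ sum-cong-≗ (λ i → cong (T³ (A i) *_) (sym (T⁵-identity (g i)))) ⟩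
          sum (λ i → T³ (A i) * T³ (T² (g i))) ≡⟨ sym (trans (cong T² (T-sum-* A (λ i → T² (g i))))
              (trans (cong T (T-sum-* (λ i → T (A i)) (λ i → T³ (g i)))) (T-sum-* (λ i → T² (A i)) (λ i → T⁴ (g i))))) ⟩
          T³ (sum (λ i → A i * T² (g i))) ≡⟨ trans (cong T³ e₂) (trans (cong T² T-0) (trans (cong T T-0) T-0)) ⟩
          0# ∎

    Φ≡Ψ : ∀ x → Φ x ≡ Ψ x
    Φ≡Ψ x = trans (combination-coordinates (λ i → Tr (A i * x)) u) (cong₂ _,_ (sum-trace-trinomial g A⊥g x) (sum-trace-trinomial h A⊥h x))

    Ψ∈U : ∀ x → U (Ψ x)
    Ψ∈U x = (λ i → Tr (A i * x)) , (λ i → from-fixed (Tr-fixed (A i * x))) , sym (Φ≡Ψ x)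

    Ψ≡⇒Tr≡ : ∀ {x y} → Ψ x ≡ Ψ y → ∀ i → Tr (A i * x) ≡ Tr (A i * y)
    Ψ≡⇒Tr≡ {x} {y} e = combination-injective (λ i → Tr-fixed (A i * x)) (λ i → Tr-fixed (A i * y)) (trans (Φ≡Ψ x) (trans e (sym (Φ≡Ψ y))))

    Δ : Carrier
    Δ = coefficient₁ A g * coefficient₄ A h - coefficient₄ A g * coefficient₁ A h

    full-rank-classified : (∀ x → (∀ i → Tr (A i * x) ≡ 0#) → x ≡ 0#) → Classified U
    full-rank-classified full-rank = trinomials-classified U-scattered _ _ _ _ _ _ Ψ∈U λ {x} {y} e →
      zero-difference (full-rank (x - y) λ i → begin
        Tr (A i * (x - y)) ≡⟨ cong Tr (solve 3 (λ a x y → a :* (x :- y) := a :* x :+ (:- (a :* y))) refl (A i) x y) ⟩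
        Tr (A i * x - A i * y) ≡⟨ trans (Tr-+ _ _) (cong (Tr (A i * x) +_) (Tr-neg _)) ⟩
        Tr (A i * x) - Tr (A i * y) ≡⟨ difference-zero (Ψ≡⇒Tr≡ e i) ⟩
        0# ∎)

    -- If all values of Ψ are Fq-proportional, then A is proportional to a vector over Fq, which the
    -- annihilation conditions turn into a linear relation between the u i.
    rank-one-impossible : ∀ {j} → A j ≢ 0# → Ψ 1# ≡ (0# , 0#) → Δ ≡ 0# → ⊥
    rank-one-impossible {j} Aj≢0 Ψ1≡0 Δ≡0 = 1≢0 (trans (sym bj≡1) (independent b (λ i → from-fixed (Tr-fixed (A i * x₁)))
        (trans (combination-coordinates b u) (cong₂ _,_ (relation g A⊥g) (relation h A⊥h))) j))
      where
        x₁ : Carrier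
        x₁ = proj₁ (trace-nondegenerate trace-one Aj≢0)
        b : Fin 5 → Carrier
        b i = Tr (A i * x₁)
        bj≡1 : b j ≡ 1#
        bj≡1 = proj₂ (trace-nondegenerate trace-one Aj≢0)
        Ψx₁≢0 : Ψ x₁ ≢ (0# , 0#)
        Ψx₁≢0 e = 1≢0 (trans (sym bj≡1) (independent b (λ i → from-fixed (Tr-fixed (A i * x₁))) (trans (Φ≡Ψ x₁) e) j))
        multiples : ∀ y i → Tr (A i * y) ≡ Tr (A j * y) * b i
        multiples y i =
          let (l , l-fixed , e) = kernel-trinomials-degenerate U-scattered _ _ _ _ _ _ Ψ∈U Ψ1≡0 Δ≡0 Ψx₁≢0 y
              trace : ∀ i → Tr (A i * y) ≡ l * b i
              trace = combination-injective (λ i → Tr-fixed (A i * y)) (λ i → Fixed-* l-fixed (Tr-fixed (A i * x₁)))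
                (trans (Φ≡Ψ y) (trans e (trans (cong (_·ᵛ_ l) (sym (Φ≡Ψ x₁))) (sym (combination-· l b u)))))
          in trans (trace i) (cong (_* b i) (sym (trans (trace j) (trans (cong (l *_) bj≡1) (*-identityʳ l)))))
        -- By `multiples` the difference of the two sides is orthogonal to all of F under the trace
        -- form, which is nondegenerate.
        A≡bAj : ∀ i → A i ≡ b i * A j
        A≡bAj i with A i - b i * A j ≟ 0#
        ... | yes e = zero-difference e
        ... | no ne = let (x , e) = trace-nondegenerate trace-one ne in ⊥-elim (1≢0 (begin
          1# ≡⟨ sym e ⟩
          Tr ((A i - b i * A j) * x) ≡⟨ cong Tr (solve 4 (λ a b c x → (a :- b :* c) :* x := a :* x :- b :* (c :* x)) refl (A i) (b i) (A j) x) ⟩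
          Tr (A i * x - b i * (A j * x)) ≡⟨ trans (Tr-+ _ _) (cong (Tr (A i * x) +_) (trans (Tr-neg _) (cong -_ (Tr-scale (Tr-fixed (A i * x₁)) (A j * x))))) ⟩
          Tr (A i * x) - b i * Tr (A j * x) ≡⟨ difference-zero (trans (multiples x i) (*-comm _ (b i))) ⟩
          0# ∎))
        relation : ∀ g → Annihilates A g → sum (λ i → b i * g i) ≡ 0#
        -- Since T² fixes each b i, the first condition reads 0 = Σ Aᵢ T²gᵢ = Aⱼ T²(Σ bᵢ gᵢ).
        relation g (e₂ , _) = T-injective (T-injective (trans (no-zero-divisors Aj≢0 (begin
          A j * T² (sum (λ i → b i * g i)) ≡⟨ cong (A j *_) (trans (cong T (T-sum-* b g)) (T-sum-* (λ i → T (b i)) (λ i → T (g i)))) ⟩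
          A j * sum (λ i → T² (b i) * T² (g i)) ≡⟨ *-distribˡ-sum (A j) (λ i → T² (b i) * T² (g i)) ⟩
          sum (λ i → A j * (T² (b i) * T² (g i))) ≡⟨ sum-cong-≗ (λ i → trans (cong (λ s → A j * (s * T² (g i))) (T²-Tr (A i * x₁)))
              (trans (solve 3 (λ a b g → a :* (b :* g) := (b :* a) :* g) refl (A j) (b i) (T² (g i))) (cong (_* T² (g i)) (sym (A≡bAj i))))) ⟩
          sum (λ i → A i * T² (g i)) ≡⟨ e₂ ⟩
          0# ∎)) (sym (trans (cong T T-0) T-0))))

    Ψ1≡0 : (∀ i → Tr (A i) ≡ 0#) → Ψ 1# ≡ (0# , 0#)
    Ψ1≡0 Tr≡0 = begin
      Ψ 1# ≡⟨ sym (Φ≡Ψ 1#) ⟩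
      combination (λ i → Tr (A i * 1#)) u ≡⟨ combination-cong u (λ i → trans (cong Tr (*-identityʳ (A i))) (trans (Tr≡0 i) (sym (zeroˡ 1#)))) ⟩
      combination {5} (λ i → 0# * 1#) u ≡⟨ combination-· 0# (λ _ → 1#) u ⟩
      0# ·ᵛ combination (λ _ → 1#) u ≡⟨ cong₂ _,_ (zeroˡ _) (zeroˡ _) ⟩
      (0# , 0#) ∎

    deficient-classified : ∀ {j} → A j ≢ 0# → (∀ i → Tr (A i) ≡ 0#) → Classified U
    deficient-classified Aj≢0 Tr≡0 with Δ ≟ 0#
    ... | yes Δ≡0 = ⊥-elim (rank-one-impossible Aj≢0 (Ψ1≡0 Tr≡0) Δ≡0)
    ... | no Δ≢0 = kernel-trinomials-classified U-scattered _ _ _ _ _ _ Ψ∈U (Ψ1≡0 Tr≡0) Δ≢0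

  classified : Classified U
  classified = split annihilator
    where
      split : ∃[ A ] ((∃[ j ] A j ≢ 0#) × Annihilates A g × Annihilates A h) → Classified U
      split (A , (j , Aj≢0) , A⊥g , A⊥h) with search (λ x → ¬? (x ≟ 0#) ×-dec Finₚ.all? (λ i → Tr (A i * x) ≟ 0#))
      -- Multiplying A by the kernel vector x moves that vector to 1 and preserves the four
      -- equations, which are F-linear in A.
      ... | yes (x , x≢0 , Tr≡0) = deficient-classified (λ i → A i * x) (rescale g A⊥g) (rescale h A⊥h) {j} (product-nonzero Aj≢0 x≢0) Tr≡0
        where
          rescaled : ∀ w → sum (λ i → A i * w i) ≡ 0# → sum (λ i → (A i * x) * w i) ≡ 0#
          rescaled w e = trans (sum-cong-≗ (λ i → cong (_* w i) (*-comm (A i) x))) (trans (sum-scale x A w) (trans (cong (x *_) e) (zeroʳ x)))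
          rescale : ∀ g → Annihilates A g → Annihilates (λ i → A i * x) g
          rescale g (e₂ , e₃) = rescaled (λ i → T² (g i)) e₂ , rescaled (λ i → T³ (g i)) e₃
      ... | no none = full-rank-classified A A⊥g A⊥h λ x Tr≡0 → kernel-trivial x Tr≡0
        where
          kernel-trivial : ∀ x → (∀ i → Tr (A i * x) ≡ 0#) → x ≡ 0#
          kernel-trivial x Tr≡0 with x ≟ 0#
          ... | yes e = e
          ... | no x≢0 = ⊥-elim (none (x , x≢0 , Tr≡0))

  q-power-suc : ∀ x s → x ^ (q ℕ.^ suc s) ≡ T (x ^ (q ℕ.^ s))
  q-power-suc x s = trans (^-* x q (q ℕ.^ s)) (sym (T-power (x ^ (q ℕ.^ s))))

  q-power-1 : ∀ x → T x ≡ x ^ (q ℕ.^ 1)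
  q-power-1 x = sym (trans (q-power-suc x 0) (cong T (*-identityʳ x)))
  q-power-2 : ∀ x → T² x ≡ x ^ (q ℕ.^ 2)
  q-power-2 x = trans (cong T (q-power-1 x)) (sym (q-power-suc x 1))
  q-power-3 : ∀ x → T³ x ≡ x ^ (q ℕ.^ 3)
  q-power-3 x = trans (cong T (q-power-2 x)) (sym (q-power-suc x 2))
  q-power-4 : ∀ x → T⁴ x ≡ x ^ (q ℕ.^ 4)
  q-power-4 x = trans (cong T (q-power-3 x)) (sym (q-power-suc x 3))

  Norm≡N : ∀ x → Norm F q x ≡ N x
  Norm≡N x = begin
    x ^ (1 ℕ.+ q ℕ.+ q ℕ.^ 2 ℕ.+ q ℕ.^ 3 ℕ.+ q ℕ.^ 4)
      ≡⟨ trans (^-+ x (1 ℕ.+ q ℕ.+ q ℕ.^ 2 ℕ.+ q ℕ.^ 3) (q ℕ.^ 4)) (cong₂ _*_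
           (trans (^-+ x (1 ℕ.+ q ℕ.+ q ℕ.^ 2) (q ℕ.^ 3)) (cong₂ _*_
             (trans (^-+ x (1 ℕ.+ q) (q ℕ.^ 2)) (cong₂ _*_ (cong (x *_) (sym (T-power x))) (sym (q-power-2 x))))
             (sym (q-power-3 x))))
           (sym (q-power-4 x))) ⟩
    x * T x * T² x * T³ x * T⁴ x
      ≡⟨ solve 5 (λ a b c d e → a :* b :* c :* d :* e := a :* (b :* (c :* (d :* e)))) refl x (T x) (T² x) (T³ x) (T⁴ x) ⟩
    N x ∎

  N-zero : ∀ {x} → N x ≡ 0# → x ≡ 0#
  N-zero {x} e with x ≟ 0#
  ... | yes x≡0 = x≡0
  ... | no x≢0 = ⊥-elim (product-nonzero x≢0 (product-nonzero x₁ (product-nonzero x₂ (product-nonzero x₃ (T-nonzero x₃)))) e)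
    where
      x₁ = T-nonzero x≢0
      x₂ = T-nonzero x₁
      x₃ = T-nonzero x₂

  -- The equivalence is linear, so σ is the identity. The condition `f 0# ≡ 0#` ensures that a
  -- nonzero vector of U goes to (x, f x) with x ≠ 0.
  equivalent : ∀ {f f′} → GraphOf f U → f 0# ≡ 0# → (∀ x → f x ≡ f′ x) → PΓLEquivalent F (LinSet F q u) (GraphSet F f′)
  equivalent {f} {f′} graph f0≡0 f≡f′ = γ , λ w → forward , backward
    where
      open GraphOf graph
      γ : ΓL2 F
      γ = record
        { a = Matrix.a M ; b = Matrix.b M ; c = Matrix.c M ; d = Matrix.d M ; σ = λ x → x ; det≢0 = Matrix.det≢0 M
        ; σ-aut = (λ _ _ → refl) , (λ _ _ → refl) , refl , (λ x → x) , (λ _ → refl) , (λ _ → refl) }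
      act-nonzero : ∀ {w} → w ≢ (0# , 0#) → act M w ≢ (0# , 0#)
      act-nonzero w≢0 e = w≢0 (act-injective M (trans e (sym (act-0 M))))
      forward : ∀ {w} → LinSet F q u w → GraphSet F f′ (act M w)
      forward (w≢0 , v , v∈U , v≢0 , l , l≢0 , refl) =
        let (x , e) = into v∈U in
        act-nonzero w≢0 , x
        , (λ x≡0 → act-nonzero v≢0 (trans e (cong₂ _,_ x≡0 (trans (cong f x≡0) f0≡0))))
        , l , l≢0 , trans (act-· M l v) (cong (_·ᵛ_ l) (trans e (cong (x ,_) (f≡f′ x))))
      backward : ∀ {w} → GraphSet F f′ (act M w) → LinSet F q u w
      backward {w} (Mw≢0 , x , x≢0 , l , l≢0 , e) =
        let (v , v∈U , e′) = onto x in
        (λ w≡0 → Mw≢0 (trans (cong (act M) w≡0) (act-0 M))) , v , v∈U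
        , (λ v≡0 → x≢0 (cong proj₁ (trans (sym e′) (trans (cong (act M) v≡0) (act-0 M)))))
        , l , l≢0 , act-injective M (trans e (trans (cong (_·ᵛ_ l) (trans (cong (x ,_) (sym (f≡f′ x))) (sym e′))) (sym (act-· M l v))))

  pseudoregulus-or-LP : PseudoregulusType F q (LinSet F q u) ⊎ LPType F q (LinSet F q u)
  pseudoregulus-or-LP = by-form classified
    where
      T²-0 : T² 0# ≡ 0#
      T²-0 = trans (cong T T-0) T-0
      T³-0 : T³ 0# ≡ 0#
      T³-0 = trans (cong T T²-0) T-0
      T⁴-0 : T⁴ 0# ≡ 0#
      T⁴-0 = trans (cong T T³-0) T-0
      sum-0 : ∀ {s t δ} → s ≡ 0# → t ≡ 0# → s + δ * t ≡ 0#
      sum-0 {δ = δ} refl refl = trans (cong (0# +_) (zeroʳ δ)) (+-identityˡ 0#)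
      by-form : Classified U → PseudoregulusType F q (LinSet F q u) ⊎ LPType F q (LinSet F q u)
      by-form (_ , pseudoregulus₁ , graph) = inj₁ (1 , ℕₚ.m≤m+n 2 3 , refl , equivalent graph T-0 q-power-1)
      by-form (_ , pseudoregulus₂ , graph) = inj₁ (2 , ℕₚ.m≤m+n 3 2 , refl , equivalent graph T²-0 q-power-2)
      by-form (_ , pseudoregulus₄ , graph) = inj₁ (4 , ℕₚ.m≤m+n 5 0 , refl , equivalent graph T⁴-0 q-power-4)
      by-form (_ , LP₁ δ δ≢0 Nδ≢1 , graph) = inj₂ (1 , δ , ℕₚ.m≤m+n 2 3 , refl
        , (λ e → δ≢0 (N-zero (trans (sym (Norm≡N δ)) e))) , (λ e → Nδ≢1 (trans (sym (Norm≡N δ)) e))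
        , equivalent graph (sum-0 T-0 T⁴-0) (λ x → cong₂ (λ s t → s + δ * t) (q-power-1 x) (q-power-4 x)))
      by-form (_ , LP₂ δ δ≢0 Nδ≢1 , graph) = inj₂ (2 , δ , ℕₚ.m≤m+n 3 2 , refl
        , (λ e → δ≢0 (N-zero (trans (sym (Norm≡N δ)) e))) , (λ e → Nδ≢1 (trans (sym (Norm≡N δ)) e))
        , equivalent graph (sum-0 T²-0 T³-0) (λ x → cong₂ (λ s t → s + δ * t) (q-power-2 x) (q-power-3 x)))

-- Computations in Fq[θ]

-- Unlike a let binding, the argument of an application is evaluated at most once.
infixl 1 _▹_
_▹_ : {A B : Set} → A → (A → B) → B
x ▹ f = f x

allᵇ anyᵇ : {A : Set} → (A → Bool) → List A → Bool
allᵇ f [] = true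
allᵇ f (x ∷ xs) = f x ∧ allᵇ f xs
anyᵇ f [] = false
anyᵇ f (x ∷ xs) = f x ∨ anyᵇ f xs

infixr 2 _or_
-- In `some` the candidates may come from any heuristic or table: soundness rests on `verify` alone.
data Test (A : Set) : Set₁ where
  test : (A → Bool) → Test A
  some : {B : Set} → (A → List B) → (A → B → Bool) → Test A
  _or_ : Test A → Test A → Test A

run : {A : Set} → Test A → A → Bool
run (test f) x = f x
run (some candidates verify) x = anyᵇ (verify x) (candidates x)
run (s or t) x = run s x ∨ run t x

-- Binary tries with keys read from the least significant bit.
data Trie (A : Set) : Set where
  leaf : Trie A
  node : Maybe A → Trie A → Trie A → Trie A

insert : {A : Set} → ℕ → ℕ → A → Trie A → Trie A
insert zero _ x _ = node (just x) leaf leaf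
insert (suc b) k x leaf with k ℕ.% 2
... | 0 = node nothing (insert b (k ℕ./ 2) x leaf) leaf
... | _ = node nothing leaf (insert b (k ℕ./ 2) x leaf)
insert (suc b) k x (node m l r) with k ℕ.% 2
... | 0 = node m (insert b (k ℕ./ 2) x l) r
... | _ = node m l (insert b (k ℕ./ 2) x r)

find : {A : Set} → ℕ → ℕ → Trie A → Maybe A
find _ _ leaf = nothing
find zero _ (node m _ _) = m
find (suc b) k (node _ l r) with k ℕ.% 2
... | 0 = find b (k ℕ./ 2) l
... | _ = find b (k ℕ./ 2) r

-- a + bθ + cθ² + dθ³ + eθ⁴
data K (D : Set) : Set where
  mk : D → D → D → D → D → K D

-- A representation of Fq by digits, and of F as Fq[θ] with θ⁵ = r₀ + r₁θ + r₂θ². Sums and products of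
-- digits need not be normalised; tᵢ is the image of θⁱ under the Frobenius map.
record Model : Set₁ where
  infixl 6 _∔_
  infixl 7 _∙_
  field
    D : Set
    _∔_ _∙_ : D → D → D
    norm reciprocal fifth-root : D → D
    𝟘 𝟙 -𝟙 : D
    eq : D → D → Bool
    code : D → ℕ
    q : ℕ
    units : List D
    r₀ r₁ r₂ : D
    t₁ t₂ t₃ t₄ : K D

  digits : List D
  digits = 𝟘 ∷ units

module Computation (M : Model) where
  open Model M

  𝕂 : Set
  𝕂 = K D

  normalise : 𝕂 → 𝕂
  normalise (mk a b c d e) = mk (norm a) (norm b) (norm c) (norm d) (norm e)

  infixl 6 _⊞_
  _⊞_ : 𝕂 → 𝕂 → 𝕂
  mk a b c d e ⊞ mk a′ b′ c′ d′ e′ = mk (a ∔ a′) (b ∔ b′) (c ∔ c′) (d ∔ d′) (e ∔ e′)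

  infixr 7 _⊡_
  _⊡_ : D → 𝕂 → 𝕂
  x ⊡ mk a b c d e = mk (x ∙ a) (x ∙ b) (x ∙ c) (x ∙ d) (x ∙ e)

  shift : 𝕂 → 𝕂
  shift (mk a b c d e) = mk (e ∙ r₀) (a ∔ e ∙ r₁) (b ∔ e ∙ r₂) c d

  constant : D → 𝕂
  constant a = mk a 𝟘 𝟘 𝟘 𝟘

  zero′ one θ′ : 𝕂
  zero′ = constant 𝟘
  one = constant 𝟙
  θ′ = mk 𝟘 𝟙 𝟘 𝟘 𝟘

  add sub mul : 𝕂 → 𝕂 → 𝕂
  add x y = normalise (x ⊞ y)
  sub x y = normalise (x ⊞ -𝟙 ⊡ y)
  mul (mk a b c d e) y = normalise (a ⊡ y ⊞ shift (b ⊡ y ⊞ shift (c ⊡ y ⊞ shift (d ⊡ y ⊞ shift (e ⊡ y)))))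

  T T² T³ T⁴ : 𝕂 → 𝕂
  T (mk a b c d e) = normalise (constant a ⊞ (b ⊡ t₁ ⊞ (c ⊡ t₂ ⊞ (d ⊡ t₃ ⊞ e ⊡ t₄))))
  T² x = T (T x)
  T³ x = T (T² x)
  T⁴ x = T (T³ x)

  eqK : 𝕂 → 𝕂 → Bool
  eqK (mk a b c d e) (mk a′ b′ c′ d′ e′) = eq a a′ ∧ (eq b b′ ∧ (eq c c′ ∧ (eq d d′ ∧ eq e e′)))

  trace : 𝕂 → 𝕂
  trace x = T x ▹ λ x₁ → T x₁ ▹ λ x₂ → T x₂ ▹ λ x₃ → add x (add x₁ (add x₂ (add x₃ (T x₃))))

  normK : 𝕂 → 𝕂
  normK x = T x ▹ λ x₁ → T x₁ ▹ λ x₂ → T x₂ ▹ λ x₃ → mul x (mul x₁ (mul x₂ (mul x₃ (T x₃))))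

  -- The product Tx T²x T³x T⁴x, whose last two factors are T² of the first two. Multiplied by x it
  -- is the norm, an element of Fq, which reduces inversion to Fq.
  conjugates : 𝕂 → 𝕂
  conjugates x = T x ▹ λ x₁ → mul x₁ (T x₁) ▹ λ x₁₂ → mul x₁₂ (T² x₁₂)

  scaleByReciprocal : 𝕂 → 𝕂 → 𝕂
  scaleByReciprocal (mk a _ _ _ _) x = normalise (reciprocal a ⊡ x)

  invert : 𝕂 → 𝕂
  invert x = conjugates x ▹ λ y → scaleByReciprocal (mul x y) y

  -- An inverse that can be checked certifies x ≠ 0 under every ring homomorphism; comparison with
  -- the zero tuple would presuppose that distinct tuples represent distinct elements.
  nonzero : 𝕂 → Bool
  nonzero x = eqK (mul x (invert x)) one

  all𝕂 : (𝕂 → Bool) → Bool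
  all𝕂 f = allᵇ (λ a → allᵇ (λ b → allᵇ (λ c → allᵇ (λ d → allᵇ (λ e → f (mk a b c d e)) digits) digits) digits) digits) digits

  index : 𝕂 → ℕ
  index (mk a b c d e) = code a ℕ.+ q ℕ.* (code b ℕ.+ q ℕ.* (code c ℕ.+ q ℕ.* (code d ℕ.+ q ℕ.* code e)))

  grid : List D → List D → List D → List D → List D → List 𝕂
  grid as bs cs ds es = concatMap (λ a → concatMap (λ b → concatMap (λ c → concatMap (λ d → map (mk a b c d) es) ds) cs) bs) as

  -- Representatives of the nonzero elements modulo Fq*.
  lines : List 𝕂
  lines = grid 𝟙s digits digits digits digits ++ grid 𝟘s 𝟙s digits digits digits ++ grid 𝟘s 𝟘s 𝟙s digits digits
       ++ grid 𝟘s 𝟘s 𝟘s 𝟙s digits ++ grid 𝟘s 𝟘s 𝟘s 𝟘s 𝟙s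
    where
      𝟘s = 𝟘 ∷ []
      𝟙s = 𝟙 ∷ []

  basis : List 𝕂
  basis = one ∷ θ′ ∷ mk 𝟘 𝟘 𝟙 𝟘 𝟘 ∷ mk 𝟘 𝟘 𝟘 𝟙 𝟘 ∷ mk 𝟘 𝟘 𝟘 𝟘 𝟙 ∷ []

  -- The keys given by `index` are below q⁵ ≤ 3125 < 2¹².
  bits : ℕ
  bits = 12

  -- Maps z^(q-1) to z for the trace-zero elements z.
  traceZeroRoots : Trie 𝕂
  traceZeroRoots = foldr (λ z t → if eqK (trace z) zero′ then insert bits (index (mul (T z) (invert z))) z t else t) leaf lines

  smallerFrom : ℕ → ℕ → 𝕂 → Bool
  smallerFrom zero i x = false
  smallerFrom (suc k) i x = (index x ℕ.<ᵇ i) ∨ smallerFrom k i (T x)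

  hasSmallerConjugate : 𝕂 → Bool
  hasSmallerConjugate x = smallerFrom 4 (index x) (T x)

  isZero isOne isConstant moves normNotOne hasTraceOne : 𝕂 → Bool
  isZero x = eqK x zero′
  isOne x = eqK x one
  isConstant x@(mk a _ _ _ _) = eqK x (constant a)
  moves x = nonzero (sub (T x) x)
  normNotOne x = nonzero (sub (normK x) one)
  hasTraceOne x = isOne (trace x)

  power : ℕ → 𝕂 → 𝕂
  power zero x = one
  power (suc k) x = mul x (power k x)

  frobenius-images : Bool
  frobenius-images = eqK (power q θ′) t₁ ∧ (eqK (mul t₁ t₁) t₂ ∧ (eqK (mul t₁ t₂) t₃ ∧ eqK (mul t₁ t₃) t₄))

  -- The trace is a nonzero Fq-linear form, so it takes the value 1 at a multiple of some basis
  -- element. The element 1 alone would not do: Tr 1 = 0 for q = 5.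
  traceOneCandidates : List 𝕂
  traceOneCandidates = concatMap (λ c → map (mul (constant c)) basis) digits

  -- For N κ = 1 this is the classical solution l of l = κ T l, unless it vanishes.
  resolvent : 𝕂 → 𝕂 → 𝕂
  resolvent κ w = step (step (step (step w)))
    where
      step : 𝕂 → 𝕂
      step x = add w (mul κ (T x))

  fifthRoot : 𝕂 → D
  fifthRoot (mk a _ _ _ _) = norm (fifth-root a)

  hilbertCandidates : 𝕂 → List (D × 𝕂)
  hilbertCandidates κ = fifthRoot (normK κ) ▹ λ c → normalise (reciprocal c ⊡ κ) ▹ λ κ′ →
    -- The pair (c, 1) serves κ = 0, where c = 0. For κ ≠ 0 the element κ/c has norm 1, and its
    -- resolvent is a nonzero Fq-linear map in w, so it cannot vanish on a whole basis.
    (c , one) ∷ map (λ w → (c , resolvent κ′ w)) basis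

  verify-hilbert : 𝕂 → D × 𝕂 → Bool
  verify-hilbert κ (c , l) = eqK (mul κ (T l)) (mul (constant c) l) ∧ nonzero l

  -- If Tm = Tδ m, then l = m T²m T⁴m satisfies T²l = Tδ l.
  normOneCandidates : 𝕂 → List 𝕂
  normOneCandidates δ = invert (T δ) ▹ λ κ → map (λ w → resolvent κ w ▹ λ m → mul m (mul (T² m) (T⁴ m))) basis

  verify-norm-one : 𝕂 → 𝕂 → Bool
  verify-norm-one δ l = eqK (mul δ (T⁴ l)) (T l) ∧ nonzero l

  linePairs : List (𝕂 × 𝕂)
  linePairs = concatMap (λ y → map (y ,_) lines) lines

  verify-T+T⁴ : 𝕂 × 𝕂 → Bool
  verify-T+T⁴ (y , t) = (nonzero y ∧ moves t) ∧ (mul t y ▹ λ ty → eqK (mul t (add (T y) (T⁴ y))) (add (T ty) (T⁴ ty)))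

  Hints : Set
  Hints = List (𝕂 × 𝕂 × 𝕂)

  -- If Tz = rz, the collision condition reads r = (e + Ty) y⁻¹; the hints are y, Ty and y⁻¹.
  traceHints : D → Hints
  traceHints t = concatMap (λ c → concatMap (λ x → mul (constant c) x ▹ λ y →
    if eqK (trace y) (constant t) ∧ nonzero y then (y , T y , invert y) ∷ [] else []) lines) digits

  traceCandidate : Trie 𝕂 → Hints → 𝕂 → List (𝕂 × 𝕂)
  traceCandidate roots [] e = []
  traceCandidate roots ((y , y₁ , y⁻¹) ∷ hints) e with find bits (index (mul (add e y₁) y⁻¹)) roots
  ... | just z = (y , z) ∷ []
  ... | nothing = traceCandidate roots hints e

  verify-trace : D → 𝕂 → 𝕂 × 𝕂 → Bool
  verify-trace t e (y , z) = (nonzero z ∧ isZero (trace z)) ∧ (eqK (trace y) (constant t)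
    ∧ eqK (mul e z) (sub (mul y (T z)) (mul z (T y))))

  verify-trace-exception : 𝕂 → D → Bool
  verify-trace-exception e d = constant d ▹ λ δ → normNotOne δ
    ∧ (eqK (add (mul δ δ) one) δ ∧ isZero (add (mul e (add one (add δ δ))) δ))

  -- If Ty = sy and Tz = rz, the collision condition reads a = s + r (s - c s T⁴s); the hints are y, s and
  -- the inverse of the factor of r.
  binomialHints : 𝕂 → Hints
  binomialHints c = concatMap (λ y → mul (T y) (invert y) ▹ λ s → sub s (mul c (mul s (T⁴ s))) ▹ λ d →
    if isZero d then [] else ((y , s , invert d) ∷ [])) lines

  binomialCandidate : Trie 𝕂 → Hints → 𝕂 → List (𝕂 × 𝕂)
  binomialCandidate roots [] a = []
  binomialCandidate roots ((y , s , d⁻¹) ∷ hints) a with find bits (index (mul (sub a s) d⁻¹)) roots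
  ... | just z = (y , z) ∷ []
  ... | nothing = binomialCandidate roots hints a

  verify-binomial : 𝕂 → 𝕂 → 𝕂 × 𝕂 → Bool
  verify-binomial c a (y , z) = T z ▹ λ z₁ → T y ▹ λ y₁ → T⁴ y ▹ λ y₄ → (nonzero y ∧ nonzero z) ∧ (isZero (trace z)
    ∧ eqK (add (mul a (mul y (mul y₄ z))) (mul c (mul y (mul y₁ z₁)))) (mul y₁ (mul y₄ (add z z₁))))

  bothZero inverseTo : 𝕂 → 𝕂 → Bool
  bothZero c a = isZero c ∧ isZero a
  inverseTo c a = isOne (mul a c)

  verify-binomial-exception : 𝕂 → 𝕂 → D → Bool
  verify-binomial-exception c a d = constant d ▹ λ δ → mul δ δ ▹ λ δ² →
    (nonzero δ ∧ normNotOne δ) ∧ (eqK (add c (mul δ² a)) δ ∧ isZero (add a (mul (mul δ² δ) c)))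

  candidateDigits : 𝕂 → List D
  candidateDigits _ = digits

  inverseTest fixedTest hilbertTest normOneTest : Test 𝕂
  inverseTest = test isZero or test nonzero
  fixedTest = test isConstant or test moves
  hilbertTest = some hilbertCandidates verify-hilbert
  normOneTest = test normNotOne or some normOneCandidates verify-norm-one

  traceZeroTest traceOneTest : Trie 𝕂 → Hints → Test 𝕂
  traceZeroTest roots hints = test hasSmallerConjugate or test isZero or some (traceCandidate roots hints) (verify-trace 𝟘)
  traceOneTest roots hints = test hasSmallerConjugate or some (traceCandidate roots hints) (verify-trace 𝟙)
    or test isZero or some candidateDigits verify-trace-exception

  binomialTest : Trie 𝕂 → Hints → 𝕂 → Test 𝕂
  binomialTest roots hints c = test hasSmallerConjugate or some (binomialCandidate roots hints) (verify-binomial c)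
    or test (bothZero c) or test (inverseTo c) or some candidateDigits (verify-binomial-exception c)

-- Soundness of the computations

∧-elim : ∀ {a b} → a ∧ b ≡ true → a ≡ true × b ≡ true
∧-elim {true} e = refl , e

∨-elim : ∀ {a b} → a ∨ b ≡ true → a ≡ true ⊎ b ≡ true
∨-elim {true} e = inj₁ refl
∨-elim {false} e = inj₂ e

allᵇ-elim : ∀ {A : Set} {f : A → Bool} {xs x} → allᵇ f xs ≡ true → x ∈ xs → f x ≡ true
allᵇ-elim e (here refl) = proj₁ (∧-elim e)
allᵇ-elim {f = f} {y ∷ _} e (there x∈xs) = allᵇ-elim (proj₂ (∧-elim {f y} e)) x∈xs

anyᵇ-elim : ∀ {A : Set} {f : A → Bool} {xs} → anyᵇ f xs ≡ true → ∃[ x ] f x ≡ true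
anyᵇ-elim {f = f} {x ∷ xs} e with ∨-elim {f x} e
... | inj₁ fx = x , fx
... | inj₂ rest = anyᵇ-elim {f = f} {xs} rest

record ModelLaws (M : Model) : Set where
  open Model M
  field
    eq-sound : ∀ {a b} → eq a b ≡ true → a ≡ b
    norm∈digits : ∀ a → norm a ∈ digits
    digits-count : length digits ≡ q
    digits-apart : ∀ i j → norm (List.lookup digits i ∔ -𝟙 ∙ List.lookup digits j) ≡ 𝟘 → i ≡ j

Outcome : {A : Set} → Test A → A → Set
Outcome (test f) x = f x ≡ true
Outcome (some candidates verify) x = ∃[ y ] verify x y ≡ true
Outcome (s or t) x = Outcome s x ⊎ Outcome t x

outcome : ∀ {A : Set} (t : Test A) x → run t x ≡ true → Outcome t x
outcome (test f) x p = p
outcome (some candidates verify) x p = anyᵇ-elim {f = verify x} {candidates x} p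
outcome (s or t) x p = Data.Sum.map (outcome s x) (outcome t x) (∨-elim {run s x} p)

module Verification (M : Model) where
  open Model M
  open Computation M

  Enumerated : 𝕂 → Set
  Enumerated (mk a b c d e) = a ∈ digits × b ∈ digits × c ∈ digits × d ∈ digits × e ∈ digits

  all𝕂-elim : ∀ f → all𝕂 f ≡ true → ∀ {x} → Enumerated x → f x ≡ true
  all𝕂-elim f p {mk a b c d e} (a∈ , b∈ , c∈ , d∈ , e∈) = allᵇ-elim (allᵇ-elim (allᵇ-elim (allᵇ-elim (allᵇ-elim p a∈) b∈) c∈) d∈) e∈

  Everywhere : Test 𝕂 → Set
  Everywhere t = ∀ x → Enumerated x → Outcome t x

  everywhere : ∀ t → all𝕂 (run t) ≡ true → Everywhere t
  everywhere t p x x∈ = outcome t x (all𝕂-elim (run t) p x∈)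

  somewhere : ∀ {A : Set} (f : A → Bool) xs → anyᵇ f xs ≡ true → ∃[ x ] f x ≡ true
  somewhere f xs p = anyᵇ-elim {f = f} {xs} p

  record Verified : Set where
    field
      inverses : Everywhere inverseTest
      fixed : Everywhere fixedTest
      images : frobenius-images ≡ true
      hilbert : Everywhere hilbertTest
      norm-ones : Everywhere normOneTest
      T+T⁴ : ∃[ yt ] verify-T+T⁴ yt ≡ true
      trace-ones : ∃[ x ] hasTraceOne x ≡ true
      roots : Trie 𝕂
      hints₀ hints₁ : Hints
      hints : D → Hints
      trace-zeros : Everywhere (traceZeroTest roots hints₀)
      trace-one-collisions : Everywhere (traceOneTest roots hints₁)
      binomials : ∀ {d} → d ∈ digits → Everywhere (binomialTest roots (hints d) (constant d))

record Realisation (M : Model) {F : Field} (frobenius : Frobenius F (Model.q M ℕ.^ 5)) : Set where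
  open Model M
  open FieldKit F
  open Frobenius frobenius
  field
    T-power : ∀ x → T x ≡ _^ᶠ_ F x q
    ι : D → Carrier
    ι-∔ : ∀ a b → ι (a ∔ b) ≡ ι a + ι b
    ι-∙ : ∀ a b → ι (a ∙ b) ≡ ι a * ι b
    ι-norm : ∀ a → ι (norm a) ≡ ι a
    ι-𝟘 : ι 𝟘 ≡ 0#
    ι-𝟙 : ι 𝟙 ≡ 1#
    ι--𝟙 : ι -𝟙 ≡ - 1#
    ι-fixed : ∀ a → T (ι a) ≡ ι a
    θ : Carrier
    θ⁵ : θ * (θ * (θ * (θ * θ))) ≡ ι r₀ + θ * (ι r₁ + θ * ι r₂)

module Soundness (M : Model) (laws : ModelLaws M) (computed : Verification.Verified M) {F : Field}
  (frobenius : Frobenius F (Model.q M ℕ.^ 5)) (realisation : Realisation M frobenius) where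
  open Model M
  open ModelLaws laws
  open FieldKit F
  open Frobenius frobenius
  open Realisation realisation
  open Conditions frobenius
  open ≡-Reasoning
  module C = Computation M
  open Verification M using (Enumerated)
  module Computed = Verification.Verified computed
  open Computation M using (𝕂; normalise; _⊞_; _⊡_; shift; constant; zero′; one; θ′; add; sub; mul; eqK; nonzero)

  φ : 𝕂 → Carrier
  φ (mk a b c d e) = ι a + θ * (ι b + θ * (ι c + θ * (ι d + θ * ι e)))

  φ-cong : ∀ {a b c d e a′ b′ c′ d′ e′} → a ≡ a′ → b ≡ b′ → c ≡ c′ → d ≡ d′ → e ≡ e′ →
    a + θ * (b + θ * (c + θ * (d + θ * e))) ≡ a′ + θ * (b′ + θ * (c′ + θ * (d′ + θ * e′)))
  φ-cong refl refl refl refl refl = refl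

  φ-normalise : ∀ x → φ (normalise x) ≡ φ x
  φ-normalise (mk a b c d e) = φ-cong (ι-norm a) (ι-norm b) (ι-norm c) (ι-norm d) (ι-norm e)

  horner-+ : ∀ {a a′ b b′ s} → s ≡ b + b′ → (a + a′) + θ * s ≡ (a + θ * b) + (a′ + θ * b′)
  horner-+ {a} {a′} {b} {b′} refl =
    solve 5 (λ t a a′ b b′ → (a :+ a′) :+ t :* (b :+ b′) := (a :+ t :* b) :+ (a′ :+ t :* b′)) refl θ a a′ b b′

  horner-* : ∀ {k a b s} → s ≡ k * b → k * a + θ * s ≡ k * (a + θ * b)
  horner-* {k} {a} {b} refl = solve 4 (λ t k a b → k :* a :+ t :* (k :* b) := k :* (a :+ t :* b)) refl θ k a b

  φ-⊞ : ∀ x y → φ (x ⊞ y) ≡ φ x + φ y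
  φ-⊞ (mk a b c d e) (mk a′ b′ c′ d′ e′) = trans (φ-cong (ι-∔ a a′) (ι-∔ b b′) (ι-∔ c c′) (ι-∔ d d′) (ι-∔ e e′))
    (horner-+ (horner-+ (horner-+ (horner-+ refl))))

  φ-⊡ : ∀ k x → φ (k ⊡ x) ≡ ι k * φ x
  φ-⊡ k (mk a b c d e) = trans (φ-cong (ι-∙ k a) (ι-∙ k b) (ι-∙ k c) (ι-∙ k d) (ι-∙ k e))
    (horner-* (horner-* (horner-* (horner-* refl))))

  φ-shift : ∀ x → φ (shift x) ≡ θ * φ x
  φ-shift (mk a b c d e) = begin
    _ ≡⟨ φ-cong (ι-∙ e r₀) (trans (ι-∔ a _) (cong (ι a +_) (ι-∙ e r₁))) (trans (ι-∔ b _) (cong (ι b +_) (ι-∙ e r₂))) refl refl ⟩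
    ι e * ι r₀ + θ * ((ι a + ι e * ι r₁) + θ * ((ι b + ι e * ι r₂) + θ * (ι c + θ * ι d)))
      ≡⟨ solve 8 (λ t a b x e r₀ r₁ r₂ → e :* r₀ :+ t :* ((a :+ e :* r₁) :+ t :* ((b :+ e :* r₂) :+ t :* x))
           := e :* (r₀ :+ t :* (r₁ :+ t :* r₂)) :+ t :* (a :+ t :* (b :+ t :* x))) refl θ (ι a) (ι b) (ι c + θ * ι d) (ι e) (ι r₀) (ι r₁) (ι r₂) ⟩
    ι e * (ι r₀ + θ * (ι r₁ + θ * ι r₂)) + θ * (ι a + θ * (ι b + θ * (ι c + θ * ι d)))
      ≡⟨ cong (λ s → ι e * s + θ * (ι a + θ * (ι b + θ * (ι c + θ * ι d)))) (sym θ⁵) ⟩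
    ι e * (θ * (θ * (θ * (θ * θ)))) + θ * (ι a + θ * (ι b + θ * (ι c + θ * ι d)))
      ≡⟨ solve 6 (λ t a b c d e → e :* (t :* (t :* (t :* (t :* t)))) :+ t :* (a :+ t :* (b :+ t :* (c :+ t :* d)))
           := t :* (a :+ t :* (b :+ t :* (c :+ t :* (d :+ t :* e))))) refl θ (ι a) (ι b) (ι c) (ι d) (ι e) ⟩
    θ * φ (mk a b c d e) ∎

  φ-constant : ∀ a → φ (constant a) ≡ ι a
  φ-constant a = trans (φ-cong refl ι-𝟘 ι-𝟘 ι-𝟘 ι-𝟘)
    (solve 2 (λ t a → a :+ t :* (:0 :+ t :* (:0 :+ t :* (:0 :+ t :* :0))) := a) refl θ (ι a))

  φ-zero : φ zero′ ≡ 0#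
  φ-zero = trans (φ-constant 𝟘) ι-𝟘

  φ-one : φ one ≡ 1#
  φ-one = trans (φ-constant 𝟙) ι-𝟙

  φ-θ : φ θ′ ≡ θ
  φ-θ = trans (φ-cong ι-𝟘 ι-𝟙 ι-𝟘 ι-𝟘 ι-𝟘)
    (solve 1 (λ t → :0 :+ t :* (:1 :+ t :* (:0 :+ t :* (:0 :+ t :* :0))) := t) refl θ)

  φ-add : ∀ x y → φ (add x y) ≡ φ x + φ y
  φ-add x y = trans (φ-normalise (x ⊞ y)) (φ-⊞ x y)

  φ-sub : ∀ x y → φ (sub x y) ≡ φ x - φ y
  φ-sub x y = trans (φ-normalise (x ⊞ -𝟙 ⊡ y)) (trans (φ-⊞ x (-𝟙 ⊡ y)) (cong (φ x +_) (trans (φ-⊡ -𝟙 y)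
    (trans (cong (_* φ y) ι--𝟙) (solve 1 (λ y → (:- :1) :* y := :- y) refl (φ y))))))

  φ-mul : ∀ x y → φ (mul x y) ≡ φ x * φ y
  φ-mul (mk a b c d e) y = begin
    φ (mul (mk a b c d e) y) ≡⟨ φ-normalise (a ⊡ y ⊞ shift (b ⊡ y ⊞ shift (c ⊡ y ⊞ shift (d ⊡ y ⊞ shift (e ⊡ y))))) ⟩
    φ (a ⊡ y ⊞ shift (b ⊡ y ⊞ shift (c ⊡ y ⊞ shift (d ⊡ y ⊞ shift (e ⊡ y)))))
      ≡⟨ horner a _ (horner b _ (horner c _ (horner d _ (φ-⊡ e y)))) ⟩
    ι a * φ y + θ * (ι b * φ y + θ * (ι c * φ y + θ * (ι d * φ y + θ * (ι e * φ y))))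
      ≡⟨ horner-*ʳ (horner-*ʳ (horner-*ʳ (horner-*ʳ refl))) ⟩
    φ (mk a b c d e) * φ y ∎
    where
      horner-*ʳ : ∀ {k a b s} → s ≡ b * k → a * k + θ * s ≡ (a + θ * b) * k
      horner-*ʳ {k} {a} {b} refl = solve 4 (λ t k a b → a :* k :+ t :* (b :* k) := (a :+ t :* b) :* k) refl θ k a b
      horner : ∀ k z {v} → φ z ≡ v → φ (k ⊡ y ⊞ shift z) ≡ ι k * φ y + θ * v
      horner k z {v} e = trans (φ-⊞ (k ⊡ y) (shift z)) (cong₂ _+_ (φ-⊡ k y) (trans (φ-shift z) (cong (θ *_) e)))

  eqK-sound : ∀ x y → eqK x y ≡ true → x ≡ y
  eqK-sound (mk a b c d e) (mk a′ b′ c′ d′ e′) p =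
    let (pa , p₁) = ∧-elim {eq a a′} p
        (pb , p₂) = ∧-elim {eq b b′} p₁
        (pc , p₃) = ∧-elim {eq c c′} p₂
        (pd , pe) = ∧-elim {eq d d′} p₃
    in mk-cong (eq-sound pa) (eq-sound pb) (eq-sound pc) (eq-sound pd) (eq-sound pe)
    where
      mk-cong : ∀ {a b c d e a′ b′ c′ d′ e′ : D} → a ≡ a′ → b ≡ b′ → c ≡ c′ → d ≡ d′ → e ≡ e′ → mk a b c d e ≡ mk a′ b′ c′ d′ e′
      mk-cong refl refl refl refl refl = refl

  infix 4 _↦_
  _↦_ : 𝕂 → Carrier → Set
  x ↦ X = φ x ≡ X

  add↦ : ∀ {x y X Y} → x ↦ X → y ↦ Y → add x y ↦ X + Y
  add↦ {x} {y} p r = trans (φ-add x y) (cong₂ _+_ p r)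

  sub↦ : ∀ {x y X Y} → x ↦ X → y ↦ Y → sub x y ↦ X - Y
  sub↦ {x} {y} p r = trans (φ-sub x y) (cong₂ _-_ p r)

  mul↦ : ∀ {x y X Y} → x ↦ X → y ↦ Y → mul x y ↦ X * Y
  mul↦ {x} {y} p r = trans (φ-mul x y) (cong₂ _*_ p r)

  equal : ∀ {x y X Y} → eqK x y ≡ true → x ↦ X → y ↦ Y → X ≡ Y
  equal {x} {y} e p r = trans (sym p) (trans (cong φ (eqK-sound x y e)) r)

  nonzero-sound : ∀ {x X} → nonzero x ≡ true → x ↦ X → X ≢ 0#
  nonzero-sound {x} {X} e p = factor-nonzeroˡ (equal {mul x (C.invert x)} {one} e (mul↦ {x} {C.invert x} p refl) φ-one) 1≢0

  power↦ : ∀ k {x X} → x ↦ X → C.power k x ↦ _^ᶠ_ F X k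
  power↦ zero p = φ-one
  power↦ (suc k) {x} p = mul↦ {x} {C.power k x} p (power↦ k p)

  frobenius-images : (t₁ ↦ T θ) × (t₂ ↦ T θ * T θ) × (t₃ ↦ T θ * (T θ * T θ)) × (t₄ ↦ T θ * (T θ * (T θ * T θ)))
  frobenius-images =
    let (p₁ , rest) = ∧-elim {eqK (C.power q θ′) t₁} Computed.images
        (p₂ , rest′) = ∧-elim {eqK (mul t₁ t₁) t₂} rest
        (p₃ , p₄) = ∧-elim {eqK (mul t₁ t₂) t₃} rest′
        i₁ : t₁ ↦ T θ
        i₁ = sym (equal {C.power q θ′} {t₁} p₁ (trans (power↦ q φ-θ) (sym (T-power θ))) refl)
        i₂ : t₂ ↦ T θ * T θ
        i₂ = sym (equal {mul t₁ t₁} {t₂} p₂ (mul↦ {t₁} {t₁} i₁ i₁) refl)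
        i₃ : t₃ ↦ T θ * (T θ * T θ)
        i₃ = sym (equal {mul t₁ t₂} {t₃} p₃ (mul↦ {t₁} {t₂} i₁ i₂) refl)
        i₄ : t₄ ↦ T θ * (T θ * (T θ * T θ))
        i₄ = sym (equal {mul t₁ t₃} {t₄} p₄ (mul↦ {t₁} {t₃} i₁ i₃) refl)
    in i₁ , i₂ , i₃ , i₄

  φ-T : ∀ x → φ (C.T x) ≡ T (φ x)
  φ-T x@(mk a b c d e) = begin
    φ (C.T x) ≡⟨ φ-normalise (constant a ⊞ (b ⊡ t₁ ⊞ (c ⊡ t₂ ⊞ (d ⊡ t₃ ⊞ e ⊡ t₄)))) ⟩
    φ (constant a ⊞ (b ⊡ t₁ ⊞ (c ⊡ t₂ ⊞ (d ⊡ t₃ ⊞ e ⊡ t₄))))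
      ≡⟨ trans (φ-⊞ (constant a) s₁) (cong₂ _+_ (φ-constant a) (trans (φ-⊞ (b ⊡ t₁) s₂) (cong₂ _+_ (scaled b t₁ i₁)
           (trans (φ-⊞ (c ⊡ t₂) s₃) (cong₂ _+_ (scaled c t₂ i₂) (trans (φ-⊞ (d ⊡ t₃) (e ⊡ t₄)) (cong₂ _+_ (scaled d t₃ i₃) (scaled e t₄ i₄)))))))) ⟩
    ι a + (ι b * T θ + (ι c * (T θ * T θ) + (ι d * (T θ * (T θ * T θ)) + ι e * (T θ * (T θ * (T θ * T θ))))))
      ≡⟨ solve 6 (λ t a b c d e → a :+ (b :* t :+ (c :* (t :* t) :+ (d :* (t :* (t :* t)) :+ e :* (t :* (t :* (t :* t))))))
           := a :+ t :* (b :+ t :* (c :+ t :* (d :+ t :* e)))) refl (T θ) (ι a) (ι b) (ι c) (ι d) (ι e) ⟩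
    ι a + T θ * (ι b + T θ * (ι c + T θ * (ι d + T θ * ι e)))
      ≡⟨ sym (image a (image b (image c (image d (ι-fixed e))))) ⟩
    T (φ x) ∎
    where
      i₁ = proj₁ frobenius-images
      i₂ = proj₁ (proj₂ frobenius-images)
      i₃ = proj₁ (proj₂ (proj₂ frobenius-images))
      i₄ = proj₂ (proj₂ (proj₂ frobenius-images))
      s₃ = d ⊡ t₃ ⊞ e ⊡ t₄
      s₂ = c ⊡ t₂ ⊞ s₃
      s₁ = b ⊡ t₁ ⊞ s₂
      scaled : ∀ k t {X} → t ↦ X → k ⊡ t ↦ ι k * X
      scaled k t p = trans (φ-⊡ k t) (cong (ι k *_) p)
      image : ∀ k {s s′} → T s ≡ s′ → T (ι k + θ * s) ≡ ι k + T θ * s′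
      image k p = trans (T-+ _ _) (cong₂ _+_ (ι-fixed k) (trans (T-* _ _) (cong (T θ *_) p)))

  T↦ : ∀ {x X} → x ↦ X → C.T x ↦ T X
  T↦ {x} p = trans (φ-T x) (cong T p)

  T⁴↦ : ∀ {x X} → x ↦ X → C.T⁴ x ↦ T⁴ X
  T⁴↦ {x} p = T↦ {C.T³ x} (T↦ {C.T² x} (T↦ {C.T x} (T↦ {x} p)))

  trace↦ : ∀ {x X} → x ↦ X → C.trace x ↦ Tr X
  trace↦ {x} p = add↦ {x} p (add↦ {C.T x} p₁ (add↦ {C.T² x} p₂ (add↦ {C.T³ x} {C.T⁴ x} p₃ (T↦ {C.T³ x} p₃))))
    where
      p₁ = T↦ {x} p
      p₂ = T↦ {C.T x} p₁
      p₃ = T↦ {C.T² x} p₂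

  norm↦ : ∀ {x X} → x ↦ X → C.normK x ↦ N X
  norm↦ {x} p = mul↦ {x} p (mul↦ {C.T x} p₁ (mul↦ {C.T² x} p₂ (mul↦ {C.T³ x} {C.T⁴ x} p₃ (T↦ {C.T³ x} p₃))))
    where
      p₁ = T↦ {x} p
      p₂ = T↦ {C.T x} p₁
      p₃ = T↦ {C.T² x} p₂

  normalised : ∀ x → Enumerated (normalise x)
  normalised (mk a b c d e) = norm∈digits a , norm∈digits b , norm∈digits c , norm∈digits d , norm∈digits e

  φ-zero⇒zero : ∀ {x} → Enumerated x → φ x ≡ 0# → x ≡ zero′
  φ-zero⇒zero {x} x∈ φx≡0 with Computed.inverses x x∈
  ... | inj₁ e = eqK-sound x zero′ e
  ... | inj₂ e = ⊥-elim (nonzero-sound {x} e refl φx≡0)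

  element-digit : Fin q → D
  element-digit i = List.lookup digits (Fin.cast (sym digits-count) i)

  element-digit∈ : ∀ i → element-digit i ∈ digits
  element-digit∈ i = ∈-lookup {xs = digits} (Fin.cast (sym digits-count) i)

  element-digit-apart : ∀ i j → norm (element-digit i ∔ -𝟙 ∙ element-digit j) ≡ 𝟘 → i ≡ j
  element-digit-apart i j e = cast-injective (sym digits-count) (digits-apart _ _ e)

  digit-index : ∀ {a} → a ∈ digits → ∃[ i ] element-digit i ≡ a
  digit-index a∈ = Fin.cast digits-count (Any.index a∈) , trans (cong (List.lookup digits) (Finₚ.cast-involutive (sym digits-count) digits-count (Any.index a∈)))
    (sym (lookup-index a∈))

  tuple : (Fin 5 → Fin q) → 𝕂
  tuple f = mk (d zero) (d (suc zero)) (d (suc (suc zero))) (d (suc (suc (suc zero)))) (d (suc (suc (suc (suc zero)))))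
    where
      d : Fin 5 → D
      d i = element-digit (f i)

  tuple∈ : ∀ f → Enumerated (tuple f)
  tuple∈ f = element-digit∈ _ , element-digit∈ _ , element-digit∈ _ , element-digit∈ _ , element-digit∈ _

  mk-injective : ∀ {a b c d e a′ b′ c′ d′ e′ : D} → mk a b c d e ≡ mk a′ b′ c′ d′ e′ →
    a ≡ a′ × b ≡ b′ × c ≡ c′ × d ≡ d′ × e ≡ e′
  mk-injective refl = refl , refl , refl , refl , refl

  φ-injective : ∀ x y → φ x ≡ φ y → sub x y ≡ zero′
  φ-injective x y e = φ-zero⇒zero {sub x y} (normalised (x ⊞ -𝟙 ⊡ y)) (trans (φ-sub x y) (difference-zero e))

  φ-tuple-injective : ∀ f g → φ (tuple f) ≡ φ (tuple g) → ∀ i → f i ≡ g i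
  φ-tuple-injective f g e = pointwise
    where
      apart : Fin 5 → Set
      apart i = norm (element-digit (f i) ∔ -𝟙 ∙ element-digit (g i)) ≡ 𝟘
      components : apart zero × apart (suc zero) × apart (suc (suc zero)) × apart (suc (suc (suc zero))) × apart (suc (suc (suc (suc zero))))
      components = mk-injective (φ-injective (tuple f) (tuple g) e)
      conclude : ∀ i → apart i → f i ≡ g i
      conclude i = element-digit-apart (f i) (g i)
      pointwise : ∀ i → f i ≡ g i
      pointwise zero = conclude zero (proj₁ components)
      pointwise (suc zero) = conclude (suc zero) (proj₁ (proj₂ components))
      pointwise (suc (suc zero)) = conclude (suc (suc zero)) (proj₁ (proj₂ (proj₂ components)))
      pointwise (suc (suc (suc zero))) = conclude (suc (suc (suc zero))) (proj₁ (proj₂ (proj₂ (proj₂ components))))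
      pointwise (suc (suc (suc (suc zero)))) = conclude (suc (suc (suc (suc zero)))) (proj₂ (proj₂ (proj₂ (proj₂ components))))

  -- Every nonzero tuple has a computed inverse, so `φ` kills none of them; hence distinct tuples of
  -- digits have distinct values, and the q⁵ of them exhaust F. The inverses thus take the place of
  -- a proof that the quintic is irreducible.
  φ-surjective : ∀ x → ∃[ k ] (Enumerated k × φ k ≡ x)
  φ-surjective x =
    let (i , e) = injective⇒surjective position position-injective (index x)
    in tuple (finToFun {q} {5} i) , tuple∈ (finToFun {q} {5} i) , index-injective e
    where
      position : Fin (q ℕ.^ 5) → Fin (q ℕ.^ 5)
      position i = index (φ (tuple (finToFun {q} {5} i)))
      position-injective : ∀ {i j} → position i ≡ position j → i ≡ j
      position-injective {i} {j} e = finToFun-injective {q} {5} (φ-tuple-injective (finToFun {q} {5} i) (finToFun {q} {5} j) (index-injective e))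

  cover : (P : Carrier → Set) → (∀ k → Enumerated k → P (φ k)) → ∀ x → P x
  cover P sound x = let (k , k∈ , e) = φ-surjective x in subst P e (sound k k∈)

  -- Since T⁵ = 1, going back by T is the same as going forward four times.
  T-invariant⁻¹ : (P : Carrier → Set) → (∀ x → P x → P (T x)) → ∀ x → P (T x) → P x
  T-invariant⁻¹ P invariant x p = subst P (T⁵-identity x)
    (invariant (T⁴ x) (invariant (T³ x) (invariant (T² x) (invariant (T x) p))))

  -- Only the conjugate of smallest index has to be checked.
  orbit-cover : (P : Carrier → Set) → (∀ x → P x → P (T x)) →
    (∀ k → Enumerated k → C.hasSmallerConjugate k ≡ true ⊎ P (φ k)) → ∀ x → P x
  orbit-cover P invariant sound x =
    let (k , k∈ , e) = φ-surjective x in subst P e (descend k k∈ (<-wellFounded (C.index k)))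
    where
      T-enumerated : ∀ k → Enumerated (C.T k)
      T-enumerated (mk a b c d e) = normalised (constant a ⊞ (b ⊡ t₁ ⊞ (c ⊡ t₂ ⊞ (d ⊡ t₃ ⊞ e ⊡ t₄))))

      smaller-conjugate : ∀ n {i} k → Enumerated k → C.smallerFrom n i k ≡ true →
        (∀ l → Enumerated l → C.index l ℕ.< i → P (φ l)) → P (φ k)
      smaller-conjugate (suc n) {i} k k∈ e smaller with ∨-elim {C.index k ℕ.<ᵇ i} e
      ... | inj₁ k<i = smaller k k∈ (ℕₚ.<ᵇ⇒< (C.index k) i (subst IsTrue (sym k<i) _))
        where
          IsTrue : Bool → Set
          IsTrue b = Data.Bool.T b
      ... | inj₂ rest = T-invariant⁻¹ P invariant (φ k) (subst P (φ-T k) (smaller-conjugate n (C.T k) (T-enumerated k) rest smaller))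

      descend : ∀ k → Enumerated k → Acc ℕ._<_ (C.index k) → P (φ k)
      descend k k∈ (acc rec) with sound k k∈
      ... | inj₁ smaller = T-invariant⁻¹ P invariant (φ k) (subst P (φ-T k)
              (smaller-conjugate 4 (C.T k) (T-enumerated k) smaller (λ l l∈ l<k → descend l l∈ (rec l<k))))
      ... | inj₂ good = good

  fixed-digit : ∀ c → Fixed c → ∃[ a ] (a ∈ digits × ι a ≡ c)
  fixed-digit = cover (λ c → Fixed c → ∃[ a ] (a ∈ digits × ι a ≡ c)) (λ k k∈ → sound k k∈ (Computed.fixed k k∈))
    where
      sound : ∀ k → Enumerated k → C.isConstant k ≡ true ⊎ C.moves k ≡ true → Fixed (φ k) → ∃[ a ] (a ∈ digits × ι a ≡ φ k)
      sound k@(mk a _ _ _ _) (a∈ , _) (inj₁ isConstant) fixed =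
        a , a∈ , trans (sym (φ-constant a)) (sym (cong φ (eqK-sound k (constant a) isConstant)))
      sound k _ (inj₂ moved) fixed = ⊥-elim (nonzero-sound {sub (C.T k) k} moved (sub↦ {C.T k} {k} (φ-T k) refl) (difference-zero fixed))

  digits-of-Fq : Digits frobenius q (length units)
  digits-of-Fq = record
    { T-power = T-power
    ; digit = λ i → ι (element-digit i)
    ; digit-fixed = λ i → ι-fixed (element-digit i)
    ; digit-injective = λ {i} {j} → digit-injective i j
    ; digit-surjective = λ {c} c-fixed → let (a , a∈ , e) = fixed-digit c c-fixed
                                             (i , e′) = digit-index a∈
                                         in i , trans (cong ι e′) e
    ; unit = λ i → ι (List.lookup units i)
    ; unit-fixed = λ i → ι-fixed (List.lookup units i)
    ; unit-injective = λ {i} {j} e → Finₚ.suc-injective (ι-injective (suc i) (suc j) e)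
    ; unit≢0 = λ i e → Finₚ.0≢1+n (ι-injective zero (suc i) (trans ι-𝟘 (sym e)))
    }
    where
      ι-injective : ∀ i j → ι (List.lookup digits i) ≡ ι (List.lookup digits j) → i ≡ j
      ι-injective i j e = digits-apart i j (proj₁ (mk-injective (φ-zero⇒zero
        (normalised (constant (List.lookup digits i) ⊞ -𝟙 ⊡ constant (List.lookup digits j)))
        (trans (φ-sub (constant (List.lookup digits i)) (constant (List.lookup digits j)))
          (difference-zero (trans (φ-constant _) (trans e (sym (φ-constant _)))))))))
      digit-injective : ∀ i j → ι (element-digit i) ≡ ι (element-digit j) → i ≡ j
      digit-injective i j e = cast-injective (sym digits-count) (ι-injective _ _ e)

  -- Invariance of collisions and exceptions under T

  T-product₃ : ∀ x y z → T (x * (y * z)) ≡ T x * (T y * T z)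
  T-product₃ x y z = trans (T-* x _) (cong (T x *_) (T-* y z))

  T-product₄ : ∀ w x y z → T (w * (x * (y * z))) ≡ T w * (T x * (T y * T z))
  T-product₄ w x y z = trans (T-* w _) (cong (T w *_) (T-product₃ x y z))

  TraceCollision-T : ∀ {t e} → TraceCollision t e → TraceCollision t (T e)
  TraceCollision-T {t} {e} (y , z , z≢0 , Trz≡0 , Try≡t , ez≡) =
    T y , T z , T-nonzero z≢0 , trans (Tr-T z) Trz≡0 , trans (Tr-T y) Try≡t , (begin
      T e * T z ≡⟨ sym (T-* e z) ⟩
      T (e * z) ≡⟨ cong T ez≡ ⟩
      T (y * T z - z * T y) ≡⟨ trans (T-+ _ _) (cong₂ _+_ (T-* y (T z)) (trans (T-neg _) (cong -_ (T-* z (T y))))) ⟩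
      T y * T² z - T z * T² y ∎)

  TraceException-T : ∀ {e δ} → TraceException e δ → TraceException (T e) δ
  TraceException-T {e} {δ} (δ-fixed , Nδ≢1 , p , r) = δ-fixed , Nδ≢1 , p , (begin
    T e * (1# + (δ + δ)) + δ ≡⟨ sym (cong₂ (λ s d → T e * s + d) (Fixed-+ T-1 (Fixed-+ δ-fixed δ-fixed)) δ-fixed) ⟩
    T e * T (1# + (δ + δ)) + T δ ≡⟨ sym (trans (T-+ _ _) (cong (_+ T δ) (T-* _ _))) ⟩
    T (e * (1# + (δ + δ)) + δ) ≡⟨ trans (cong T r) T-0 ⟩
    0# ∎)

  -- Because c lies in Fq, T acts on the pair (c, a) through a alone. This is what permits one a per
  -- Galois orbit for each fixed c.
  BinomialCollision-T : ∀ {c a} → Fixed c → BinomialCollision c a → BinomialCollision c (T a)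
  BinomialCollision-T {c} {a} c-fixed (y , z , y≢0 , z≢0 , Trz≡0 , e) =
    T y , T z , T-nonzero y≢0 , T-nonzero z≢0 , trans (Tr-T z) Trz≡0 , (begin
      T a * (T y * (T (T⁴ y) * T z)) + c * (T y * (T² y * T² z))
        ≡⟨ sym (trans (T-+ _ _) (cong₂ _+_ (T-product₄ a y (T⁴ y) z)
             (trans (T-product₄ c y (T y) (T z)) (cong (_* (T y * (T² y * T² z))) c-fixed)))) ⟩
      T (a * (y * (T⁴ y * z)) + c * (y * (T y * T z))) ≡⟨ cong T e ⟩
      T (T y * (T⁴ y * (z + T z))) ≡⟨ trans (T-product₃ (T y) (T⁴ y) (z + T z)) (cong (λ s → T² y * (T (T⁴ y) * s)) (T-+ z (T z))) ⟩
      T² y * (T (T⁴ y) * (T z + T² z)) ∎)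

  BinomialException-T : ∀ {c a δ} → Fixed c → BinomialException c a δ → BinomialException c (T a) δ
  BinomialException-T {c} {a} {δ} c-fixed (δ-fixed , δ≢0 , Nδ≢1 , p , r) = δ-fixed , δ≢0 , Nδ≢1 ,
    (begin
      c + δ * δ * T a ≡⟨ sym (cong₂ (λ s d → s + d * T a) c-fixed (Fixed-* δ-fixed δ-fixed)) ⟩
      T c + T (δ * δ) * T a ≡⟨ sym (trans (T-+ _ _) (cong (T c +_) (T-* _ a))) ⟩
      T (c + δ * δ * a) ≡⟨ trans (cong T p) δ-fixed ⟩
      δ ∎) ,
    (begin
      T a + δ * δ * δ * c ≡⟨ cong (T a +_) (sym (Fixed-* (Fixed-* (Fixed-* δ-fixed δ-fixed) δ-fixed) c-fixed)) ⟩
      T a + T (δ * δ * δ * c) ≡⟨ sym (T-+ a _) ⟩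
      T (a + δ * δ * δ * c) ≡⟨ trans (cong T r) T-0 ⟩
      0# ∎)

  verify-trace-sound : ∀ {t e y z X} → constant t ↦ X → C.verify-trace t e (y , z) ≡ true → TraceCollision X (φ e)
  verify-trace-sound {t} {e} {y} {z} t↦ p =
    let (p₁ , p₂) = ∧-elim {nonzero z ∧ C.isZero (C.trace z)} p
        (nz , tz) = ∧-elim {nonzero z} p₁
        (ty , eq) = ∧-elim {eqK (C.trace y) (constant t)} p₂
    in φ y , φ z , nonzero-sound {z} nz refl
     , equal {C.trace z} {zero′} tz (trace↦ {z} refl) φ-zero
     , equal {C.trace y} {constant t} ty (trace↦ {y} refl) t↦
     , equal {mul e z} {sub (mul y (C.T z)) (mul z (C.T y))} eq (mul↦ {e} {z} refl refl)
         (sub↦ {mul y (C.T z)} {mul z (C.T y)} (mul↦ {y} {C.T z} refl (φ-T z)) (mul↦ {z} {C.T y} refl (φ-T y)))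

  constant-fixed : ∀ d → Fixed (φ (constant d))
  constant-fixed d = trans (cong T (φ-constant d)) (trans (ι-fixed d) (sym (φ-constant d)))

  norm≢1-sound : ∀ {δ} → C.normNotOne δ ≡ true → N (φ δ) ≢ 1#
  norm≢1-sound {δ} p e = nonzero-sound {sub (C.normK δ) one} p (sub↦ {C.normK δ} {one} (norm↦ {δ} refl) φ-one) (difference-zero e)

  verify-trace-exception-sound : ∀ {e d} → C.verify-trace-exception e d ≡ true → TraceException (φ e) (φ (constant d))
  verify-trace-exception-sound {e} {d} p =
    let δ = constant d
        (nn , rest) = ∧-elim {C.normNotOne δ} p
        (p₁ , p₂) = ∧-elim {eqK (add (mul δ δ) one) δ} rest
    in constant-fixed d , norm≢1-sound {δ} nn
     , equal {add (mul δ δ) one} {δ} p₁ (add↦ {mul δ δ} {one} (mul↦ {δ} {δ} refl refl) φ-one) refl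
     , equal {add (mul e (add one (add δ δ))) δ} {zero′} p₂
         (add↦ {mul e (add one (add δ δ))} {δ} (mul↦ {e} {add one (add δ δ)} refl (add↦ {one} {add δ δ} φ-one (add↦ {δ} {δ} refl refl))) refl) φ-zero

  verify-binomial-sound : ∀ {c a y z} → C.verify-binomial c a (y , z) ≡ true → BinomialCollision (φ c) (φ a)
  verify-binomial-sound {c} {a} {y} {z} p =
    let (p₁ , p₂) = ∧-elim {nonzero y ∧ nonzero z} p
        (ny , nz) = ∧-elim {nonzero y} p₁
        (tz , eq) = ∧-elim {C.isZero (C.trace z)} p₂
        y₁ = C.T y
        y₄ = C.T⁴ y
        z₁ = C.T z
        y₄↦ = T⁴↦ {y} refl
    in φ y , φ z , nonzero-sound {y} ny refl , nonzero-sound {z} nz refl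
     , equal {C.trace z} {zero′} tz (trace↦ {z} refl) φ-zero
     , equal {add (mul a (mul y (mul y₄ z))) (mul c (mul y (mul y₁ z₁)))} {mul y₁ (mul y₄ (add z z₁))} eq
         (add↦ {mul a (mul y (mul y₄ z))} {mul c (mul y (mul y₁ z₁))}
           (mul↦ {a} {mul y (mul y₄ z)} refl (mul↦ {y} {mul y₄ z} refl (mul↦ {y₄} {z} y₄↦ refl)))
           (mul↦ {c} {mul y (mul y₁ z₁)} refl (mul↦ {y} {mul y₁ z₁} refl (mul↦ {y₁} {z₁} (φ-T y) (φ-T z)))))
         (mul↦ {y₁} {mul y₄ (add z z₁)} (φ-T y) (mul↦ {y₄} {add z z₁} y₄↦ (add↦ {z} {z₁} refl (φ-T z))))

  verify-binomial-exception-sound : ∀ {c a d} → C.verify-binomial-exception c a d ≡ true → BinomialException (φ c) (φ a) (φ (constant d))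
  verify-binomial-exception-sound {c} {a} {d} p =
    let δ = constant d
        δ² = mul δ δ
        δ²↦ = mul↦ {δ} {δ} refl refl
        (p₁ , p₂) = ∧-elim {nonzero δ ∧ C.normNotOne δ} p
        (nδ , nn) = ∧-elim {nonzero δ} p₁
        (e₁ , e₂) = ∧-elim {eqK (add c (mul δ² a)) δ} p₂
    in constant-fixed d , nonzero-sound {δ} nδ refl , norm≢1-sound {δ} nn
     , equal {add c (mul δ² a)} {δ} e₁ (add↦ {c} {mul δ² a} refl (mul↦ {δ²} {a} δ²↦ refl)) refl
     , equal {add a (mul (mul δ² δ) c)} {zero′} e₂
         (add↦ {a} {mul (mul δ² δ) c} refl (mul↦ {mul δ² δ} {c} (mul↦ {δ²} {δ} δ²↦ refl) refl)) φ-zero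

  isZero-sound : ∀ {x} → C.isZero x ≡ true → φ x ≡ 0#
  isZero-sound {x} p = equal {x} {zero′} p refl φ-zero

  moves-sound : ∀ {x} → C.moves x ≡ true → T (φ x) ≢ φ x
  moves-sound {x} p e = nonzero-sound {sub (C.T x) x} p (sub↦ {C.T x} {x} (φ-T x) refl) (difference-zero e)

  binomial-cases : ∀ c a → Fixed c →
    BinomialCollision c a ⊎ (c ≡ 0# × a ≡ 0#) ⊎ a * c ≡ 1# ⊎ ∃ (BinomialException c a)
  binomial-cases c a c-fixed = for-digit (fixed-digit c c-fixed)
    where
      P : Carrier → Carrier → Set
      P c a = BinomialCollision c a ⊎ (c ≡ 0# × a ≡ 0#) ⊎ a * c ≡ 1# ⊎ ∃ (BinomialException c a)
      invariant : ∀ a → P c a → P c (T a)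
      invariant a (inj₁ collision) = inj₁ (BinomialCollision-T c-fixed collision)
      invariant a (inj₂ (inj₁ (c≡0 , a≡0))) = inj₂ (inj₁ (c≡0 , trans (cong T a≡0) T-0))
      invariant a (inj₂ (inj₂ (inj₁ ac≡1))) = inj₂ (inj₂ (inj₁
        (trans (cong (T a *_) (sym c-fixed)) (trans (sym (T-* a c)) (trans (cong T ac≡1) T-1)))))
      invariant a (inj₂ (inj₂ (inj₂ (δ , exception)))) = inj₂ (inj₂ (inj₂ (δ , BinomialException-T c-fixed exception)))
      for-digit : ∃[ d ] (d ∈ digits × ι d ≡ c) → P c a
      for-digit (d , d∈ , ιd≡c) = orbit-cover (P c) invariant
          (λ k k∈ → map₂ (λ o → subst (λ c → P c (φ k)) (trans (φ-constant d) ιd≡c) (sound k o)) (Computed.binomials d∈ k k∈)) a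
        where
          sound : ∀ k → (∃[ yz ] C.verify-binomial (constant d) k yz ≡ true) ⊎ C.bothZero (constant d) k ≡ true
            ⊎ C.inverseTo (constant d) k ≡ true ⊎ (∃[ δ ] C.verify-binomial-exception (constant d) k δ ≡ true) → P (φ (constant d)) (φ k)
          sound k (inj₁ ((y , z) , p)) = inj₁ (verify-binomial-sound {constant d} {k} {y} {z} p)
          sound k (inj₂ (inj₁ p)) = let (p₁ , p₂) = ∧-elim {C.isZero (constant d)} p in
            inj₂ (inj₁ (isZero-sound {constant d} p₁ , isZero-sound {k} p₂))
          sound k (inj₂ (inj₂ (inj₁ p))) = inj₂ (inj₂ (inj₁ (equal {mul k (constant d)} {one} p (mul↦ {k} {constant d} refl refl) φ-one)))
          sound k (inj₂ (inj₂ (inj₂ (δ , p)))) = inj₂ (inj₂ (inj₂ (_ , verify-binomial-exception-sound {constant d} {k} {δ} p)))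

  trace-zero-cases : ∀ e → e ≡ 0# ⊎ TraceCollision 0# e
  trace-zero-cases = orbit-cover (λ e → e ≡ 0# ⊎ TraceCollision 0# e)
    (λ e → Data.Sum.map (λ e≡0 → trans (cong T e≡0) T-0) TraceCollision-T)
    (λ k k∈ → map₂ (Data.Sum.map (isZero-sound {k}) (λ ((y , z) , p) → verify-trace-sound {𝟘} {k} {y} {z} φ-zero p)) (Computed.trace-zeros k k∈))

  trace-one-cases : ∀ e → TraceCollision 1# e ⊎ e ≡ 0# ⊎ ∃ (TraceException e)
  trace-one-cases = orbit-cover (λ e → TraceCollision 1# e ⊎ e ≡ 0# ⊎ ∃ (TraceException e))
    (λ e → Data.Sum.map TraceCollision-T (Data.Sum.map (λ e≡0 → trans (cong T e≡0) T-0) (λ (δ , p) → δ , TraceException-T p)))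
    (λ k k∈ → map₂ (Data.Sum.map (λ ((y , z) , p) → verify-trace-sound {𝟙} {k} {y} {z} φ-one p)
      (Data.Sum.map (isZero-sound {k}) (λ (d , p) → _ , verify-trace-exception-sound {k} {d} p))) (Computed.trace-one-collisions k k∈))

  hilbert90-cases : ∀ κ → ∃[ l ] ∃[ c ] (l ≢ 0# × Fixed c × κ * T l ≡ c * l)
  hilbert90-cases = cover (λ κ → ∃[ l ] ∃[ c ] (l ≢ 0# × Fixed c × κ * T l ≡ c * l)) (λ k k∈ → sound k (Computed.hilbert k k∈))
    where
      sound : ∀ k → ∃[ cl ] C.verify-hilbert k cl ≡ true → ∃[ l ] ∃[ c ] (l ≢ 0# × Fixed c × φ k * T l ≡ c * l)
      sound k ((c , l) , p) = let (e , nl) = ∧-elim {eqK (mul k (C.T l)) (mul (constant c) l)} p in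
        φ l , φ (constant c) , nonzero-sound {l} nl refl , constant-fixed c
        , equal {mul k (C.T l)} {mul (constant c) l} e (mul↦ {k} {C.T l} refl (φ-T l)) (mul↦ {constant c} {l} refl refl)

  norm-one-cases : ∀ δ → N δ ≡ 1# → ∃[ l ] (l ≢ 0# × δ * T⁴ l ≡ T l)
  norm-one-cases = cover (λ δ → N δ ≡ 1# → ∃[ l ] (l ≢ 0# × δ * T⁴ l ≡ T l)) (λ k k∈ → sound k (Computed.norm-ones k k∈))
    where
      sound : ∀ k → C.normNotOne k ≡ true ⊎ (∃[ l ] C.verify-norm-one k l ≡ true) → N (φ k) ≡ 1# → ∃[ l ] (l ≢ 0# × φ k * T⁴ l ≡ T l)
      sound k (inj₁ p) N≡1 = ⊥-elim (norm≢1-sound {k} p N≡1)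
      sound k (inj₂ (l , p)) _ = let (e , nl) = ∧-elim {eqK (mul k (C.T⁴ l)) (C.T l)} p in
        φ l , nonzero-sound {l} nl refl , equal {mul k (C.T⁴ l)} {C.T l} e (mul↦ {k} {C.T⁴ l} refl (T⁴↦ {l} refl)) (φ-T l)

  T+T⁴-case : ∃[ y ] ∃[ t ] (y ≢ 0# × T t ≢ t × t * (T y + T⁴ y) ≡ T (t * y) + T⁴ (t * y))
  T+T⁴-case =
    let ((y , t) , p) = Computed.T+T⁴
        (p₁ , e) = ∧-elim {nonzero y ∧ C.moves t} p
        (ny , mt) = ∧-elim {nonzero y} p₁
        ty = mul t y
        ty↦ = mul↦ {t} {y} refl refl
    in φ y , φ t , nonzero-sound {y} ny refl , moves-sound {t} mt
     , equal {mul t (add (C.T y) (C.T⁴ y))} {add (C.T ty) (C.T⁴ ty)} e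
         (mul↦ {t} {add (C.T y) (C.T⁴ y)} refl (add↦ {C.T y} {C.T⁴ y} (φ-T y) (T⁴↦ {y} refl)))
         (add↦ {C.T ty} {C.T⁴ ty} (T↦ {ty} ty↦) (T⁴↦ {ty} ty↦))

  arithmetic : Arithmetic
  arithmetic = record
    { moved = let (y , t , _ , t-moved , _) = T+T⁴-case in t , t-moved
    ; trace-one = let (x , p) = Computed.trace-ones in φ x , equal {C.trace x} {one} p (trace↦ {x} refl) φ-one
    ; hilbert90 = hilbert90-cases
    ; norm-one = norm-one-cases
    ; T+T⁴-collision = T+T⁴-case
    ; trace-zero-collision = trace-zero-cases
    ; trace-one-collision = trace-one-cases
    ; binomial-collision = binomial-cases
    }

-- The fields of order q⁵ for q = 2, 3, 4, 5

-- 2F and 3F stand for ω and 1 + ω, where ω² = 1 + ω.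
infixl 6 _+₄_
_+₄_ : Fin 4 → Fin 4 → Fin 4
0F +₄ b = b
a +₄ 0F = a
1F +₄ 1F = 0F
1F +₄ 2F = 3F
1F +₄ 3F = 2F
2F +₄ 1F = 3F
2F +₄ 2F = 0F
2F +₄ 3F = 1F
3F +₄ 1F = 2F
3F +₄ 2F = 1F
3F +₄ 3F = 0F

infixl 7 _*₄_
_*₄_ : Fin 4 → Fin 4 → Fin 4
0F *₄ b = 0F
1F *₄ b = b
2F *₄ 0F = 0F
2F *₄ 1F = 2F
2F *₄ 2F = 3F
2F *₄ 3F = 1F
3F *₄ 0F = 0F
3F *₄ 1F = 3F
3F *₄ 2F = 1F
3F *₄ 3F = 2F

coordinates : Fin 4 → ℕ × ℕ
coordinates 0F = (0 , 0)
coordinates 1F = (1 , 0)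
coordinates 2F = (0 , 1)
coordinates 3F = (1 , 1)

-- The quintics are X⁵ + X² + 1 for q = 2, irreducible also over F₄ because 5 is odd, X⁵ - X - 2 for
-- q = 3, and the Artin-Schreier polynomial X⁵ - X - 1 for q = 5, where Tθ = θ + 1 and the tᵢ are
-- its powers. On Fq*, `reciprocal` is a ↦ a^(q-2) and `fifth-root` inverts a ↦ a⁵, which is the
-- norm there.
model₂ model₃ model₄ model₅ : Model
model₂ = record
  { D = ℕ ; _∔_ = ℕ._+_ ; _∙_ = ℕ._*_ ; norm = λ a → a % 2 ; reciprocal = λ a → a ; fifth-root = λ a → a
  ; 𝟘 = 0 ; 𝟙 = 1 ; -𝟙 = 1 ; eq = _≡ᵇ_ ; code = λ a → a ; q = 2 ; units = 1 ∷ []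
  ; r₀ = 1 ; r₁ = 0 ; r₂ = 1
  ; t₁ = mk 0 0 1 0 0 ; t₂ = mk 0 0 0 0 1 ; t₃ = mk 0 1 0 1 0 ; t₄ = mk 1 0 1 1 0 }
model₃ = record
  { D = ℕ ; _∔_ = ℕ._+_ ; _∙_ = ℕ._*_ ; norm = λ a → a % 3 ; reciprocal = λ a → a ; fifth-root = λ a → a
  ; 𝟘 = 0 ; 𝟙 = 1 ; -𝟙 = 2 ; eq = _≡ᵇ_ ; code = λ a → a ; q = 3 ; units = 1 ∷ 2 ∷ []
  ; r₀ = 2 ; r₁ = 1 ; r₂ = 0
  ; t₁ = mk 0 0 0 1 0 ; t₂ = mk 0 2 1 0 0 ; t₃ = mk 2 1 0 0 2 ; t₄ = mk 0 0 1 1 1 }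
model₅ = record
  { D = ℕ ; _∔_ = ℕ._+_ ; _∙_ = ℕ._*_ ; norm = λ a → a % 5 ; reciprocal = λ a → a ℕ.* a ℕ.* a ; fifth-root = λ a → a
  ; 𝟘 = 0 ; 𝟙 = 1 ; -𝟙 = 4 ; eq = _≡ᵇ_ ; code = λ a → a ; q = 5 ; units = 1 ∷ 2 ∷ 3 ∷ 4 ∷ []
  ; r₀ = 1 ; r₁ = 1 ; r₂ = 0
  ; t₁ = mk 1 1 0 0 0 ; t₂ = mk 1 2 1 0 0 ; t₃ = mk 1 3 3 1 0 ; t₄ = mk 1 4 1 4 1 }
model₄ = record
  { D = Fin 4 ; _∔_ = _+₄_ ; _∙_ = _*₄_ ; norm = λ a → a ; reciprocal = λ a → a *₄ a ; fifth-root = λ a → a *₄ a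
  ; 𝟘 = 0F ; 𝟙 = 1F ; -𝟙 = 1F ; eq = λ a b → Fin.toℕ a ≡ᵇ Fin.toℕ b
  ; code = Fin.toℕ ; q = 4 ; units = 1F ∷ 2F ∷ 3F ∷ []
  ; r₀ = 1F ; r₁ = 0F ; r₂ = 1F
  ; t₁ = mk 0F 0F 0F 0F 1F ; t₂ = mk 1F 0F 1F 1F 0F ; t₃ = mk 0F 1F 1F 1F 0F ; t₄ = mk 1F 1F 0F 1F 1F }

≡ᵇ-sound : ∀ {a b} → (a ≡ᵇ b) ≡ true → a ≡ b
≡ᵇ-sound {a} {b} e = ℕₚ.≡ᵇ⇒≡ a b (subst Data.Bool.T (sym e) tt)
  where import Data.Bool

laws₂ : ModelLaws model₂
laws₂ = record
  { eq-sound = ≡ᵇ-sound ; norm∈digits = λ a → ∈-upTo⁺ (DivMod.m%n<n a 2) ; digits-count = refl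
  ; digits-apart = toWitness {a? = Finₚ.all? λ i → Finₚ.all? λ j → (_ ℕₚ.≟ 0) →-dec (i Finₚ.≟ j)} tt }

laws₃ : ModelLaws model₃
laws₃ = record
  { eq-sound = ≡ᵇ-sound ; norm∈digits = λ a → ∈-upTo⁺ (DivMod.m%n<n a 3) ; digits-count = refl
  ; digits-apart = toWitness {a? = Finₚ.all? λ i → Finₚ.all? λ j → (_ ℕₚ.≟ 0) →-dec (i Finₚ.≟ j)} tt }

laws₅ : ModelLaws model₅
laws₅ = record
  { eq-sound = ≡ᵇ-sound ; norm∈digits = λ a → ∈-upTo⁺ (DivMod.m%n<n a 5) ; digits-count = refl
  ; digits-apart = toWitness {a? = Finₚ.all? λ i → Finₚ.all? λ j → (_ ℕₚ.≟ 0) →-dec (i Finₚ.≟ j)} tt }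

laws₄ : ModelLaws model₄
laws₄ = record
  { eq-sound = λ e → Finₚ.toℕ-injective (≡ᵇ-sound e)
  ; norm∈digits = λ { 0F → here refl ; 1F → there (here refl) ; 2F → there (there (here refl)) ; 3F → there (there (there (here refl))) }
  ; digits-count = refl
  ; digits-apart = toWitness {a? = Finₚ.all? λ i → Finₚ.all? λ j → (_ Finₚ.≟ 0F) →-dec (i Finₚ.≟ j)} tt }

module _ (M : Model) where
  open Model M
  open Computation M
  open Verification M

  computations : all𝕂 (run inverseTest) ≡ true → all𝕂 (run fixedTest) ≡ true → frobenius-images ≡ true →
    all𝕂 (run hilbertTest) ≡ true → all𝕂 (run normOneTest) ≡ true →
    anyᵇ verify-T+T⁴ linePairs ≡ true → anyᵇ hasTraceOne traceOneCandidates ≡ true →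
    all𝕂 (run (traceZeroTest traceZeroRoots (traceHints 𝟘))) ≡ true →
    all𝕂 (run (traceOneTest traceZeroRoots (traceHints 𝟙))) ≡ true →
    All (λ d → all𝕂 (run (binomialTest traceZeroRoots (binomialHints (constant d)) (constant d))) ≡ true) digits → Verified
  computations inverses fixed images hilbert norm-ones T+T⁴ trace-ones trace-zeros trace-one-collisions binomials = record
    { inverses = everywhere inverseTest inverses
    ; fixed = everywhere fixedTest fixed
    ; images = images
    ; hilbert = everywhere hilbertTest hilbert
    ; norm-ones = everywhere normOneTest norm-ones
    ; T+T⁴ = somewhere verify-T+T⁴ linePairs T+T⁴
    ; trace-ones = somewhere hasTraceOne traceOneCandidates trace-ones
    ; roots = traceZeroRoots
    ; hints₀ = traceHints 𝟘
    ; hints₁ = traceHints 𝟙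
    ; hints = λ d → binomialHints (constant d)
    ; trace-zeros = everywhere (traceZeroTest traceZeroRoots (traceHints 𝟘)) trace-zeros
    ; trace-one-collisions = everywhere (traceOneTest traceZeroRoots (traceHints 𝟙)) trace-one-collisions
    ; binomials = λ {d} d∈ → everywhere (binomialTest traceZeroRoots (binomialHints (constant d)) (constant d)) (All.lookup binomials d∈)
    }

abstract
  -- Each `refl` for a condition on all tuples evaluates it over the whole of Fq[θ]. The list at the
  -- end has one entry for each c in Fq, which accounts for the q⁶ pairs (c, a).
  verified₂ : Verification.Verified model₂
  verified₂ = computations model₂ refl refl refl refl refl refl refl refl refl (refl ∷ refl ∷ [])

  verified₃ : Verification.Verified model₃
  verified₃ = computations model₃ refl refl refl refl refl refl refl refl refl (refl ∷ refl ∷ refl ∷ [])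

  verified₄ : Verification.Verified model₄
  verified₄ = computations model₄ refl refl refl refl refl refl refl refl refl (refl ∷ refl ∷ refl ∷ refl ∷ [])

  verified₅ : Verification.Verified model₅
  verified₅ = computations model₅ refl refl refl refl refl refl refl refl refl (refl ∷ refl ∷ refl ∷ refl ∷ refl ∷ [])

-- Comparing by a Boolean function keeps the intermediate results of the computation shared.
sameList : List ℕ → List ℕ → Bool
sameList [] [] = true
sameList (a ∷ as) (b ∷ bs) = (a ≡ᵇ b) ∧ sameList as bs
sameList _ _ = false

sameList-sound : ∀ {as bs} → sameList as bs ≡ true → as ≡ bs
sameList-sound {[]} {[]} e = refl
sameList-sound {a ∷ as} {b ∷ bs} e = let (p , r) = ∧-elim {a ≡ᵇ b} e in cong₂ _∷_ (≡ᵇ-sound p) (sameList-sound r)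

-- Here and below the number of steps is the order of F minus the degree of the modulus: 2⁵ - 5, 3⁵
-- - 5, 4⁵ - 5, 4⁵ - 2 and 5⁵ - 5. The result X says that the modulus divides Xⁿ - X.
X-power₂ : X-power 2 (0 ∷ 0 ∷ 1 ∷ 0 ∷ 1 ∷ []) 27 (0 ∷ 0 ∷ 1 ∷ 0 ∷ 1 ∷ []) ≡ 0 ∷ 0 ∷ 0 ∷ 1 ∷ 0 ∷ []
X-power₂ = sameList-sound {X-power 2 (0 ∷ 0 ∷ 1 ∷ 0 ∷ 1 ∷ []) 27 (0 ∷ 0 ∷ 1 ∷ 0 ∷ 1 ∷ [])} refl

X-power₃ : X-power 3 (0 ∷ 0 ∷ 0 ∷ 1 ∷ 2 ∷ []) 238 (0 ∷ 0 ∷ 0 ∷ 1 ∷ 2 ∷ []) ≡ 0 ∷ 0 ∷ 0 ∷ 1 ∷ 0 ∷ []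
X-power₃ = sameList-sound {X-power 3 (0 ∷ 0 ∷ 0 ∷ 1 ∷ 2 ∷ []) 238 (0 ∷ 0 ∷ 0 ∷ 1 ∷ 2 ∷ [])} refl

X-power₄ : X-power 2 (0 ∷ 0 ∷ 1 ∷ 0 ∷ 1 ∷ []) 1019 (0 ∷ 0 ∷ 1 ∷ 0 ∷ 1 ∷ []) ≡ 0 ∷ 0 ∷ 0 ∷ 1 ∷ 0 ∷ []
X-power₄ = sameList-sound {X-power 2 (0 ∷ 0 ∷ 1 ∷ 0 ∷ 1 ∷ []) 1019 (0 ∷ 0 ∷ 1 ∷ 0 ∷ 1 ∷ [])} refl

X-power-ω : X-power 2 (1 ∷ 1 ∷ []) 1022 (1 ∷ 1 ∷ []) ≡ 1 ∷ 0 ∷ []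
X-power-ω = sameList-sound {X-power 2 (1 ∷ 1 ∷ []) 1022 (1 ∷ 1 ∷ [])} refl

X-power₅ : X-power 5 (0 ∷ 0 ∷ 0 ∷ 1 ∷ 1 ∷ []) 3120 (0 ∷ 0 ∷ 0 ∷ 1 ∷ 1 ∷ []) ≡ 0 ∷ 0 ∷ 0 ∷ 1 ∷ 0 ∷ []
X-power₅ = sameList-sound {X-power 5 (0 ∷ 0 ∷ 0 ∷ 1 ∷ 1 ∷ []) 3120 (0 ∷ 0 ∷ 0 ∷ 1 ∷ 1 ∷ [])} refl

module FrobeniusMap (F : Field) (q : ℕ) (finite : Fin (q ℕ.^ 5) ↔ Field.Carrier F)
  (additive : ∀ x y → _^ᶠ_ F (Field._+_ F x y) q ≡ Field._+_ F (_^ᶠ_ F x q) (_^ᶠ_ F y q)) where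
  open FieldKit F
  open FiniteField F
  open ≡-Reasoning

  *-^ : ∀ x y k → (x * y) ^ k ≡ x ^ k * y ^ k
  *-^ x y zero = sym (*-identityˡ 1#)
  *-^ x y (suc k) = trans (cong (x * y *_) (*-^ x y k))
    (solve 4 (λ x y a b → x :* y :* (a :* b) := (x :* a) :* (y :* b)) refl x y (x ^ k) (y ^ k))

  q-power-suc : ∀ x s → (x ^ (q ℕ.^ s)) ^ q ≡ x ^ (q ℕ.^ suc s)
  q-power-suc x s = sym (^-* x q (q ℕ.^ s))

  frobenius : Frobenius F (q ℕ.^ 5)
  frobenius = record
    { finite = finite
    ; T = _^ q
    ; T-+ = additive
    ; T-* = λ x y → *-^ x y q
    ; T⁵-identity = λ x → begin
        ((((x ^ q) ^ q) ^ q) ^ q) ^ q ≡⟨ cong (λ y → ((((y ^ q) ^ q) ^ q) ^ q) ^ q) (sym (*-identityʳ x)) ⟩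
        (((((x ^ (q ℕ.^ 0)) ^ q) ^ q) ^ q) ^ q) ^ q ≡⟨ cong (λ y → (((y ^ q) ^ q) ^ q) ^ q) (q-power-suc x 0) ⟩
        ((((x ^ (q ℕ.^ 1)) ^ q) ^ q) ^ q) ^ q ≡⟨ cong (λ y → ((y ^ q) ^ q) ^ q) (q-power-suc x 1) ⟩
        (((x ^ (q ℕ.^ 2)) ^ q) ^ q) ^ q ≡⟨ cong (λ y → (y ^ q) ^ q) (q-power-suc x 2) ⟩
        ((x ^ (q ℕ.^ 3)) ^ q) ^ q ≡⟨ cong (_^ q) (q-power-suc x 3) ⟩
        (x ^ (q ℕ.^ 4)) ^ q ≡⟨ q-power-suc x 4 ⟩
        x ^ (q ℕ.^ 5) ≡⟨ fermat (q ℕ.^ 5) finite x ⟩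
        x ∎
    }

  open Frobenius frobenius using (T; T-0; T-1; T-+)

  ι-fixed : ∀ k → T (ι k) ≡ ι k
  ι-fixed zero = T-0
  ι-fixed (suc k) = begin
    T (ι (suc k)) ≡⟨ cong T (ι-suc k) ⟩
    T (1# + ι k) ≡⟨ trans (T-+ 1# (ι k)) (cong₂ _+_ T-1 (ι-fixed k)) ⟩
    1# + ι k ≡⟨ sym (ι-suc k) ⟩
    ι (suc k) ∎

module _ (F : Field) where
  open FieldKit F
  open FiniteField F

  private
    value-X : ∀ x → value (0 ∷ 0 ∷ 0 ∷ 1 ∷ 0 ∷ []) x ≡ x
    value-X = solve 1 (λ x → :0 :* (x :* (x :* (x :* (x :* :1)))) :+ (:0 :* (x :* (x :* (x :* :1))) :+ (:0 :* (x :* (x :* :1))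
      :+ (:1 :* (x :* :1) :+ (:0 :* :1 :+ :0)))) := x) refl

    quintic : ∀ r₀ r₁ r₂ θ → θ ^ 5 ≡ value (0 ∷ 0 ∷ r₂ ∷ r₁ ∷ r₀ ∷ []) θ → θ * (θ * (θ * (θ * θ))) ≡ ι r₀ + θ * (ι r₁ + θ * ι r₂)
    quintic r₀ r₁ r₂ θ e = trans (solve 1 (λ t → t :* (t :* (t :* (t :* t))) := t :* (t :* (t :* (t :* (t :* :1))))) refl θ) (trans e
      (solve 4 (λ t r₀ r₁ r₂ → :0 :* (t :* (t :* (t :* (t :* :1)))) :+ (:0 :* (t :* (t :* (t :* :1))) :+ (r₂ :* (t :* (t :* :1))
        :+ (r₁ :* (t :* :1) :+ (r₀ :* :1 :+ :0)))) := r₀ :+ t :* (r₁ :+ t :* r₂)) refl θ (ι r₀) (ι r₁) (ι r₂)))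

    minus-one : ∀ k → ι (suc k) ≡ 0# → ι k ≡ - 1#
    minus-one k e = linear₁ (trans (sym (ι-suc k)) e) 1# (solve 1 (λ k → k :- (:- :1) := :1 :* ((:1 :+ k) :- :0)) refl (ι k))

  module Order₂ (finite : Fin (2 ℕ.^ 5) ↔ Carrier) where
    abstract
      char : ι 2 ≡ 0#
      char = prime-power-zero 2 5 (cardinality-zero finite) finite

      additive : ∀ x y → (x + y) ^ 2 ≡ x ^ 2 + y ^ 2
      additive x y = linear₁ char (x * y)
        (solve 2 (λ x y → (x :+ y) :* ((x :+ y) :* :1) :- (x :* (x :* :1) :+ y :* (y :* :1)) := (x :* y) :* (con (2 , 0) :- :0)) refl x y)

    open FrobeniusMap F 2 finite additive public

    abstract
      root : ∃[ θ ] θ ^ 5 ≡ value (0 ∷ 0 ∷ 1 ∷ 0 ∷ 1 ∷ []) θ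
      root = RootExistence.root-exists 2 F char (0 ∷ 0 ∷ 1 ∷ 0 ∷ 1 ∷ []) {27} finite (s≤s z≤n) refl X-power₂ value-X

    realisation : Realisation model₂ frobenius
    realisation = record
      { T-power = λ x → refl ; ι = ι ; ι-∔ = ι-+ ; ι-∙ = ι-* ; ι-norm = ι-% ; ι-𝟘 = refl ; ι-𝟙 = refl ; ι--𝟙 = minus-one 1 char
      ; ι-fixed = ι-fixed ; θ = proj₁ root ; θ⁵ = quintic 1 0 1 (proj₁ root) (proj₂ root) }
      where
        open Characteristic 2 F char

  module Order₃ (finite : Fin (3 ℕ.^ 5) ↔ Carrier) where
    abstract
      char : ι 3 ≡ 0#
      char = prime-power-zero 3 5 (cardinality-zero finite) finite

      additive : ∀ x y → (x + y) ^ 3 ≡ x ^ 3 + y ^ 3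
      additive x y = linear₁ char (x * y * (x + y))
        (solve 2 (λ x y → (x :+ y) :* ((x :+ y) :* ((x :+ y) :* :1)) :- (x :* (x :* (x :* :1)) :+ y :* (y :* (y :* :1)))
          := (x :* y :* (x :+ y)) :* (con (3 , 0) :- :0)) refl x y)

    open FrobeniusMap F 3 finite additive public

    abstract
      root : ∃[ θ ] θ ^ 5 ≡ value (0 ∷ 0 ∷ 0 ∷ 1 ∷ 2 ∷ []) θ
      root = RootExistence.root-exists 3 F char (0 ∷ 0 ∷ 0 ∷ 1 ∷ 2 ∷ []) {238} finite (s≤s z≤n) refl X-power₃ value-X

    realisation : Realisation model₃ frobenius
    realisation = record
      { T-power = λ x → refl ; ι = ι ; ι-∔ = ι-+ ; ι-∙ = ι-* ; ι-norm = ι-% ; ι-𝟘 = refl ; ι-𝟙 = refl ; ι--𝟙 = minus-one 2 char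
      ; ι-fixed = ι-fixed ; θ = proj₁ root ; θ⁵ = quintic 2 1 0 (proj₁ root) (proj₂ root) }
      where
        open Characteristic 3 F char

  module Order₅ (finite : Fin (5 ℕ.^ 5) ↔ Carrier) where
    abstract
      char : ι 5 ≡ 0#
      char = prime-power-zero 5 5 (cardinality-zero finite) finite

      additive : ∀ x y → (x + y) ^ 5 ≡ x ^ 5 + y ^ 5
      additive x y = linear₁ char (x * y * (x + y) * (x * x + x * y + y * y))
        (solve 2 (λ x y → (x :+ y) :* ((x :+ y) :* ((x :+ y) :* ((x :+ y) :* ((x :+ y) :* :1))))
            :- (x :* (x :* (x :* (x :* (x :* :1)))) :+ y :* (y :* (y :* (y :* (y :* :1)))))
          := (x :* y :* (x :+ y) :* (x :* x :+ x :* y :+ y :* y)) :* (con (5 , 0) :- :0)) refl x y)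

    open FrobeniusMap F 5 finite additive public

    abstract
      root : ∃[ θ ] θ ^ 5 ≡ value (0 ∷ 0 ∷ 0 ∷ 1 ∷ 1 ∷ []) θ
      root = RootExistence.root-exists 5 F char (0 ∷ 0 ∷ 0 ∷ 1 ∷ 1 ∷ []) {3120} finite (s≤s z≤n) refl X-power₅ value-X

    realisation : Realisation model₅ frobenius
    realisation = record
      { T-power = λ x → refl ; ι = ι ; ι-∔ = ι-+ ; ι-∙ = ι-* ; ι-norm = ι-% ; ι-𝟘 = refl ; ι-𝟙 = refl ; ι--𝟙 = minus-one 4 char
      ; ι-fixed = ι-fixed ; θ = proj₁ root ; θ⁵ = quintic 1 1 0 (proj₁ root) (proj₂ root) }
      where
        open Characteristic 5 F char

  module Order₄ (finite : Fin (4 ℕ.^ 5) ↔ Carrier) where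
    open ≡-Reasoning

    abstract
      char : ι 2 ≡ 0#
      char = prime-power-zero 2 10 (cardinality-zero finite) finite

      additive : ∀ x y → (x + y) ^ 4 ≡ x ^ 4 + y ^ 4
      -- The difference (x + y)⁴ - x⁴ - y⁴ is 2 · xy(2x² + 3xy + 2y²), with the inner coefficients
      -- written as repeated sums.
      additive x y = linear₁ char (x * y * (x * x + x * x + x * y + x * y + x * y + y * y + y * y))
        (solve 2 (λ x y → (x :+ y) :* ((x :+ y) :* ((x :+ y) :* ((x :+ y) :* :1)))
            :- (x :* (x :* (x :* (x :* :1))) :+ y :* (y :* (y :* (y :* :1))))
          := (x :* y :* (x :* x :+ x :* x :+ x :* y :+ x :* y :+ x :* y :+ y :* y :+ y :* y)) :* (con (2 , 0) :- :0)) refl x y)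

    open FrobeniusMap F 4 finite additive public
    open Frobenius frobenius using (T; T-+; T-*)
    open Characteristic 2 F char

    abstract
     -- F₄ is not given inside F; it is generated by a root of X² + X + 1, found in the same way as
     -- θ.
     root-ω : ∃[ ω ] ω ^ 2 ≡ value (1 ∷ 1 ∷ []) ω
     root-ω = RootExistence.root-exists 2 F char (1 ∷ 1 ∷ []) {1022} finite (s≤s z≤n) refl
       X-power-ω (solve 1 (λ x → :1 :* (x :* :1) :+ (:0 :* :1 :+ :0) := x) refl)

    ω : Carrier
    ω = proj₁ root-ω

    ω² : ω * ω ≡ 1# + ω
    ω² = trans (solve 1 (λ w → w :* w := w :* (w :* :1)) refl ω) (trans (proj₂ root-ω)
      (solve 1 (λ w → :1 :* (w :* :1) :+ (:1 :* :1 :+ :0) := :1 :+ w) refl ω))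

    abstract
     root-θ : ∃[ θ ] θ ^ 5 ≡ value (0 ∷ 0 ∷ 1 ∷ 0 ∷ 1 ∷ []) θ
     root-θ = RootExistence.root-exists 2 F char (0 ∷ 0 ∷ 1 ∷ 0 ∷ 1 ∷ []) {1019} finite (s≤s z≤n) refl X-power₄ value-X

    Tω : T ω ≡ ω
    Tω = linear₂ ω² (ω * ω + ω + 1# + 1#) char (ω + 1#) (solve 1 (λ w → w :* (w :* (w :* (w :* :1))) :- w
      := (w :* w :+ w :+ :1 :+ :1) :* (w :* w :- (:1 :+ w)) :+ (w :+ :1) :* (con (2 , 0) :- :0)) refl ω)

    ι₂ : ℕ × ℕ → Carrier
    ι₂ (a , b) = ι a + ι b * ω

    reduced : ℕ → ℕ → ℕ × ℕ
    reduced a b = (a % 2 , b % 2)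

    ι₂-reduced : ∀ a b → ι₂ (reduced a b) ≡ ι₂ (a , b)
    ι₂-reduced a b = cong₂ (λ s t → s + t * ω) (ι-% a) (ι-% b)

    ι₄ : Fin 4 → Carrier
    ι₄ a = ι₂ (coordinates a)

    coordinates-+ : ∀ i j → let (a , b) = coordinates i
                                (c , d) = coordinates j
                            in coordinates (i +₄ j) ≡ reduced (a ℕ.+ c) (b ℕ.+ d)
    coordinates-+ = toWitness {a? = Finₚ.all? λ i → Finₚ.all? λ j → ≡-dec ℕₚ._≟_ ℕₚ._≟_ _ _} tt

    coordinates-* : ∀ i j → let (a , b) = coordinates i
                                (c , d) = coordinates j
                            in coordinates (i *₄ j) ≡ reduced (a ℕ.* c ℕ.+ b ℕ.* d) (a ℕ.* d ℕ.+ b ℕ.* c ℕ.+ b ℕ.* d)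
    coordinates-* = toWitness {a? = Finₚ.all? λ i → Finₚ.all? λ j → ≡-dec ℕₚ._≟_ ℕₚ._≟_ _ _} tt

    ι₄-+ : ∀ i j → ι₄ (i +₄ j) ≡ ι₄ i + ι₄ j
    ι₄-+ i j = begin
      ι₄ (i +₄ j) ≡⟨ cong ι₂ (coordinates-+ i j) ⟩
      ι₂ (reduced (a ℕ.+ c) (b ℕ.+ d)) ≡⟨ ι₂-reduced (a ℕ.+ c) (b ℕ.+ d) ⟩
      ι (a ℕ.+ c) + ι (b ℕ.+ d) * ω ≡⟨ cong₂ (λ s t → s + t * ω) (ι-+ a c) (ι-+ b d) ⟩
      (ι a + ι c) + (ι b + ι d) * ω ≡⟨ solve 5 (λ a b c d w → (a :+ c) :+ (b :+ d) :* w := (a :+ b :* w) :+ (c :+ d :* w)) refl (ι a) (ι b) (ι c) (ι d) ω ⟩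
      ι₄ i + ι₄ j ∎
      where
        a = proj₁ (coordinates i)
        b = proj₂ (coordinates i)
        c = proj₁ (coordinates j)
        d = proj₂ (coordinates j)

    ι₄-* : ∀ i j → ι₄ (i *₄ j) ≡ ι₄ i * ι₄ j
    ι₄-* i j = begin
      ι₄ (i *₄ j) ≡⟨ cong ι₂ (coordinates-* i j) ⟩
      ι₂ (reduced (a ℕ.* c ℕ.+ b ℕ.* d) (a ℕ.* d ℕ.+ b ℕ.* c ℕ.+ b ℕ.* d)) ≡⟨ ι₂-reduced (a ℕ.* c ℕ.+ b ℕ.* d) (a ℕ.* d ℕ.+ b ℕ.* c ℕ.+ b ℕ.* d) ⟩
      ι (a ℕ.* c ℕ.+ b ℕ.* d) + ι (a ℕ.* d ℕ.+ b ℕ.* c ℕ.+ b ℕ.* d) * ω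
        ≡⟨ cong₂ (λ s t → s + t * ω) (trans (ι-+ (a ℕ.* c) _) (cong₂ _+_ (ι-* a c) (ι-* b d)))
             (trans (ι-+ (a ℕ.* d ℕ.+ b ℕ.* c) _) (cong₂ _+_ (trans (ι-+ (a ℕ.* d) _) (cong₂ _+_ (ι-* a d) (ι-* b c))) (ι-* b d))) ⟩
      (ι a * ι c + ι b * ι d) + (ι a * ι d + ι b * ι c + ι b * ι d) * ω
        ≡⟨ linear₁ ω² (- (ι b * ι d)) (solve 5 (λ a b c d w → ((a :* c :+ b :* d) :+ (a :* d :+ b :* c :+ b :* d) :* w) :- (a :+ b :* w) :* (c :+ d :* w)
             := (:- (b :* d)) :* (w :* w :- (:1 :+ w))) refl (ι a) (ι b) (ι c) (ι d) ω) ⟩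
      ι₄ i * ι₄ j ∎
      where
        a = proj₁ (coordinates i)
        b = proj₂ (coordinates i)
        c = proj₁ (coordinates j)
        d = proj₂ (coordinates j)

    ι₄-fixed : ∀ i → T (ι₄ i) ≡ ι₄ i
    ι₄-fixed i = trans (T-+ (ι a) (ι b * ω)) (cong₂ _+_ (ι-fixed a) (trans (T-* (ι b) ω) (cong₂ _*_ (ι-fixed b) Tω)))
      where
        a = proj₁ (coordinates i)
        b = proj₂ (coordinates i)

    ι₄-0 : ι₄ 0F ≡ 0#
    ι₄-0 = solve 1 (λ w → :0 :+ :0 :* w := :0) refl ω

    ι₄-1 : ι₄ 1F ≡ 1#
    ι₄-1 = solve 1 (λ w → :1 :+ :0 :* w := :1) refl ω

    realisation : Realisation model₄ frobenius
    realisation = record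
      { T-power = λ x → refl ; ι = ι₄ ; ι-∔ = ι₄-+ ; ι-∙ = ι₄-* ; ι-norm = λ _ → refl ; ι-𝟘 = ι₄-0 ; ι-𝟙 = ι₄-1
      ; ι--𝟙 = trans ι₄-1 (minus-one 1 char)
      ; ι-fixed = ι₄-fixed ; θ = proj₁ root-θ
      ; θ⁵ = trans (quintic 1 0 1 (proj₁ root-θ) (proj₂ root-θ))
          (sym (cong₂ (λ s t → s + proj₁ root-θ * t) ι₄-1 (cong₂ (λ s t → s + proj₁ root-θ * t) ι₄-0 ι₄-1))) }

-- The classification for each q

module _ (M : Model) (laws : ModelLaws M) (computed : Verification.Verified M) {F : Field}
  (frobenius : Frobenius F (Model.q M ℕ.^ 5)) (realisation : Realisation M frobenius) where
  open Model M using (q; units)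
  open Soundness M laws computed frobenius realisation

  classification : suc ((1 ℕ.+ q ℕ.+ q ℕ.^ 2 ℕ.+ q ℕ.^ 3 ℕ.+ q ℕ.^ 4) ℕ.* length units) ≡ q ℕ.^ 5 →
    (u : Fin 5 → V F) → LinIndep F q u → MaxScattered F q u →
    PseudoregulusType F q (LinSet F q u) ⊎ LPType F q (LinSet F q u)
  classification count u independent maximum =
    MaximumScattered.pseudoregulus-or-LP q (length units) frobenius digits-of-Fq arithmetic count u independent maximum

not-prime-power-0 : ¬ IsPrimePower 0
not-prime-power-0 (p , k , p-prime , e) with ℕₚ.m^n≡0⇒m≡0 p (suc k) (sym e)
... | refl = ¬prime[0] p-prime

not-prime-power-1 : ¬ IsPrimePower 1
not-prime-power-1 (p , k , p-prime , e) with ℕₚ.m^n≡1⇒n≡0∨m≡1 p (suc k) (sym e)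
... | inj₂ refl = ¬prime[1] p-prime

open import Data.Nat using (_≤_; _^_)

theorem2p11 : (q : ℕ) → IsPrimePower q → q ≤ 5 →
    (F : Field) → HasCard F (q ^ 5) →
    (u : Fin 5 → V F) → LinIndep F q u → MaxScattered F q u →
    PseudoregulusType F q (LinSet F q u) ⊎ LPType F q (LinSet F q u)
theorem2p11 0 primePower _ _ _ = ⊥-elim (not-prime-power-0 primePower)
theorem2p11 1 primePower _ _ _ = ⊥-elim (not-prime-power-1 primePower)
-- The closing `refl` is the identity 1 + (1 + q + q² + q³ + q⁴)(q - 1) = q⁵ for the given q.
theorem2p11 2 _ _ F finite = classification model₂ laws₂ verified₂ (Order₂.frobenius F finite) (Order₂.realisation F finite) refl
theorem2p11 3 _ _ F finite = classification model₃ laws₃ verified₃ (Order₃.frobenius F finite) (Order₃.realisation F finite) refl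
theorem2p11 4 _ _ F finite = classification model₄ laws₄ verified₄ (Order₄.frobenius F finite) (Order₄.realisation F finite) refl
theorem2p11 5 _ _ F finite = classification model₅ laws₅ verified₅ (Order₅.frobenius F finite) (Order₅.realisation F finite) refl
theorem2p11 (suc (suc (suc (suc (suc (suc _)))))) _ (s≤s (s≤s (s≤s (s≤s (s≤s ()))))) _ _
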